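{- For every $\delta > 0$ there exists $\delta' > 0$ such that for all sufficiently large $n$, every $(n,(3-\delta')n)$-multigraph with multiplicity at most $(1-\delta)n$ contains a rainbow matching of size $n$.
   Context: An $(n,v)$-multigraph is a multigraph whose edges are coloured with a set of $n$ colours (parallel edges allowed, with distinct colours) such that each colour class is a vertex-disjoint union of cliques on at least $2$ vertices which together have at least $v$ vertices. The multiplicity is the maximum number of edges joining a single pair of vertices. A rainbow matching is a matching whose edges have pairwise distinct colours. -}

module Defs where

open import Data.Fin using (Fin)
open import Data.Fin.Subset using (Subset; _∈_; _∩_; ⋃; ∣_∣; Empty)
open import Data.Integer using (+_)
open import Data.List using (List; []; _∷_; map; length; filter; allFin; cartesianProductWith)
open import Data.List.Extrema.Nat using (max)
open import Data.List.Relation.Binary.Disjoint.Propositional using (Disjoint)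
open import Data.List.Relation.Unary.All using (All)
open import Data.List.Relation.Unary.AllPairs using (AllPairs)
open import Data.List.Relation.Unary.Any using (Any)
open import Data.List.Relation.Unary.Unique.Propositional using (Unique)
open import Data.Nat as ℕ using (ℕ)
open import Data.Product using (_×_; ∃-syntax)
open import Data.Rational as ℚ using (ℚ; _/_)
open import Function.Bundles using (_⇔_)
open import Level using (0ℓ)
open import Relation.Binary.Core using (Rel)
open import Relation.Binary.Definitions using (Decidable; Symmetric)
open import Relation.Binary.PropositionalEquality using (_≡_; _≢_)
open import Relation.Nullary using (¬_)

-- Real parameters δ, δ′ are taken in ℚ.  Nothing is lost: shrinking δ weakens
-- the bound (1 - δ)n on the multiplicity, and shrinking δ′ strengthens the
-- bound (3 - δ′)n on the colour classes, so both may be made rational.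
fromℕ : ℕ → ℚ
fromℕ k = + k / 1

-- Parallel edges have distinct colours, so an edge is determined by its
-- colour and its two endpoints: `Joined c u w` says that there is an edge of
-- colour `c` between `u` and `w`.
record ColouredMultigraph (n : ℕ) : Set₁ where
  field
    order   : ℕ
    Joined  : Fin n → Rel (Fin order) 0ℓ
    joined? : ∀ c → Decidable (Joined c)
    sym     : ∀ c → Symmetric (Joined c)
    irrefl  : ∀ c u → ¬ Joined c u u

-- The relation `E` is the edge set of a vertex-disjoint union of cliques, each
-- on at least 2 vertices, with at least `v` vertices in total.  Vertices of
-- `Fin m` outside every clique are allowed; they do not count towards `v`.
-- The bound `v` is rational so that no rounding of (3 - δ′)n is needed.
record IsDisjointUnionOfCliques {m : ℕ} (v : ℚ) (E : Rel (Fin m) 0ℓ) : Set where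
  field
    cliques  : List (Subset m)
    disjoint : AllPairs (λ K L → Empty (K ∩ L)) cliques
    size≥2   : All (λ K → 2 ℕ.≤ ∣ K ∣) cliques
    edges    : ∀ u w → E u w ⇔ (u ≢ w × Any (λ K → u ∈ K × w ∈ K) cliques)
    total≥v  : v ℚ.≤ fromℕ ∣ ⋃ cliques ∣

Is⟨_,_⟩-multigraph : (n : ℕ) (v : ℚ) → ColouredMultigraph n → Set
Is⟨ n , v ⟩-multigraph G = ∀ c → IsDisjointUnionOfCliques v (Joined c)
  where open ColouredMultigraph G

module _ {n : ℕ} (G : ColouredMultigraph n) where
  open ColouredMultigraph G

  edgesBetween : Fin order → Fin order → ℕ
  edgesBetween u w = length (filter (λ c → joined? c u w) (allFin n))

  -- The pairs (u , u) included here contribute 0, by `irrefl`.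
  multiplicity : ℕ
  multiplicity = max 0 (cartesianProductWith edgesBetween (allFin order) (allFin order))

  record Edge : Set where
    field
      colour    : Fin n
      end₁ end₂ : Fin order
      joined    : Joined colour end₁ end₂

    ends : List (Fin order)
    ends = end₁ ∷ end₂ ∷ []

  -- Vertex-disjoint edges are distinct, so the length of a list satisfying
  -- this is the number of edges of the matching.
  IsMatching : List Edge → Set
  IsMatching = AllPairs (λ e f → Disjoint (Edge.ends e) (Edge.ends f))

  IsRainbow : List Edge → Set
  IsRainbow es = Unique (map Edge.colour es)

  HasRainbowMatchingOfSize : ℕ → Set
  HasRainbowMatchingOfSize k =
    ∃[ es ] (IsMatching es × IsRainbow es × length es ≡ k)

{-# OPTIONS --safe #-}

-- Let M be a rainbow matching which misses at least w colours, for a small w linear in n.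
-- If a missing colour d joins an uncovered vertex u to an end x of the edge xy of M of
-- colour k, then xy can be exchanged for xu: now k is missing and y is uncovered.  Let R be
-- the set of colours that can be made missing by boundedly many exchanges, in many ways; by
-- pigeonhole on the number of rounds, one further round hardly enlarges R.  For c in R,
-- vertices that can be set free at the same time are not joined in colour c, or else M can
-- be augmented.  Hence a clique of colour c contains essentially only one uncovered or
-- freeable vertex, unless it contains both ends of an edge of M.  Since each missing colour
-- reaches nearly n uncovered vertices, nearly every edge of M has a freeable end, and it
-- follows that c covers at most about 2n + π(c) vertices, where π(c) is the number of edges
-- of M parallel to an edge of colour c.  Coverage close to 3n forces π(c) to be close to n
-- for nearly all c, so that some edge has multiplicity above (1 - δ)n.
--
-- So M can be augmented until fewer than w colours are missing.  To finish, this is applied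
-- outside a random set S of vertices, which contains only a small fraction of the vertices
-- covered by each colour but still 2w disjoint edges of each colour: the missing colours are
-- then served greedily inside S.

module Submission where

open import Defs

-- The obstacle is that a colour is freed by a whole chain of exchanges, and that augmenting takes
-- three chains at once: one for the colour `c` and one for each end of the new edge. No edge of M
-- may be broken twice and no uncovered vertex used twice. With at most `L` rounds every chain is
-- short, so that `K` = 3L + 5 bounds the colours and the vertices ever touched, and a choice with
-- enough candidates avoids all of them. The candidates for an exchange at `x` are colours `d`, each
-- with an uncovered vertex `u`, and many of them may share the same `u`. Hence a dichotomy. If at
-- least `Λ` colours hit `x` through one `u`, that `u` is booked in advance (`own`), and few colours
-- book the same vertex. Otherwise only hits at non-heavy pairs count, and `Γ` colours with such
-- hits cannot be blocked by forbidding a few `u`. Hits of neither kind are lost. They cost at most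
-- 2nΓ over all colours, which is negligible only when averaged over linearly many colours of `R`.
-- This is why augmentation stops at `w` missing colours and a reserved set has to take over.

module RainbowMatchings where
  open import Data.Nat hiding (_≟_; _/_; _%_)
  open import Data.Nat.Properties hiding (_≟_; 0≢1+n) renaming (suc-injective to ℕ-suc-injective)
  open import Data.Fin using (Fin; zero; suc)
  open import Data.Fin.Properties using (_≟_; any?; suc-injective; 0≢1+n)
  open import Data.Product using (_×_; _,_; proj₁; proj₂; ∃)
  open import Data.Product.Properties using () renaming (≡-dec to ×-≡-dec)
  open import Data.Sum using (_⊎_; inj₁; inj₂; [_,_]′)
  open import Data.Empty using (⊥; ⊥-elim)
  open import Function using (_∘_; id; case_of_)
  open import Relation.Nullary using (¬_; Dec; yes; no; contradiction; ¬?; _×-dec_; _⊎-dec_)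
  open import Relation.Nullary.Decidable using (map′; decidable-stable)
  open import Relation.Binary.PropositionalEquality
  open import Algebra.Properties.Semiring.Sum +-*-semiring
    using (sum; ∑-distrib-+; ∑-comm; *-distribˡ-sum; *-distribʳ-sum; sum-cong-≗)
  open import Data.List using (List; []; _∷_; _++_; length)
  open import Data.List.Membership.Propositional using (_∈_; _∉_; lose)
  open import Data.List.Relation.Unary.Any using (here; there)
  import Data.List.Membership.DecPropositional as ListDec
  open import Data.Maybe using (Maybe; just; nothing)
  open import Data.Maybe.Properties using (just-injective; ≡-dec)
  import Data.List.Relation.Unary.Any as Any
  open import Data.List.Properties using (length-++)
  open import Data.List.Membership.Propositional.Properties using (∈-++⁺ˡ; ∈-++⁺ʳ; ∈-++⁻)
  open import Data.Nat.Tactic.RingSolver using (solve-∀)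
  open import Data.Nat.DivMod using (_/_; _%_; m/n*n≤m; m≡m%n+[m/n]*n; m%n<n; m*n/n≡m; /-monoˡ-≤)
  open import Data.Vec as Vec using (Vec; []; _∷_; lookup; _[_]≔_)
  open import Data.Vec.Properties using (lookup∘updateAt; lookup∘updateAt′)
  open import Data.List.Relation.Unary.All as All using (All; []; _∷_)
  open import Data.List.Relation.Unary.AllPairs using ([]; _∷_)
  open import Data.List.Relation.Unary.Unique.Propositional using (Unique)
  open import Data.List.Relation.Unary.All.Properties using (¬Any⇒All¬)

  -- Counting with sums of indicators.

  𝟙 : {P : Set} → Dec P → ℕ
  𝟙 (yes _) = 1
  𝟙 (no  _) = 0

  𝟙≤1 : {P : Set} (d : Dec P) → 𝟙 d ≤ 1
  𝟙≤1 (yes _) = ≤-refl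
  𝟙≤1 (no  _) = z≤n

  𝟙-mono : {P Q : Set} (d : Dec P) (e : Dec Q) → (P → Q) → 𝟙 d ≤ 𝟙 e
  𝟙-mono (yes p) (yes _) f = ≤-refl
  𝟙-mono (yes p) (no ¬q) f = contradiction (f p) ¬q
  𝟙-mono (no  _) e       f = z≤n

  𝟙-yes : {P : Set} (d : Dec P) → P → 𝟙 d ≡ 1
  𝟙-yes (yes _) p = refl
  𝟙-yes (no ¬p) p = contradiction p ¬p

  𝟙-no : {P : Set} (d : Dec P) → ¬ P → 𝟙 d ≡ 0
  𝟙-no (yes p) ¬p = contradiction p ¬p
  𝟙-no (no  _) ¬p = refl

  𝟙-⊎ : {P Q R : Set} (d : Dec P) (e : Dec Q) (f : Dec R) → (P → Q ⊎ R) → 𝟙 d ≤ 𝟙 e + 𝟙 f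
  𝟙-⊎ (no _)  e f h = z≤n
  𝟙-⊎ (yes p) e f h with h p
  ... | inj₁ q = ≤-trans (≤-reflexive (sym (𝟙-yes e q))) (m≤m+n _ _)
  ... | inj₂ r = ≤-trans (≤-reflexive (sym (𝟙-yes f r))) (m≤n+m _ (𝟙 e))

  sum-mono : ∀ {k} {f g : Fin k → ℕ} → (∀ i → f i ≤ g i) → sum f ≤ sum g
  sum-mono {zero}  h = z≤n
  sum-mono {suc k} h = +-mono-≤ (h zero) (sum-mono (h ∘ suc))

  sum-mono-< : ∀ {k} {f g : Fin k → ℕ} → 0 < k → (∀ i → f i < g i) → sum f < sum g
  sum-mono-< {suc k} _ h = +-mono-<-≤ (h zero) (sum-mono (<⇒≤ ∘ h ∘ suc))

  sum-const : ∀ k c → sum {k} (λ _ → c) ≡ k * c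
  sum-const zero    c = refl
  sum-const (suc k) c = cong (c +_) (sum-const k c)

  sum-zero : ∀ {k} {f : Fin k → ℕ} → (∀ i → f i ≡ 0) → sum f ≡ 0
  sum-zero {k} h = trans (sum-cong-≗ h) (trans (sum-const k 0) (*-zeroʳ k))

  term≤sum : ∀ {k} (f : Fin k → ℕ) i → f i ≤ sum f
  term≤sum f zero    = m≤m+n _ _
  term≤sum f (suc i) = ≤-trans (term≤sum (f ∘ suc) i) (m≤n+m _ (f zero))

  sum-exchange : ∀ {k} {f g : Fin k → ℕ} c → (∀ i → i ≢ c → f i ≡ g i) → sum f + g c ≡ sum g + f c
  sum-exchange {f = f} {g} zero h rewrite sum-cong-≗ (λ i → h (suc i) (λ ())) =
    trans (+-assoc (f zero) _ _) (trans (+-comm (f zero) _) (cong (_+ f zero) (+-comm _ (g zero))))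
  sum-exchange {f = f} {g} (suc c) h =
    trans (+-assoc (f zero) _ _)
    (trans (cong₂ _+_ (h zero (λ ())) (sum-exchange c (λ i i≢ → h (suc i) (i≢ ∘ suc-injective))))
           (sym (+-assoc (g zero) _ _)))

  # : ∀ {k} {P : Fin k → Set} → (∀ i → Dec (P i)) → ℕ
  # P? = sum (λ i → 𝟙 (P? i))

  module _ {k : ℕ} {P : Fin k → Set} (P? : ∀ i → Dec (P i)) where

    #-bound : # P? ≤ k
    #-bound = ≤-trans (sum-mono (λ i → 𝟙≤1 (P? i))) (≤-reflexive (trans (sum-const k 1) (*-identityʳ k)))

    #-complement : # P? + # (λ i → ¬? (P? i)) ≡ k
    #-complement = trans (sym (∑-distrib-+ _ (λ i → 𝟙 (¬? (P? i)))))
      (trans (sum-cong-≗ (λ i → h (P? i))) (trans (sum-const k 1) (*-identityʳ k)))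
      where
      h : {A : Set} (d : Dec A) → 𝟙 d + 𝟙 (¬? d) ≡ 1
      h (yes _) = refl
      h (no  _) = refl

    #-≥1 : ∀ i → P i → 1 ≤ # P?
    #-≥1 i p = ≤-trans (≤-reflexive (sym (𝟙-yes (P? i) p))) (term≤sum _ i)

    #-none : (∀ i → ¬ P i) → # P? ≡ 0
    #-none h = sum-zero (λ i → 𝟙-no (P? i) (h i))

  #-mono : ∀ {k} {P Q : Fin k → Set} (P? : ∀ i → Dec (P i)) (Q? : ∀ i → Dec (Q i)) →
    (∀ i → P i → Q i) → # P? ≤ # Q?
  #-mono P? Q? h = sum-mono (λ i → 𝟙-mono (P? i) (Q? i) (h i))

  #-⊎ : ∀ {k} {P Q R : Fin k → Set} (P? : ∀ i → Dec (P i)) (Q? : ∀ i → Dec (Q i)) (R? : ∀ i → Dec (R i)) →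
    (∀ i → P i → Q i ⊎ R i) → # P? ≤ # Q? + # R?
  #-⊎ P? Q? R? h = ≤-trans (sum-mono (λ i → 𝟙-⊎ (P? i) (Q? i) (R? i) (h i)))
    (≤-reflexive (∑-distrib-+ _ (λ i → 𝟙 (R? i))))

  #-unique : ∀ {k} {P : Fin k → Set} (P? : ∀ i → Dec (P i)) → (∀ i j → P i → P j → i ≡ j) → # P? ≤ 1
  #-unique {zero}  P? h = z≤n
  #-unique {suc k} P? h with P? zero
  ... | yes p = s≤s (≤-reflexive (#-none (P? ∘ suc) (λ i q → 0≢1+n (h _ _ p q))))
  ... | no  _ = #-unique (P? ∘ suc) (λ i j p q → suc-injective (h _ _ p q))

  #-pick : ∀ {k} {P Q : Fin k → Set} (P? : ∀ i → Dec (P i)) (Q? : ∀ i → Dec (Q i)) →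
    # Q? < # P? → ∃ λ i → P i × ¬ Q i
  #-pick P? Q? lt with any? (λ i → P? i ×-dec ¬? (Q? i))
  ... | yes r = r
  ... | no ¬r = contradiction lt (≤⇒≯ (#-mono P? Q? λ i p → h i p (Q? i)))
    where
    h : ∀ i → _ → Dec _ → _
    h i p (yes q) = q
    h i p (no ¬q) = contradiction (i , p , ¬q) ¬r

  -- Double counting of the pairs (i , j) related by `R` with `P i` and `Q j`: each row contains
  -- such a pair, each column at most one. Since `R` may be any relation, "joined in colour c" can
  -- serve as the charging rule.
  #-matching : ∀ {k l} {P : Fin k → Set} {Q : Fin l → Set} {R : Fin k → Fin l → Set}
    (P? : ∀ i → Dec (P i)) (Q? : ∀ j → Dec (Q j)) (R? : ∀ i j → Dec (R i j)) →
    (∀ i → P i → ∃ λ j → Q j × R i j) →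
    (∀ i i′ j → P i → P i′ → R i j → R i′ j → i ≡ i′) →
    # P? ≤ # Q?
  #-matching {k} {l} {P} {Q} {R} P? Q? R? total inj = begin
    sum (λ i → 𝟙 (P? i))              ≤⟨ sum-mono row ⟩
    sum (λ i → sum (λ j → 𝟙 (T? i j))) ≡⟨ ∑-comm (λ i j → 𝟙 (T? i j)) ⟩
    sum (λ j → sum (λ i → 𝟙 (T? i j))) ≤⟨ sum-mono column ⟩
    sum (λ j → 𝟙 (Q? j))              ∎
    where
    open ≤-Reasoning
    T? : ∀ i j → Dec (P i × Q j × R i j)
    T? i j = P? i ×-dec (Q? j ×-dec R? i j)
    row : ∀ i → 𝟙 (P? i) ≤ sum (λ j → 𝟙 (T? i j))
    row i with P? i in eq
    ... | no  _ = z≤n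
    ... | yes p with total i p
    ...   | j , q , r = ≤-trans (≤-reflexive (sym (𝟙-yes (T? i j) (p , q , r)))) (≤-trans (term≤sum (λ j′ → 𝟙 (T? i j′)) j) (sum-mono λ j′ → 𝟙-mono (T? i j′) _ λ t → p , proj₂ t))
    column : ∀ j → sum (λ i → 𝟙 (T? i j)) ≤ 𝟙 (Q? j)
    column j with Q? j
    ... | yes q = #-unique (λ i → P? i ×-dec (yes q ×-dec R? i j)) (λ i i′ t t′ → inj i i′ j (proj₁ t) (proj₁ t′) (proj₂ (proj₂ t)) (proj₂ (proj₂ t′)))
    ... | no ¬q = ≤-reflexive (#-none (λ i → P? i ×-dec (no ¬q ×-dec R? i j)) (λ i t → ¬q (proj₁ (proj₂ t))))

  module _ {k : ℕ} where
    open ListDec {A = Fin k} _≟_ public using (_∈?_)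

  #-∈ : ∀ {k} (xs : List (Fin k)) → # (λ i → i ∈? xs) ≤ length xs
  #-∈ {k} []   = ≤-reflexive (#-none {k} (λ i → i ∈? []) (λ i ()))
  #-∈ (x ∷ xs) = ≤-trans
    (#-⊎ (λ i → i ∈? (x ∷ xs)) (λ i → i ≟ x) (λ i → i ∈? xs) λ { i (here e) → inj₁ e ; i (there m) → inj₂ m })
    (+-mono-≤ (#-unique (λ i → i ≟ x) (λ i j p q → trans p (sym q))) (#-∈ xs))

  #-Any : ∀ {k} {A : Set} {P : A → Fin k → Set} (P? : ∀ a i → Dec (P a i)) {c} → (∀ a → # (P? a) ≤ c) →
    ∀ xs → # (λ i → Any.any? (λ a → P? a i) xs) ≤ length xs * c
  #-Any {k} P? h []       = ≤-reflexive (#-none {k} (λ i → Any.any? (λ a → P? a i) []) (λ i ()))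
  #-Any P? h (x ∷ xs) = ≤-trans
    (#-⊎ (λ i → Any.any? (λ a → P? a i) (x ∷ xs)) (P? x) (λ i → Any.any? (λ a → P? a i) xs)
      λ { i (here p) → inj₁ p ; i (there q) → inj₂ q })
    (+-mono-≤ (h x) (#-Any P? h xs))

  -- Clique colourings and rainbow matchings.

  record CliqueColouring (N n : ℕ) : Set₁ where
    field
      E       : Fin n → Fin N → Fin N → Set
      E?      : ∀ c u v → Dec (E c u v)
      E-sym   : ∀ {c u v} → E c u v → E c v u
      E-irr   : ∀ {c u} → ¬ E c u u
      -- Together with symmetry and irreflexivity this says that "equal or joined in colour c" is an
      -- equivalence relation; its classes with at least two elements are the cliques.
      E-trans : ∀ {c u v w} → E c u v → E c v w → u ≢ w → E c u w

    HasNeighbour : Fin n → Fin N → Set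
    HasNeighbour c v = ∃ λ w → E c v w

    abstract
      hasNeighbour? : ∀ c v → Dec (HasNeighbour c v)
      hasNeighbour? c v = any? (E? c v)

  -- A rainbow matching is kept as a partial assignment of edges to colours.
  Assignment : ℕ → ℕ → Set
  Assignment N n = Fin n → Maybe (Fin N × Fin N)

  module _ {N : ℕ} where

    On : Fin N → Maybe (Fin N × Fin N) → Set
    On z nothing        = ⊥
    On z (just (x , y)) = z ≡ x ⊎ z ≡ y

    abstract
      on? : ∀ z m → Dec (On z m)
      on? z nothing        = no id
      on? z (just (x , y)) = (z ≟ x) ⊎-dec (z ≟ y)

    Ends : Maybe (Fin N × Fin N) → Fin N → Fin N → Set
    Ends m x y = m ≡ just (x , y) ⊎ m ≡ just (y , x)

    maybe-pair-≟ : (m m′ : Maybe (Fin N × Fin N)) → Dec (m ≡ m′)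
    maybe-pair-≟ = ≡-dec (×-≡-dec _≟_ _≟_)

    abstract
      ends? : ∀ m x y → Dec (Ends m x y)
      ends? m x y = maybe-pair-≟ m _ ⊎-dec maybe-pair-≟ m _

    ends-left : ∀ {m x y} → Ends m x y → On x m
    ends-left (inj₁ refl) = inj₁ refl
    ends-left (inj₂ refl) = inj₂ refl

    ends-right : ∀ {m x y} → Ends m x y → On y m
    ends-right (inj₁ refl) = inj₂ refl
    ends-right (inj₂ refl) = inj₁ refl

    on-ends : ∀ {m x} → On x m → ∃ λ y → Ends m x y
    on-ends {just (x , y)} (inj₁ refl) = y , inj₁ refl
    on-ends {just (x , y)} (inj₂ refl) = x , inj₂ refl

    ends-cover : ∀ {m x y z} → Ends m x y → On z m → z ≡ x ⊎ z ≡ y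
    ends-cover (inj₁ refl) o        = o
    ends-cover (inj₂ refl) (inj₁ e) = inj₂ e
    ends-cover (inj₂ refl) (inj₂ e) = inj₁ e

  module _ {N n : ℕ} where

    Covered : Assignment N n → Fin N → Set
    Covered μ z = ∃ λ c → On z (μ c)

    abstract
      covered? : ∀ μ z → Dec (Covered μ z)
      covered? μ z = any? (λ c → on? z (μ c))

    missing? : ∀ (μ : Assignment N n) c → Dec (μ c ≡ nothing)
    missing? μ c = maybe-pair-≟ (μ c) nothing

    missing : Assignment N n → ℕ
    missing μ = # (missing? μ)

    _[_:=_] : Assignment N n → Fin n → Maybe (Fin N × Fin N) → Assignment N n
    (μ [ c := m ]) k with k ≟ c
    ... | yes _ = m
    ... | no  _ = μ k

    :=-same : ∀ μ c m → (μ [ c := m ]) c ≡ m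
    :=-same μ c m with c ≟ c
    ... | yes _  = refl
    ... | no c≢c = contradiction refl c≢c

    :=-other : ∀ μ c m {k} → k ≢ c → (μ [ c := m ]) k ≡ μ k
    :=-other μ c m {k} k≢c with k ≟ c
    ... | yes e = contradiction e k≢c
    ... | no  _ = refl

    missing-fill : ∀ {μ : Assignment N n} {c e} → μ c ≡ nothing → missing μ ≡ suc (missing (μ [ c := just e ]))
    missing-fill {μ} {c} {e} h = begin
      missing μ                    ≡⟨ sym (+-identityʳ _) ⟩
      missing μ + 0                ≡⟨ cong (missing μ +_) (sym (𝟙-no (missing? μ′ c) λ e → case trans (sym (:=-same μ c _)) e of λ ())) ⟩
      missing μ + 𝟙 (missing? μ′ c) ≡⟨ sum-exchange c (λ i i≢c → cong (λ m → 𝟙 (maybe-pair-≟ m nothing)) (sym (:=-other μ c _ i≢c))) ⟩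
      missing μ′ + 𝟙 (missing? μ c) ≡⟨ cong (missing μ′ +_) (𝟙-yes (missing? μ c) h) ⟩
      missing μ′ + 1               ≡⟨ +-comm _ 1 ⟩
      suc (missing μ′)             ∎
      where
      open ≡-Reasoning
      μ′ = μ [ c := just e ]

    missing-clear : ∀ {μ : Assignment N n} {c e} → μ c ≡ just e → missing (μ [ c := nothing ]) ≡ suc (missing μ)
    missing-clear {μ} {c} {e} h = begin
      missing μ′                    ≡⟨ sym (+-identityʳ _) ⟩
      missing μ′ + 0                ≡⟨ cong (missing μ′ +_) (sym (𝟙-no (missing? μ c) λ e → case trans (sym h) e of λ ())) ⟩
      missing μ′ + 𝟙 (missing? μ c) ≡⟨ sym (sum-exchange c (λ i i≢c → cong (λ m → 𝟙 (maybe-pair-≟ m nothing)) (sym (:=-other μ c _ i≢c)))) ⟩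
      missing μ + 𝟙 (missing? μ′ c) ≡⟨ cong (missing μ +_) (𝟙-yes (missing? μ′ c) (:=-same μ c nothing)) ⟩
      missing μ + 1               ≡⟨ +-comm _ 1 ⟩
      suc (missing μ)             ∎
      where
      open ≡-Reasoning
      μ′ = μ [ c := nothing ]

    on-clear : ∀ {μ c k z} → On z ((μ [ c := nothing ]) k) → k ≢ c × On z (μ k)
    on-clear {μ} {c} {k} o with k ≟ c
    ... | no k≢c = k≢c , o

    covered-clear : ∀ {μ c z} → Covered (μ [ c := nothing ]) z → Covered μ z
    covered-clear {μ} {c} (k , o) = k , proj₂ (on-clear {μ} {c} {k} o)

    on-fill : ∀ {μ c k x y z} → On z ((μ [ c := just (x , y) ]) k) → (k ≢ c × On z (μ k)) ⊎ (k ≡ c × (z ≡ x ⊎ z ≡ y))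
    on-fill {μ} {c} {k} o with k ≟ c
    ... | no k≢c = inj₁ (k≢c , o)
    ... | yes e = inj₂ (e , o)

    covered-fill : ∀ {μ c x y z} → Covered (μ [ c := just (x , y) ]) z → Covered μ z ⊎ (z ≡ x ⊎ z ≡ y)
    covered-fill {μ} {c} (k , o) with on-fill {μ} {c} {k} o
    ... | inj₁ (_ , p) = inj₁ (k , p)
    ... | inj₂ (_ , q) = inj₂ q

  module _ {N n : ℕ} (G : CliqueColouring N n) where
    open CliqueColouring G

    record IsRainbowMatching (μ : Assignment N n) : Set where
      field
        joined   : ∀ {c x y} → μ c ≡ just (x , y) → E c x y
        disjoint : ∀ {c c′ z} → On z (μ c) → On z (μ c′) → c ≡ c′

  module _ {N n : ℕ} {G : CliqueColouring N n} where
    open CliqueColouring G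
    open IsRainbowMatching

    clear-isRainbowMatching : ∀ {μ} → IsRainbowMatching G μ → ∀ c → IsRainbowMatching G (μ [ c := nothing ])
    clear-isRainbowMatching {μ} rm c .joined {k} e with k ≟ c
    ... | no _ = joined rm e
    clear-isRainbowMatching {μ} rm c .disjoint {k} {k′} o o′ =
      disjoint rm (proj₂ (on-clear {μ = μ} {c} {k} o)) (proj₂ (on-clear {μ = μ} {c} {k′} o′))

    uncovered-clear : ∀ {μ} → IsRainbowMatching G μ → ∀ {c z} → On z (μ c) → ¬ Covered (μ [ c := nothing ]) z
    uncovered-clear {μ} rm {c} o (k , p) with on-clear {μ = μ} {c} {k} p
    ... | k≢c , q = k≢c (disjoint rm q o)

    fill-isRainbowMatching : ∀ {μ} → IsRainbowMatching G μ → ∀ {c x y} → E c x y → ¬ Covered μ x → ¬ Covered μ y →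
      IsRainbowMatching G (μ [ c := just (x , y) ])
    fill-isRainbowMatching {μ} rm {c} e x∉ y∉ .joined {k} eq with k ≟ c
    ... | no _ = joined rm eq
    fill-isRainbowMatching {μ} rm {c} e x∉ y∉ .joined {k} refl | yes refl = e
    fill-isRainbowMatching {μ} rm {c} e x∉ y∉ .disjoint {k} {k′} o o′
      with on-fill {μ = μ} {c} {k} o | on-fill {μ = μ} {c} {k′} o′
    ... | inj₁ (_ , p) | inj₁ (_ , p′) = disjoint rm p p′
    ... | inj₂ (p , _) | inj₂ (p′ , _) = trans p (sym p′)
    ... | inj₁ (_ , p) | inj₂ (_ , inj₁ refl) = contradiction (_ , p) x∉
    ... | inj₁ (_ , p) | inj₂ (_ , inj₂ refl) = contradiction (_ , p) y∉
    ... | inj₂ (_ , inj₁ refl) | inj₁ (_ , p) = contradiction (_ , p) x∉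
    ... | inj₂ (_ , inj₂ refl) | inj₁ (_ , p) = contradiction (_ , p) y∉

    Augmented : Assignment N n → Set
    Augmented μ = ∃ λ μ′ → IsRainbowMatching G μ′ × missing μ ≡ suc (missing μ′)

    augment : ∀ {μ} → IsRainbowMatching G μ → ∀ {c x y} → μ c ≡ nothing → E c x y →
      ¬ Covered μ x → ¬ Covered μ y → Augmented μ
    augment {μ} rm c∅ e x∉ y∉ = _ , fill-isRainbowMatching rm e x∉ y∉ , missing-fill {μ = μ} c∅

    ends-joined : ∀ {μ} → IsRainbowMatching G μ → ∀ {c x y} → Ends (μ c) x y → E c x y
    ends-joined rm (inj₁ e) = joined rm e
    ends-joined rm (inj₂ e) = E-sym (joined rm e)

  module _ {N n : ℕ} (μ : Assignment N n) where

    private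
      Fst Snd : Fin N → Maybe (Fin N × Fin N) → Set
      Fst v nothing        = ⊥
      Fst v (just (x , y)) = v ≡ x
      Snd v nothing        = ⊥
      Snd v (just (x , y)) = v ≡ y

      fst? : ∀ v m → Dec (Fst v m)
      fst? v nothing        = no id
      fst? v (just (x , y)) = v ≟ x

      snd? : ∀ v m → Dec (Snd v m)
      snd? v nothing        = no id
      snd? v (just (x , y)) = v ≟ y

      split : ∀ {v} m → On v m → Fst v m ⊎ Snd v m
      split (just _) o = o

      fst-unique : ∀ {v v′} m → Fst v m → Fst v′ m → v ≡ v′
      fst-unique (just _) p q = trans p (sym q)

      snd-unique : ∀ {v v′} m → Snd v m → Snd v′ m → v ≡ v′
      snd-unique (just _) p q = trans p (sym q)

    #-endpoints : {S : Fin n → Set} (S? : ∀ c → Dec (S c)) →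
      # (λ v → any? λ c → S? c ×-dec on? v (μ c)) ≤ # S? + # S?
    #-endpoints {S} S? = ≤-trans
      (#-⊎ (λ v → any? λ c → S? c ×-dec on? v (μ c)) f? s?
        λ { v (c , s , o) → [ (λ p → inj₁ (c , s , p)) , (λ p → inj₂ (c , s , p)) ]′ (split (μ c) o) })
      (+-mono-≤ (#-matching f? S? (λ v c → fst? v (μ c)) (λ _ p → p) (λ v v′ c _ _ → fst-unique (μ c)))
                (#-matching s? S? (λ v c → snd? v (μ c)) (λ _ p → p) (λ v v′ c _ _ → snd-unique (μ c))))
      where
      f? : ∀ v → Dec (∃ λ c → S c × Fst v (μ c))
      f? v = any? λ c → S? c ×-dec fst? v (μ c)
      s? : ∀ v → Dec (∃ λ c → S c × Snd v (μ c))
      s? v = any? λ c → S? c ×-dec snd? v (μ c)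

    used? : ∀ c → Dec (¬ μ c ≡ nothing)
    used? c = ¬? (missing? μ c)

    covered-count : # (covered? μ) ≤ # used? + # used?
    covered-count = ≤-trans (#-mono (covered? μ) (λ v → any? λ c → used? c ×-dec on? v (μ c))
      λ { v (c , o) → c , (λ e → subst (On v) e o) , o }) (#-endpoints used?)

  -- Hits, rounds of exchanges, and a single exchange.

  module Exchange {N n : ℕ} (G : CliqueColouring N n)
    (M : Assignment N n) (M-rainbow : IsRainbowMatching G M) (Λ Γ : ℕ) where
    open CliqueColouring G
    open IsRainbowMatching

    V = Fin N
    C = Fin n

    -- A fixed choice of a matched neighbour; only its functionality in (d , u) matters.
    rep : C → V → Maybe V
    rep d u with any? (λ x → covered? M x ×-dec E? d u x)
    ... | yes (x , _) = just x
    ... | no  _       = nothing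

    rep-just : ∀ d u {x} → rep d u ≡ just x → Covered M x × E d u x
    rep-just d u e with any? (λ x → covered? M x ×-dec E? d u x)
    rep-just d u refl | yes (x , p) = p

    rep-nothing : ∀ d u → rep d u ≡ nothing → ∀ x → Covered M x → ¬ E d u x
    rep-nothing d u e x cov j with any? (λ x → covered? M x ×-dec E? d u x)
    ... | no ¬p = ¬p (x , cov , j)

    _≟ᵐ_ : (o o′ : Maybe V) → Dec (o ≡ o′)
    _≟ᵐ_ = ≡-dec _≟_

    -- R is the set of colours that can be made missing; own d is the vertex that
    -- freeing d is bound to use, if there is one.
    record Stage : Set₁ where
      field
        R   : C → Set
        R?  : ∀ d → Dec (R d)
        own : C → Maybe V

    module _ (st : Stage) where
      open Stage st

      -- The clause on `rep` charges a pair (d , u) to a single `x`, which is what `heavy-count`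
      -- rests on. The last clause is there because freeing `d` may itself consume the vertex
      -- `own d`, which then cannot be the new end of the edge of `d`.
      Hit : C → V → V → Set
      Hit d x u = R d × ¬ Covered M u × rep d u ≡ just x × own d ≢ just u

      abstract
        hit? : ∀ d x u → Dec (Hit d x u)
        hit? d x u = R? d ×-dec (¬? (covered? M u) ×-dec (rep d u ≟ᵐ just x ×-dec ¬? (own d ≟ᵐ just u)))

      -- If (x , u) is heavy then u can be reserved for x; if x is light then its hits
      -- are spread over many u, so that forbidding a few of them does no harm.
      Heavy : V → V → Set
      Heavy x u = Λ ≤ # (λ d → hit? d x u)

      abstract
        heavy? : ∀ x u → Dec (Heavy x u)
        heavy? x u = Λ ≤? # (λ d → hit? d x u)

      LightHit : C → V → Set
      LightHit d x = ∃ λ u → Hit d x u × ¬ Heavy x u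

      abstract
        lightHit? : ∀ d x → Dec (LightHit d x)
        lightHit? d x = any? (λ u → hit? d x u ×-dec ¬? (heavy? x u))

      Light : V → Set
      Light x = Γ ≤ # (λ d → lightHit? d x)

      abstract
        light? : ∀ x → Dec (Light x)
        light? x = Γ ≤? # (λ d → lightHit? d x)

      -- The plan for an exchange at `x`: with `just u` the new end is fixed beforehand, with
      -- `nothing` it is chosen only when the exchange is made.
      Option : V → Maybe V → Set
      Option x (just u) = Heavy x u
      Option x nothing  = Light x

      HeavyEnd : C → Set
      HeavyEnd d = ∃ λ x → ∃ λ u → On x (M d) × Heavy x u

      abstract
        heavyEnd? : ∀ d → Dec (HeavyEnd d)
        heavyEnd? d = any? λ x → any? λ u → on? x (M d) ×-dec heavy? x u

      LightEnd : C → Set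
      LightEnd d = ∃ λ x → On x (M d) × Light x

      abstract
        lightEnd? : ∀ d → Dec (LightEnd d)
        lightEnd? d = any? λ x → on? x (M d) ×-dec light? x

      -- A booking is made in the round in which a colour enters `R` and is kept for ever. Heavy
      -- ends take precedence, so that a colour entering now with `nothing` is known to have a light
      -- end.
      ownNext : C → Maybe V
      ownNext d with R? d | heavyEnd? d
      ... | yes _ | _               = own d
      ... | no  _ | yes (x , u , _) = just u
      ... | no  _ | no _            = nothing

      next : Stage
      next .Stage.R d = R d ⊎ (HeavyEnd d ⊎ LightEnd d)
      next .Stage.R? d = R? d ⊎-dec (heavyEnd? d ⊎-dec lightEnd? d)
      next .Stage.own = ownNext

      next-R : ∀ {d} → Stage.R next d →
        (R d × ownNext d ≡ own d) ⊎ ∃ λ x → On x (M d) × Option x (ownNext d)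
      next-R {d} r with R? d | heavyEnd? d
      ... | yes r′ | _                   = inj₁ (r′ , refl)
      ... | no  _  | yes (x , u , o , h) = inj₂ (x , o , h)
      next-R (inj₁ r)        | no ¬r | no _  = contradiction r ¬r
      next-R (inj₂ (inj₁ h)) | no _  | no ¬h = contradiction h ¬h
      next-R (inj₂ (inj₂ l)) | no _  | no _  = inj₂ l

      ownNext-just : ∀ {d u} → ownNext d ≡ just u → own d ≡ just u ⊎ ∃ λ x → Heavy x u × On x (M d)
      ownNext-just {d} e with R? d | heavyEnd? d
      ... | yes _ | _ = inj₁ e
      ownNext-just {d} refl | no  _ | yes (x , u , o , h) = inj₂ (x , h , o)

      -- For a fixed `u` each colour `d` hits at most one `x`, namely `rep d u`. So the vertices
      -- heavy with `u` share n colours and take at least `Λ` each.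
      heavy-count : ∀ u → # (λ x → heavy? x u) * Λ ≤ n
      heavy-count u = begin
        # (λ x → heavy? x u) * Λ             ≡⟨ *-distribʳ-sum Λ (λ x → 𝟙 (heavy? x u)) ⟩
        sum (λ x → 𝟙 (heavy? x u) * Λ)       ≤⟨ sum-mono row ⟩
        sum (λ x → # (λ d → hit? d x u))     ≡⟨ ∑-comm (λ x d → 𝟙 (hit? d x u)) ⟩
        sum (λ d → # (λ x → hit? d x u))     ≤⟨ sum-mono (λ d → #-unique (λ x → hit? d x u) λ x x′ h h′ →
                                                 just-injective (trans (sym (proj₁ (proj₂ (proj₂ h)))) (proj₁ (proj₂ (proj₂ h′))))) ⟩
        sum (λ (d : C) → 1)                  ≡⟨ trans (sum-const n 1) (*-identityʳ n) ⟩
        n                                    ∎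
        where
        open ≤-Reasoning
        row : ∀ x → 𝟙 (heavy? x u) * Λ ≤ # (λ d → hit? d x u)
        row x with heavy? x u
        ... | yes h = ≤-trans (≤-reflexive (*-identityˡ Λ)) h
        ... | no  _ = z≤n

      -- A new booking of `u` comes from an edge of M with an end `x` heavy with `u`; as M is a
      -- matching, `x` determines the colour of that edge.
      own-count : ∀ u → # (λ d → ownNext d ≟ᵐ just u) ≤ # (λ d → own d ≟ᵐ just u) + # (λ x → heavy? x u)
      own-count u = ≤-trans
        (#-⊎ (λ d → ownNext d ≟ᵐ just u) (λ d → own d ≟ᵐ just u) end? λ d → ownNext-just)
        (+-monoʳ-≤ _ (#-matching end? (λ x → heavy? x u) (λ d x → on? x (M d)) (λ d p → p)
          λ d d′ x _ _ → disjoint M-rainbow))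
        where
        end? : ∀ d → Dec (∃ λ x → Heavy x u × On x (M d))
        end? d = any? (λ x → heavy? x u ×-dec on? x (M d))

    stage : ℕ → Stage
    stage zero .Stage.R d = M d ≡ nothing
    stage zero .Stage.R? = missing? M
    stage zero .Stage.own _ = nothing
    stage (suc j) = next (stage j)

    own-bound : ∀ {H} → n < suc H * Λ → ∀ j u → # (λ d → Stage.own (stage j) d ≟ᵐ just u) ≤ j * H
    own-bound {H} lt zero    u = ≤-reflexive (#-none {n} (λ d → nothing ≟ᵐ just u) (λ d ()))
    own-bound {H} lt (suc j) u = ≤-trans (own-count (stage j) u)
      (≤-trans (+-mono-≤ (own-bound lt j u) few) (≤-reflexive (+-comm (j * H) H)))
      where
      few : # (λ x → heavy? (stage j) x u) ≤ H
      few = s≤s⁻¹ (*-cancelʳ-< Λ _ (suc H) (≤-<-trans (heavy-count (stage j) u) lt))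

    -- A rainbow matching obtained from M by exchanges: B bounds the colours whose
    -- edges changed, F the newly covered vertices; P and Z are colours and
    -- vertices which have been set free.
    record State (B : List C) (F : List V) (P : List C) (Z : List V) : Set where
      field
        μ       : Assignment N n
        rainbow : IsRainbowMatching G μ
        same    : ∀ {k} → k ∉ B → μ k ≡ M k
        cover   : ∀ {z} → Covered μ z → Covered M z ⊎ z ∈ F
        absent  : ∀ {p} → p ∈ P → μ p ≡ nothing
        P⊆B     : ∀ {p} → p ∈ P → p ∈ B
        Z-free  : ∀ {z} → z ∈ Z → ¬ Covered μ z
        Z-known : ∀ {z} → z ∈ Z → Covered M z ⊎ z ∈ F
        size    : missing μ ≡ missing M
    open State

    -- The exchange gives the freed colour `d` the edge `xu` in place of the edge `xy` of `k`. So
    -- `d` leaves `P` but stays in `B`, `x` remains covered, and `y` is the gain.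
    swap : ∀ {B F d P Z k x y u} → State B F (d ∷ P) Z → d ∉ P → k ∉ B → Ends (M k) x y →
      u ∉ F → ¬ Covered M u → E d x u → State (k ∷ B) (u ∷ F) (k ∷ P) (y ∷ Z)
    swap {B} {F} {d} {P} {Z} {k} {x} {y} {u} s d∉P k∉B kxy u∉F u∉M dxu = record
      { μ       = μ₂
      ; rainbow = fill-isRainbowMatching rm₁ dxu x∉₁ u∉₁
      ; same    = λ {c} c∉ → trans (:=-other μ₁ d (just (x , u)) {c} (λ { refl → c∉ (there (P⊆B s (here refl))) }))
                    (trans (:=-other (μ s) k nothing {c} (c∉ ∘ here)) (same s (c∉ ∘ there)))
      ; cover   = λ c → cover₂ (covered-fill {μ = μ₁} {d} c)
      ; absent  = λ { (here refl) → trans (:=-other μ₁ d (just (x , u)) k≢d) (:=-same (μ s) k nothing)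
                    ; (there p∈) → absent₂ p∈ }
      ; P⊆B     = λ { (here refl) → here refl ; (there p∈) → there (P⊆B s (there p∈)) }
      ; Z-free  = λ { (here refl) c → y-free (covered-fill {μ = μ₁} {d} c)
                    ; (there z∈) c → Z-free₂ z∈ (covered-fill {μ = μ₁} {d} c) }
      ; Z-known = λ { (here refl) → inj₁ (_ , ends-right kxy)
                    ; (there z∈) → [ inj₁ , inj₂ ∘ there ]′ (Z-known s z∈) }
      ; size    = ℕ-suc-injective (trans (sym (missing-fill {μ = μ₁} {d} d∅₁))
                    (trans (missing-clear-ends kxyμ) (cong suc (size s))))
      }
      where
      μ₁ = μ s [ k := nothing ]
      μ₂ = μ₁ [ d := just (x , u) ]
      k≢d : k ≢ d
      k≢d refl = k∉B (P⊆B s (here refl))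
      kxyμ : Ends (μ s k) x y
      kxyμ = subst (λ m → Ends m x y) (sym (same s k∉B)) kxy
      missing-clear-ends : Ends (μ s k) x y → missing μ₁ ≡ suc (missing (μ s))
      missing-clear-ends (inj₁ e) = missing-clear {μ = μ s} e
      missing-clear-ends (inj₂ e) = missing-clear {μ = μ s} e
      rm₁ = clear-isRainbowMatching (rainbow s) k
      x∉₁ : ¬ Covered μ₁ x
      x∉₁ = uncovered-clear (rainbow s) (ends-left kxyμ)
      y∉₁ : ¬ Covered μ₁ y
      y∉₁ = uncovered-clear (rainbow s) (ends-right kxyμ)
      u∉μ : ¬ Covered (μ s) u
      u∉μ c = [ u∉M , u∉F ]′ (cover s c)
      u∉₁ : ¬ Covered μ₁ u
      u∉₁ c = u∉μ (covered-clear {μ = μ s} c)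
      d∅₁ : μ₁ d ≡ nothing
      d∅₁ = trans (:=-other (μ s) k nothing (k≢d ∘ sym)) (absent s (here refl))
      cover₂ : ∀ {z} → Covered μ₁ z ⊎ (z ≡ x ⊎ z ≡ u) → Covered M z ⊎ z ∈ u ∷ F
      cover₂ (inj₁ c) = [ inj₁ , inj₂ ∘ there ]′ (cover s (covered-clear {μ = μ s} c))
      cover₂ (inj₂ (inj₁ refl)) = inj₁ (_ , ends-left kxy)
      cover₂ (inj₂ (inj₂ refl)) = inj₂ (here refl)
      absent₂ : ∀ {p} → p ∈ P → μ₂ p ≡ nothing
      absent₂ {p} p∈ = trans (:=-other μ₁ d (just (x , u)) {p} (λ { refl → d∉P p∈ }))
        (trans (:=-other (μ s) k nothing {p} (λ { refl → k∉B (P⊆B s (there p∈)) })) (absent s (there p∈)))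
      y-free : Covered μ₁ y ⊎ (y ≡ x ⊎ y ≡ u) → ⊥
      y-free (inj₁ c) = y∉₁ c
      y-free (inj₂ (inj₁ refl)) = E-irr (ends-joined M-rainbow kxy)
      y-free (inj₂ (inj₂ refl)) = u∉M (_ , ends-right kxy)
      Z-free₂ : ∀ {z} → z ∈ Z → Covered μ₁ z ⊎ (z ≡ x ⊎ z ≡ u) → ⊥
      Z-free₂ z∈ (inj₁ c) = Z-free s z∈ (covered-clear {μ = μ s} c)
      Z-free₂ z∈ (inj₂ (inj₁ refl)) = Z-free s z∈ (k , ends-left kxyμ)
      -- The purpose of `Z-known`: the new end `u` is neither covered by `M` nor in `F`, hence it is
      -- not one of the vertices already set free.
      Z-free₂ z∈ (inj₂ (inj₂ refl)) = [ u∉M , u∉F ]′ (Z-known s z∈)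

  -- Chains of exchanges that avoid reserved colours and vertices.

  module Freeing {N n : ℕ} (G : CliqueColouring N n)
    (M : Assignment N n) (M-rainbow : IsRainbowMatching G M) (Λ Γ H K L : ℕ)
    (n<ΛH : n < suc H * Λ)
    (Λ-large : K + K * (L * H) < Λ)
    (Γ-large : K + K * (L * H) + K * Λ < Γ) where
    open CliqueColouring G
    open Exchange G M M-rainbow Λ Γ public
    open IsRainbowMatching

    own : ℕ → C → Maybe V
    own j = Stage.own (stage j)

    R : ℕ → C → Set
    R j = Stage.R (stage j)

    module _ {j : ℕ} (j≤L : j ≤ L) (Bs : List C) (Us : List V) (Bs≤K : length Bs ≤ K) (Us≤K : length Us ≤ K) where
      private
        st = stage j
        Clash : C → Set
        Clash d = d ∈ Bs ⊎ Any.Any (λ w → own j d ≡ just w) Us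
        clash? : ∀ d → Dec (Clash d)
        clash? d = (d ∈? Bs) ⊎-dec Any.any? (λ w → own j d ≟ᵐ just w) Us
        clash-count : # clash? ≤ K + K * (L * H)
        clash-count = ≤-trans
          (#-⊎ clash? (λ d → d ∈? Bs) (λ d → Any.any? (λ w → own j d ≟ᵐ just w) Us) (λ d → id))
          (+-mono-≤ (≤-trans (#-∈ Bs) Bs≤K)
            (≤-trans (#-Any (λ w d → own j d ≟ᵐ just w) (own-bound n<ΛH j) Us)
              (*-mono-≤ Us≤K (*-monoˡ-≤ H j≤L))))

      -- At most K colours are excluded outright, and each of at most K forbidden vertices is booked
      -- by at most LH colours; a heavy pair has more colours than that. At a light end a forbidden
      -- vertex `w` also spoils the colours that hit `x` through `w`, but fewer than Λ of them
      -- unless (x , w) is heavy, and hits at heavy pairs are not counted for `Light`.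
      choose : ∀ {x} o → Option st x o → (∀ {u} → o ≡ just u → u ∉ Us) →
        ∃ λ d → ∃ λ u → Hit st d x u × u ∉ Us × d ∉ Bs × (∀ {w} → w ∈ Us → own j d ≢ just w)
      choose {x} (just u) heavy ok
        with #-pick (λ d → hit? st d x u) clash? (<-≤-trans (≤-<-trans clash-count Λ-large) heavy)
      ... | d , hit , ¬clash = d , u , hit , ok refl , ¬clash ∘ inj₁ , λ w∈ e → ¬clash (inj₂ (lose w∈ e))
      choose {x} nothing light ok
        with #-pick (λ d → lightHit? st d x) bad? (<-≤-trans (≤-<-trans bad-count Γ-large) light)
        where
        spent? : ∀ w d → Dec (Hit st d x w × ¬ Heavy st x w)
        spent? w d = hit? st d x w ×-dec ¬? (heavy? st x w)
        spent-count : ∀ w → # (spent? w) ≤ Λ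
        spent-count w with heavy? st x w
        ... | yes h = ≤-trans (≤-reflexive (#-none (λ d → hit? st d x w ×-dec no (λ ¬h → ¬h h)) (λ d p → proj₂ p h))) z≤n
        ... | no ¬h = ≤-trans (#-mono (λ d → hit? st d x w ×-dec yes ¬h) (λ d → hit? st d x w) (λ d → proj₁)) (≰⇒≥ ¬h)
        bad? : ∀ d → Dec (Clash d ⊎ Any.Any (λ w → Hit st d x w × ¬ Heavy st x w) Us)
        bad? d = clash? d ⊎-dec Any.any? (λ w → spent? w d) Us
        bad-count : # bad? ≤ K + K * (L * H) + K * Λ
        bad-count = ≤-trans (#-⊎ bad? clash? (λ d → Any.any? (λ w → spent? w d) Us) (λ d → id))
          (+-mono-≤ clash-count (≤-trans (#-Any spent? spent-count Us) (*-monoˡ-≤ Λ Us≤K)))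
      ... | d , (u , hit , ¬heavy) , ¬bad =
        d , u , hit , (λ u∈ → ¬bad (inj₂ (lose u∈ (hit , ¬heavy)))) , ¬bad ∘ inj₁ ∘ inj₁ ,
        λ w∈ e → ¬bad (inj₁ (inj₂ (lose w∈ e)))

    -- The outcome of a chain making at most `g` changes. The new lists are hidden: later chains may
    -- rely only on their lengths and on their avoiding what was reserved.
    record Freed (g : ℕ) (B : List C) (F : List V) (A : List C) (W : List V) (P : List C) (Z : List V) : Set where
      field
        {B′}   : List C
        {F′}   : List V
        state  : State B′ F′ P Z
        avoidA : ∀ {a} → a ∈ A → a ∉ B → a ∉ B′
        avoidW : ∀ {w} → w ∈ W → w ∉ F → w ∉ F′
        lenB   : length B′ ≤ length B + g
        lenF   : length F′ ≤ length F + g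

    room : ∀ {X : Set} (xs ys : List X) {j} → length ys + length xs + suc (suc j) ≤ K → suc (length (xs ++ ys)) ≤ K
    room xs ys {j} le = ≤-trans (s≤s (≤-trans (≤-reflexive (trans (length-++ xs) (+-comm (length xs) _))) (m≤m+n _ (suc j))))
      (≤-trans (≤-reflexive (sym (+-suc _ (suc j)))) le)

    shift : ∀ a b {j} → a + b + suc (suc j) ≤ K → a + suc b + suc j ≤ K
    shift a b {j} = ≤-trans (≤-reflexive (trans (cong (_+ suc j) (+-suc a b)) (sym (+-suc (a + b) (suc j)))))

    -- The colours in A and the vertices in W are reserved for later exchanges.
    freeColour : ∀ j {B F A W P Z d} → j ≤ L →
      length B + length A + suc j ≤ K → length F + length W + suc j ≤ K →
      State B F P Z → R j d → d ∉ B → d ∉ A → (∀ {w} → own j d ≡ just w → w ∉ F × w ∉ W) →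
      Freed (suc j) B F A W (d ∷ P) Z

    freeVertex : ∀ j {B F A W P Z k x y} → j ≤ L →
      length B + length A + suc (suc j) ≤ K → length F + length W + suc (suc j) ≤ K →
      State B F P Z → k ∉ B → k ∉ A → Ends (M k) x y → ∀ o → Option (stage j) x o →
      (∀ {u} → o ≡ just u → u ∉ F × u ∉ W) →
      Freed (suc (suc j)) B F A W (k ∷ P) (y ∷ Z)

    -- A colour missing in `M` and still untouched needs no exchange; it only enters `B`, so that no
    -- other chain uses it.
    freeColour zero {B} {F} {d = d} j≤L roomB roomF s d∅ d∉B d∉A ok = record
      { state = record
        { μ = μ s ; rainbow = rainbow s ; same = λ k∉ → same s (k∉ ∘ there) ; cover = cover s
        ; absent = λ { (here refl) → trans (same s d∉B) d∅ ; (there p∈) → absent s p∈ }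
        ; P⊆B = λ { (here refl) → here refl ; (there p∈) → there (P⊆B s p∈) }
        ; Z-free = Z-free s ; Z-known = Z-known s ; size = size s }
      ; avoidA = λ { a∈ a∉ (here refl) → d∉A a∈ ; a∈ a∉ (there a∈B) → a∉ a∈B }
      ; avoidW = λ _ → id
      ; lenB = ≤-reflexive (+-comm 1 (length B))
      ; lenF = m≤m+n (length F) 1 }
      where open State
    freeColour (suc j) {B} {F} j≤L roomB roomF s r d∉B d∉A ok with next-R (stage j) r
    ... | inj₁ (r′ , own≡) = record
      { state = Freed.state f ; avoidA = Freed.avoidA f ; avoidW = Freed.avoidW f
      ; lenB = ≤-trans (Freed.lenB f) (+-monoʳ-≤ (length B) (n≤1+n _))
      ; lenF = ≤-trans (Freed.lenF f) (+-monoʳ-≤ (length F) (n≤1+n _)) }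
      where
      f = freeColour j (<⇒≤ j≤L) (≤-trans (+-monoʳ-≤ _ (n≤1+n _)) roomB) (≤-trans (+-monoʳ-≤ _ (n≤1+n _)) roomF)
            s r′ d∉B d∉A (ok ∘ trans own≡)
    ... | inj₂ (x , onx , opt) with on-ends onx
    ...   | y , ends = record
      { state = record
        { μ = μ t ; rainbow = rainbow t ; same = same t ; cover = cover t ; absent = absent t ; P⊆B = P⊆B t
        ; Z-free = Z-free t ∘ there ; Z-known = Z-known t ∘ there ; size = size t }
      ; avoidA = Freed.avoidA f ; avoidW = Freed.avoidW f ; lenB = Freed.lenB f ; lenF = Freed.lenF f }
      where
      open State
      f = freeVertex j (<⇒≤ j≤L) roomB roomF s d∉B d∉A ends _ opt ok
      t = Freed.state f

    freeVertex j {B} {F} {A} {W} {P} {Z} {k} {x} {y} j≤L roomB roomF s k∉B k∉A ends o opt ok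
      with choose j≤L (k ∷ A ++ B) (W ++ F) (room A B roomB) (<⇒≤ (room W F roomF)) o opt
             (λ e u∈ → let u∉F , u∉W = ok e in [ u∉W , u∉F ]′ (∈-++⁻ W u∈))
    ... | d , u , (r , u∉M , rep≡ , own≢u) , u∉ , d∉ , own∉ = record
      { state  = swap (Freed.state f) (d∉B ∘ State.P⊆B s) (Freed.avoidA f (here refl) k∉B) ends
                   (Freed.avoidW f (here refl) u∉F) u∉M (E-sym (proj₂ (rep-just d u rep≡)))
      ; avoidA = λ { a∈ a∉ (here refl) → k∉A a∈ ; a∈ a∉ (there a∈B′) → Freed.avoidA f (there a∈) a∉ a∈B′ }
      ; avoidW = λ { w∈ w∉ (here refl) → u∉ (∈-++⁺ˡ w∈) ; w∈ w∉ (there w∈F′) → Freed.avoidW f (there w∈) w∉ w∈F′ }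
      ; lenB = ≤-trans (s≤s (Freed.lenB f)) (≤-reflexive (sym (+-suc (length B) (suc j))))
      ; lenF = ≤-trans (s≤s (Freed.lenF f)) (≤-reflexive (sym (+-suc (length F) (suc j)))) }
      where
      u∉F : u ∉ F
      u∉F = u∉ ∘ ∈-++⁺ʳ W
      d∉B : d ∉ B
      d∉B = d∉ ∘ there ∘ ∈-++⁺ʳ A
      f = freeColour j {A = k ∷ A} {W = u ∷ W} j≤L
            (shift (length B) (length A) roomB) (shift (length F) (length W) roomF) s r d∉B
            (λ { (here refl) → d∉ (here refl) ; (there d∈A) → d∉ (there (∈-++⁺ˡ d∈A)) })
            (λ e → (λ w∈F → own∉ (∈-++⁺ʳ W w∈F) e) ,
              λ { (here refl) → own≢u e ; (there w∈W) → own∉ (∈-++⁺ˡ w∈W) e })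

  -- Vertices that can be freed together, and augmentation.

  module Claims {N n : ℕ} (G : CliqueColouring N n)
    (M : Assignment N n) (M-rainbow : IsRainbowMatching G M) (Λ Γ H K L : ℕ)
    (n<ΛH : n < suc H * Λ)
    (Λ-large : K + K * (L * H) < Λ)
    (Γ-large : K + K * (L * H) + K * Λ < Γ)
    (K-large : 3 * L + 5 ≤ K) where
    open CliqueColouring G
    open Freeing G M M-rainbow Λ Γ H K L n<ΛH Λ-large Γ-large public
    open IsRainbowMatching

    HasOption : ℕ → V → V → Set
    HasOption j x u = Heavy (stage j) x u ⊎ Light (stage j) x

    abstract
      hasOption? : ∀ j x u → Dec (HasOption j x u)
      hasOption? j x u = heavy? (stage j) x u ⊎-dec light? (stage j) x

    -- The last clause keeps the edge of `c` itself out of the exchanges at `x`, because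
    -- `augment-claims` frees `c` as well.
    Nice : ℕ → C → V → V → Set
    Nice j c x u = Hit (stage j) c x u × HasOption j x u × ¬ On x (M c)

    abstract
      nice? : ∀ j c x u → Dec (Nice j c x u)
      nice? j c x u = hit? (stage j) c x u ×-dec (hasOption? j x u ×-dec ¬? (on? x (M c)))

    -- y can be set free, if necessary at the expense of u.
    data Claim (j : ℕ) (c : C) (y u : V) : Set where
      outer : y ≡ u → ¬ Covered M u → own j c ≢ just u → Claim j c y u
      inner : ∀ x k → Nice j c x u → Ends (M k) x y → Claim j c y u

    abstract
      claim? : ∀ j c y u → Dec (Claim j c y u)
      claim? j c y u = map′
        [ (λ { (e , u∉M , own≢) → outer e u∉M own≢ }) , (λ { (x , k , nice , ends) → inner x k nice ends }) ]′
        (λ { (outer e u∉M own≢) → inj₁ (e , u∉M , own≢) ; (inner x k nice ends) → inj₂ (x , k , nice , ends) })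
        (((y ≟ u) ×-dec (¬? (covered? M u) ×-dec ¬? (own j c ≟ᵐ just u)))
          ⊎-dec any? λ x → any? λ k → nice? j c x u ×-dec ends? (M k) x y)

    SameEdge : V → V → Set
    SameEdge y y′ = ∃ λ k → On y (M k) × On y′ (M k)

    abstract
      sameEdge? : ∀ y y′ → Dec (SameEdge y y′)
      sameEdge? y y′ = any? λ k → on? y (M k) ×-dec on? y′ (M k)

    module _ {j : ℕ} {c : C} {y u : V} where

      claimColours : Claim j c y u → List C
      claimColours (outer _ _ _)   = []
      claimColours (inner _ k _ _) = k ∷ []

      claimColours-length : ∀ cl → length (claimColours cl) ≤ 1
      claimColours-length (outer _ _ _) = z≤n
      claimColours-length (inner _ _ _ _) = ≤-refl

      claimColours-on : ∀ cl {k} → k ∈ claimColours cl → On y (M k)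
      claimColours-on (inner _ _ _ ends) (here refl) = ends-right ends

      claimColours-own : ∀ cl → c ∉ claimColours cl
      claimColours-own (inner _ _ (_ , _ , x∉c) ends) (here refl) = x∉c (ends-left ends)

      claim-own : Claim j c y u → own j c ≢ just u
      claim-own (outer _ _ own≢) = own≢
      claim-own (inner _ _ ((_ , _ , _ , own≢) , _) _) = own≢

      freeClaim : ∀ {B F A W P Z} (cl : Claim j c y u) → j ≤ L →
        length B + length A + suc (suc j) ≤ K → length F + length W + suc (suc j) ≤ K →
        State B F P Z → (∀ {k} → k ∈ claimColours cl → k ∉ B × k ∉ A) → u ∉ F → u ∉ W →
        ∃ λ P′ → Freed (suc (suc j)) B F A W (P′ ++ P) (y ∷ Z)
      -- An uncovered vertex is free already; putting it into `F` keeps later exchanges off it.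
      freeClaim {B} {F} (outer refl u∉M _) j≤L roomB roomF s fresh u∉F u∉W = [] , record
        { state = record
          { μ = μ s ; rainbow = rainbow s ; same = same s ; absent = absent s ; P⊆B = P⊆B s ; size = size s
          ; cover = λ cov → [ inj₁ , inj₂ ∘ there ]′ (cover s cov)
          ; Z-free = λ { (here refl) cov → [ u∉M , u∉F ]′ (cover s cov) ; (there z∈) → Z-free s z∈ }
          ; Z-known = λ { (here refl) → inj₂ (here refl) ; (there z∈) → [ inj₁ , inj₂ ∘ there ]′ (Z-known s z∈) } }
        ; avoidA = λ _ → id
        ; avoidW = λ { w∈ w∉ (here refl) → u∉W w∈ ; w∈ w∉ (there w∈F) → w∉ w∈F }
        ; lenB = m≤m+n (length B) _
        ; lenF = ≤-trans (s≤s (m≤m+n (length F) (suc j))) (≤-reflexive (sym (+-suc (length F) (suc j)))) }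
        where open State
      freeClaim (inner x k (_ , option , _) ends) j≤L roomB roomF s fresh u∉F u∉W =
        k ∷ [] , [ (λ h → free (just u) h λ { refl → u∉F , u∉W }) , (λ l → free nothing l λ ()) ]′ option
        where free = freeVertex j j≤L roomB roomF s (proj₁ (fresh (here refl))) (proj₂ (fresh (here refl))) ends

    initial : State [] [] [] []
    initial = record
      { μ = M ; rainbow = M-rainbow ; same = λ _ → refl ; cover = inj₁
      ; absent = λ () ; P⊆B = λ () ; Z-free = λ () ; Z-known = λ () ; size = refl }

    private
      -- The number 3j + 5 is the total length of three chains: j + 1 for the colour `c` and j + 2
      -- for each end of the new edge.
      fit : ∀ {a j} b → j ≤ L → a + b ≡ 3 * j + 5 → a ≤ K
      fit {a} b j≤L e = ≤-trans (m+n≤o⇒m≤o a (≤-reflexive e)) (≤-trans (+-monoˡ-≤ 5 (*-monoʳ-≤ 3 j≤L)) K-large)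

      fit₁ : ∀ {j} → j ≤ L → 2 + suc j ≤ K
      fit₁ {j} j≤L = fit (2 * j + 2) j≤L (arith j)
        where
        arith : ∀ j → 2 + suc j + (2 * j + 2) ≡ 3 * j + 5
        arith = solve-∀

      fit₂ : ∀ {j} → j ≤ L → suc j + 1 + suc (suc j) ≤ K
      fit₂ {j} j≤L = fit (1 + j) j≤L (arith j)
        where
        arith : ∀ j → suc j + 1 + suc (suc j) + (1 + j) ≡ 3 * j + 5
        arith = solve-∀

      fit₃ : ∀ {j} → j ≤ L → suc j + suc (suc j) + 0 + suc (suc j) ≤ K
      fit₃ {j} j≤L = fit 0 j≤L (arith j)
        where
        arith : ∀ j → suc j + suc (suc j) + 0 + suc (suc j) + 0 ≡ 3 * j + 5
        arith = solve-∀

    module _ {j : ℕ} {c : C} {y u y′ u′ : V} (j≤L : j ≤ L) (r : R j c) (cl : Claim j c y u) (cl′ : Claim j c y′ u′) (u≢u′ : u ≢ u′)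
      (¬same : ¬ SameEdge y y′) where
      private
        ks  = claimColours cl
        ks′ = claimColours cl′

        free₁ : Freed (suc j) [] [] (ks ++ ks′) (u ∷ u′ ∷ []) (c ∷ []) []
        free₁ = freeColour j j≤L
          (≤-trans (+-monoˡ-≤ (suc j) (≤-trans (≤-reflexive (length-++ ks)) (+-mono-≤ (claimColours-length cl) (claimColours-length cl′)))) (fit₁ j≤L))
          (fit₁ j≤L)
          initial r (λ ()) (λ c∈ → [ claimColours-own cl , claimColours-own cl′ ]′ (∈-++⁻ ks c∈))
          (λ e → (λ ()) , λ { (here refl) → claim-own cl e ; (there (here refl)) → claim-own cl′ e })

        free₂ : (f₁ : Freed (suc j) [] [] (ks ++ ks′) (u ∷ u′ ∷ []) (c ∷ []) []) → let open Freed f₁ in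
          ∃ λ P → Freed (suc (suc j)) B′ F′ ks′ (u′ ∷ []) (P ++ c ∷ []) (y ∷ [])
        free₂ f₁ = freeClaim cl j≤L
          (≤-trans (+-monoˡ-≤ (suc (suc j)) (+-mono-≤ lenB (claimColours-length cl′))) (fit₂ j≤L))
          (≤-trans (+-monoˡ-≤ (suc (suc j)) (+-monoˡ-≤ 1 lenF)) (fit₂ j≤L))
          state
          (λ k∈ → avoidA (∈-++⁺ˡ k∈) (λ ()) ,
            λ k∈′ → ¬same (_ , claimColours-on cl k∈ , claimColours-on cl′ k∈′))
          (avoidW (here refl) (λ ())) λ { (here refl) → u≢u′ refl }
          where open Freed f₁

        free₃ : ∀ {B F P} → length B ≤ suc j → length F ≤ suc j → (∀ {k} → k ∈ ks′ → k ∉ B) → u′ ∉ F →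
          (f₂ : Freed (suc (suc j)) B F ks′ (u′ ∷ []) P (y ∷ [])) → let open Freed f₂ in
          ∃ λ P′ → Freed (suc (suc j)) B′ F′ [] [] (P′ ++ P) (y′ ∷ y ∷ [])
        free₃ lenB₁ lenF₁ ks′∉ u′∉ f₂ = freeClaim cl′ j≤L
          (≤-trans (+-monoˡ-≤ (suc (suc j)) (+-monoˡ-≤ 0 (≤-trans lenB (+-monoˡ-≤ (suc (suc j)) lenB₁)))) (fit₃ j≤L))
          (≤-trans (+-monoˡ-≤ (suc (suc j)) (+-monoˡ-≤ 0 (≤-trans lenF (+-monoˡ-≤ (suc (suc j)) lenF₁)))) (fit₃ j≤L))
          state
          (λ k∈ → avoidA k∈ (ks′∉ k∈) , λ ())
          (avoidW (here refl) u′∉) (λ ())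
          where open Freed f₂

        finish : ∀ {B F P} → State B F P (y′ ∷ y ∷ []) → c ∈ P → E c y y′ → Augmented {G = G} M
        finish s c∈P e with augment {G = G} {μ} rainbow (absent c∈P) e (Z-free (there (here refl))) (Z-free (here refl))
          where open State s
        ... | μ′ , rm , eq = μ′ , rm , trans (sym (State.size s)) eq

      -- The colour `c` and the vertices `y` and `y′` are freed one after another, each chain
      -- reserving what the later ones need, and then `c` receives the edge `yy′`. Because `u` and
      -- `u′` differ and `y`, `y′` lie on no common edge of M, the two claims do not compete for a
      -- vertex or an edge.
      augment-claims : E c y y′ → Augmented {G = G} M
      augment-claims = conclude free₁
        where
        conclude : Freed (suc j) [] [] (ks ++ ks′) (u ∷ u′ ∷ []) (c ∷ []) [] → E c y y′ → Augmented {G = G} M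
        conclude f₁ with free₂ f₁
        ... | P₂ , f₂ with free₃ (Freed.lenB f₁) (Freed.lenF f₁) (λ k∈ → Freed.avoidA f₁ (∈-++⁺ʳ ks k∈) (λ ()))
                             (Freed.avoidW f₁ (there (here refl)) (λ ())) f₂
        ...   | P₃ , f₃ = finish (Freed.state f₃) (∈-++⁺ʳ P₃ (∈-++⁺ʳ P₂ (here refl)))

  -- The number of vertices covered by a colour of `R` when no augmentation is found.

  module Counting {N n : ℕ} (G : CliqueColouring N n)
    (M : Assignment N n) (M-rainbow : IsRainbowMatching G M) (Λ Γ H K L : ℕ)
    (n<ΛH : n < suc H * Λ)
    (Λ-large : K + K * (L * H) < Λ)
    (Γ-large : K + K * (L * H) + K * Λ < Γ)
    (K-large : 3 * L + 5 ≤ K) where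
    open CliqueColouring G
    open Claims G M M-rainbow Λ Γ H K L n<ΛH Λ-large Γ-large K-large public
    open IsRainbowMatching

    Stuck : ℕ → Set
    Stuck j = ∀ c y u y′ u′ → R j c → Claim j c y u → Claim j c y′ u′ → u ≢ u′ → E c y y′ → SameEdge y y′

    BadHit : ℕ → C → V → Set
    BadHit j c x = ∃ λ u → Hit (stage j) c x u × ¬ HasOption j x u

    abstract
      badHit? : ∀ j c x → Dec (BadHit j c x)
      badHit? j c x = any? λ u → hit? (stage j) c x u ×-dec ¬? (hasOption? j x u)

    Parallel : C → C → Set
    Parallel c e = ∃ λ x → ∃ λ y → Ends (M e) x y × E c x y

    abstract
      parallel? : ∀ c e → Dec (Parallel c e)
      parallel? c e = any? λ x → any? λ y → ends? (M e) x y ×-dec E? c x y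

    NiceEdge : ℕ → C → C → Set
    NiceEdge j c e = ∃ λ x → ∃ λ u → Nice j c x u × On x (M e)

    abstract
      niceEdge? : ∀ j c e → Dec (NiceEdge j c e)
      niceEdge? j c e = any? λ x → any? λ u → nice? j c x u ×-dec on? x (M e)

    module _ {j : ℕ} {c : C} (stuck : Stuck j) (Rc : R j c) where
      private
        Outside : V → Set
        Outside v = HasNeighbour c v × ¬ Covered M v
        outside? : ∀ v → Dec (Outside v)
        outside? v = hasNeighbour? c v ×-dec ¬? (covered? M v)

        Inside : V → Set
        Inside v = HasNeighbour c v × Covered M v
        inside? : ∀ v → Dec (Inside v)
        inside? v = hasNeighbour? c v ×-dec covered? M v

        own≡? : ∀ v → Dec (own j c ≡ just v)
        own≡? v = own j c ≟ᵐ just v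

        own-unique : # own≡? ≤ 1
        own-unique = #-unique own≡? λ v v′ p q → just-injective (trans (sym p) q)

        Used : C → Set
        Used e = ¬ M e ≡ nothing

        Plain : C → Set
        Plain e = Used e × ¬ NiceEdge j c e
        plain? : ∀ e → Dec (Plain e)
        plain? e = used? M e ×-dec ¬? (niceEdge? j c e)

        -- The π(c) of the overview is `κ`. Here `π` counts the edges of M without a nice end, which
        -- are the exceptional ones.
        β ν π κ : ℕ
        β = # (badHit? j c)
        ν = # (niceEdge? j c)
        π = # plain?
        κ = # (parallel? c)

        -- Two uncovered vertices joined to `x` in colour `c` are joined to each other. Both are
        -- outer claims, so `Stuck` would put them on an edge of M.
        hit-unique : ∀ {x u u′} → Hit (stage j) c x u → Hit (stage j) c x u′ → u ≡ u′
        hit-unique {x} {u} {u′} (r , u∉ , rep≡ , own≢) (_ , u′∉ , rep′≡ , own≢′) with u ≟ u′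
        ... | yes e = e
        ... | no u≢ with stuck c u u u′ u′ r (outer refl u∉ own≢) (outer refl u′∉ own≢′) u≢
                           (E-trans (proj₂ (rep-just c u rep≡)) (E-sym (proj₂ (rep-just c u′ rep′≡))) u≢)
        ...   | k , o , _ = contradiction (k , o) u∉

        rep-functional : ∀ {x x′ u} → Hit (stage j) c x u → Hit (stage j) c x′ u → x ≡ x′
        rep-functional (_ , _ , p , _) (_ , _ , q , _) = just-injective (trans (sym p) q)

        -- If both ends of an edge were nice, `x′` could be freed by an exchange at `x`, although it
        -- is joined in colour `c` to its own uncovered vertex `u′`.
        nice-unique : ∀ {x u x′ u′ e} → Nice j c x u → Nice j c x′ u′ → On x (M e) → On x′ (M e) → x ≡ x′
        nice-unique {x} {u} {x′} {u′} {e} nice@(hit , _) (hit′@(r , u′∉ , rep≡ , own≢) , _) o o′ with on-ends o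
        ... | y , ends with ends-cover ends o′
        ...   | inj₁ x′≡x = sym x′≡x
        ...   | inj₂ refl with u ≟ u′
        ...     | yes refl = rep-functional hit hit′
        ...     | no u≢ with stuck c x′ u u′ u′ r (inner x e nice ends) (outer refl u′∉ own≢) u≢ (E-sym (proj₂ (rep-just c u′ rep≡)))
        ...       | k , _ , ou = contradiction (k , ou) u′∉

        nice+plain : ν + π ≤ # (used? M)
        nice+plain = ≤-trans (≤-reflexive (sym (∑-distrib-+ (λ e → 𝟙 (niceEdge? j c e)) (λ e → 𝟙 (plain? e))))) (sum-mono term)
          where
          term : ∀ e → 𝟙 (niceEdge? j c e) + 𝟙 (plain? e) ≤ 𝟙 (used? M e)
          term e with used? M e | niceEdge? j c e
          ... | yes _ | yes _ = ≤-refl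
          ... | yes _ | no  _ = ≤-refl
          ... | no  _ | no  _ = z≤n
          ... | no ¬u | yes (x , _ , _ , o) = contradiction (λ e≡ → subst (On x) e≡ o) ¬u

      -- The 4 accounts for the vertex `own j c`, one vertex without covered neighbours, and two
      -- vertices that hit the edge of `c` in M. All others hit, and are determined by, either a
      -- badly hit vertex or an edge with a nice end.
      outside-count : # (λ v → hasNeighbour? c v ×-dec ¬? (covered? M v)) ≤ 4 + # (badHit? j c) + # (niceEdge? j c)
      outside-count = begin
        # outside?                      ≤⟨ #-⊎ outside? own≡? unowned? (λ v p → case own≡? v of λ { (yes q) → inj₁ q ; (no ¬q) → inj₂ (p , ¬q) }) ⟩
        # own≡? + # unowned?            ≤⟨ +-mono-≤ own-unique (#-⊎ unowned? lonely? hitting? split) ⟩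
        1 + (# lonely? + # hitting?)    ≤⟨ +-monoʳ-≤ 1 (+-mono-≤ lonely-unique (#-⊎ hitting? ownHit? otherHit? split₂)) ⟩
        2 + (# ownHit? + # otherHit?)   ≤⟨ +-monoʳ-≤ 2 (+-mono-≤ ownHit-count (#-⊎ otherHit? badly? nicely? split₃)) ⟩
        4 + (# badly? + # nicely?)      ≤⟨ +-monoʳ-≤ 4 (+-mono-≤ badly-count nicely-count) ⟩
        4 + (β + ν)                     ≡⟨ sym (+-assoc 4 β ν) ⟩
        4 + β + ν                       ∎
        where
        open ≤-Reasoning
        Unowned Lonely Hitting OwnHit OtherHit Badly Nicely : V → Set
        Unowned v = Outside v × own j c ≢ just v
        Lonely v = Unowned v × rep c v ≡ nothing
        Hitting v = ∃ λ x → Hit (stage j) c x v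
        OwnHit v = ∃ λ x → Hit (stage j) c x v × On x (M c)
        OtherHit v = ∃ λ x → Hit (stage j) c x v × ¬ On x (M c)
        Badly v = ∃ λ x → Hit (stage j) c x v × ¬ HasOption j x v
        Nicely v = ∃ λ x → Nice j c x v
        unowned? : ∀ v → Dec (Unowned v)
        unowned? v = outside? v ×-dec ¬? (own≡? v)
        lonely? : ∀ v → Dec (Lonely v)
        lonely? v = unowned? v ×-dec (rep c v ≟ᵐ nothing)
        hitting? : ∀ v → Dec (Hitting v)
        hitting? v = any? λ x → hit? (stage j) c x v
        ownHit? : ∀ v → Dec (OwnHit v)
        ownHit? v = any? λ x → hit? (stage j) c x v ×-dec on? x (M c)
        otherHit? : ∀ v → Dec (OtherHit v)
        otherHit? v = any? λ x → hit? (stage j) c x v ×-dec ¬? (on? x (M c))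
        badly? : ∀ v → Dec (Badly v)
        badly? v = any? λ x → hit? (stage j) c x v ×-dec ¬? (hasOption? j x v)
        nicely? : ∀ v → Dec (Nicely v)
        nicely? v = any? λ x → nice? j c x v
        split : ∀ v → Unowned v → Lonely v ⊎ Hitting v
        split v p@((_ , v∉) , own≢) = by (rep c v) refl
          where
          by : ∀ o → rep c v ≡ o → Lonely v ⊎ Hitting v
          by nothing  eq = inj₁ (p , eq)
          by (just x) eq = inj₂ (x , Rc , v∉ , eq , own≢)
        split₂ : ∀ v → Hitting v → OwnHit v ⊎ OtherHit v
        split₂ v (x , h) with on? x (M c)
        ... | yes o = inj₁ (x , h , o)
        ... | no ¬o = inj₂ (x , h , ¬o)
        split₃ : ∀ v → OtherHit v → Badly v ⊎ Nicely v
        split₃ v (x , h , ¬o) with hasOption? j x v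
        ... | yes p = inj₂ (x , h , p , ¬o)
        ... | no ¬p = inj₁ (x , h , ¬p)
        -- All neighbours of `v` are uncovered, and an uncovered neighbour other than `own j c`
        -- would be a second outer claim.
        lonely-neighbour : ∀ {v} → Lonely v → ∃ λ w → E c v w × own j c ≡ just w
        lonely-neighbour {v} ((((w , e) , v∉) , own≢) , rep∅) with own≡? w
        ... | yes p = w , e , p
        ... | no ¬p with stuck c v v w w Rc (outer refl v∉ own≢) (outer refl (λ w∈ → rep-nothing c v rep∅ w w∈ e) ¬p)
                           (λ { refl → E-irr e }) e
        ...   | k , o , _ = contradiction (k , o) v∉
        lonely-unique : # lonely? ≤ 1
        lonely-unique = #-unique lonely? unique
          where
          unique : ∀ v v′ → Lonely v → Lonely v′ → v ≡ v′
          unique v v′ p p′ with v ≟ v′ | lonely-neighbour p | lonely-neighbour p′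
          ... | yes e | _ | _ = e
          ... | no v≢ | w , e , q | w′ , e′ , q′ with just-injective (trans (sym q) q′)
          ...   | refl with stuck c v v v′ v′ Rc (outer refl (proj₂ (proj₁ (proj₁ p))) (proj₂ (proj₁ p)))
                              (outer refl (proj₂ (proj₁ (proj₁ p′))) (proj₂ (proj₁ p′))) v≢ (E-trans e (E-sym e′) v≢)
          ...     | k , o , _ = contradiction (k , o) (proj₂ (proj₁ (proj₁ p)))
        rep? : ∀ v x → Dec (rep c v ≡ just x)
        rep? v x = rep c v ≟ᵐ just x
        hit-inj : ∀ {P : V → V → Set} v v′ x → ∃ (λ x → Hit (stage j) c x v × P v x) → ∃ (λ x → Hit (stage j) c x v′ × P v′ x) →
          rep c v ≡ just x → rep c v′ ≡ just x → v ≡ v′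
        hit-inj v v′ x (y , (r , v∉ , _ , own≢) , _) (y′ , (r′ , v′∉ , _ , own≢′) , _) p q =
          hit-unique (r , v∉ , p , own≢) (r′ , v′∉ , q , own≢′)
        ownHit-count : # ownHit? ≤ 2
        ownHit-count = ≤-trans
          (#-matching ownHit? (λ x → on? x (M c)) rep? (λ { v (x , h , o) → x , o , proj₁ (proj₂ (proj₂ h)) }) hit-inj)
          (≤-trans (#-mono (λ x → on? x (M c)) (λ x → any? λ e → (e ≟ c) ×-dec on? x (M e)) (λ x o → c , refl , o))
            (≤-trans (#-endpoints M (λ e → e ≟ c)) (+-mono-≤ one one)))
          where
          one : # (λ e → e ≟ c) ≤ 1
          one = #-unique (λ e → e ≟ c) λ _ _ p q → trans p (sym q)
        badly-count : # badly? ≤ β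
        badly-count = #-matching badly? (badHit? j c) rep? (λ { v (x , h , ¬o) → x , (v , h , ¬o) , proj₁ (proj₂ (proj₂ h)) }) hit-inj
        nicely-count : # nicely? ≤ ν
        nicely-count = #-matching nicely? (niceEdge? j c) (λ v e → any? λ x → rep? v x ×-dec on? x (M e))
          (λ { v (x , nice@((_ , _ , p , _) , _)) → let e , o = proj₁ (rep-just c v p) in e , (x , v , nice , o) , x , p , o })
          λ { v v′ e (y , nice@(h@(_ , _ , q , _) , _)) (y′ , nice′@(h′@(_ , _ , q′ , _) , _)) (x , p , o) (x′ , p′ , o′) →
            inj v v′ e y y′ nice nice′ (subst (λ z → On z (M e)) (just-injective (trans (sym p) q)) o)
              (subst (λ z → On z (M e)) (just-injective (trans (sym p′) q′)) o′) }
          where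
          inj : ∀ v v′ e y y′ → Nice j c y v → Nice j c y′ v′ → On y (M e) → On y′ (M e) → v ≡ v′
          inj v v′ e y y′ nice nice′ o o′ with nice-unique nice nice′ o o′
          ... | refl = hit-unique (proj₁ nice) (proj₁ nice′)

      -- Let `x` be the nice end of an edge of M and `v` the other end. If `v` is joined to `x` in
      -- colour `c`, the edge counts for `κ`. Otherwise every neighbour of `v` is `own j c` or lies
      -- on a plain edge, which leaves at most 1 + 2π targets; no target serves two such `v`, for
      -- these would be joined to each other and are both claims.
      inside-count : # (λ v → hasNeighbour? c v ×-dec covered? M v) ≤ (π + π) + (ν + (κ + (1 + (π + π))))
      inside-count = begin
        # inside?                        ≤⟨ #-⊎ inside? onPlain? onNice? split ⟩
        # onPlain? + # onNice?           ≤⟨ +-mono-≤ (#-endpoints M plain?) (#-⊎ onNice? rep? partner? split₂) ⟩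
        π + π + (# rep? + # partner?)    ≤⟨ +-monoʳ-≤ (π + π) (+-mono-≤ rep-count (#-⊎ partner? along? across? split₃)) ⟩
        π + π + (ν + (# along? + # across?)) ≤⟨ +-monoʳ-≤ (π + π) (+-monoʳ-≤ ν (+-mono-≤ along-count across-count)) ⟩
        π + π + (ν + (κ + (1 + (π + π)))) ∎
        where
        open ≤-Reasoning
        OnPlain OnNice Rep Partner Along Across : V → Set
        OnPlain v = ∃ λ e → Plain e × On v (M e)
        OnNice v = HasNeighbour c v × ∃ λ e → NiceEdge j c e × On v (M e)
        Rep v = ∃ λ u → Nice j c v u
        PartnerOf : V → C → V → V → Set
        PartnerOf v e x u = Nice j c x u × Ends (M e) x v
        Partner v = HasNeighbour c v × ∃ λ e → ∃ λ x → ∃ λ u → PartnerOf v e x u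
        Along v = ∃ λ e → ∃ λ x → ∃ λ u → PartnerOf v e x u × E c x v
        Across v = HasNeighbour c v × ∃ λ e → ∃ λ x → ∃ λ u → PartnerOf v e x u × ¬ E c x v
        onPlain? : ∀ v → Dec (OnPlain v)
        onPlain? v = any? λ e → plain? e ×-dec on? v (M e)
        onNice? : ∀ v → Dec (OnNice v)
        onNice? v = hasNeighbour? c v ×-dec any? λ e → niceEdge? j c e ×-dec on? v (M e)
        rep? : ∀ v → Dec (Rep v)
        rep? v = any? λ u → nice? j c v u
        partnerOf? : ∀ v e x u → Dec (PartnerOf v e x u)
        partnerOf? v e x u = nice? j c x u ×-dec ends? (M e) x v
        partner? : ∀ v → Dec (Partner v)
        partner? v = hasNeighbour? c v ×-dec any? λ e → any? λ x → any? λ u → partnerOf? v e x u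
        along? : ∀ v → Dec (Along v)
        along? v = any? λ e → any? λ x → any? λ u → partnerOf? v e x u ×-dec E? c x v
        across? : ∀ v → Dec (Across v)
        across? v = hasNeighbour? c v ×-dec any? λ e → any? λ x → any? λ u → partnerOf? v e x u ×-dec ¬? (E? c x v)
        split : ∀ v → Inside v → OnPlain v ⊎ OnNice v
        split v (h , e , o) with niceEdge? j c e
        ... | yes p = inj₂ (h , e , p , o)
        ... | no ¬p = inj₁ (e , ((λ e≡ → subst (On v) e≡ o) , ¬p) , o)
        split₂ : ∀ v → OnNice v → Rep v ⊎ Partner v
        split₂ v (h , e , (x , u , nice , ox) , ov) with on-ends ox
        ... | y , ends with ends-cover ends ov
        ...   | inj₁ refl = inj₁ (u , nice)
        ...   | inj₂ refl = inj₂ (h , e , x , u , nice , ends)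
        split₃ : ∀ v → Partner v → Along v ⊎ Across v
        split₃ v (h , e , x , u , p) with E? c x v
        ... | yes q = inj₁ (e , x , u , p , q)
        ... | no ¬q = inj₂ (h , e , x , u , p , ¬q)
        rep-count : # rep? ≤ ν
        rep-count = #-matching rep? (niceEdge? j c) (λ v e → on? v (M e))
          (λ { v (u , nice@((_ , _ , p , _) , _)) → let e , o = proj₁ (rep-just c u p) in e , (v , u , nice , o) , o })
          (λ { v v′ e (_ , nice) (_ , nice′) → nice-unique nice nice′ })
        ends-same : ∀ {e x y y′} → Ends (M e) x y → Ends (M e) x y′ → y ≡ y′
        ends-same p q with ends-cover p (ends-right q) | ends-cover q (ends-right p)
        ... | inj₂ e | _ = sym e
        ... | inj₁ _ | inj₂ e = e
        ... | inj₁ refl | inj₁ refl = refl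
        partner-unique : ∀ {v v′ e x x′ u u′} → PartnerOf v e x u → PartnerOf v′ e x′ u′ → v ≡ v′
        partner-unique (nice , ends) (nice′ , ends′) with nice-unique nice nice′ (ends-left ends) (ends-left ends′)
        ... | refl = ends-same ends ends′
        edge-unique : ∀ {e e′ v} → On v (M e) → On v (M e′) → e ≡ e′
        edge-unique = disjoint M-rainbow
        along-count : # along? ≤ κ
        along-count = #-matching along? (parallel? c) (λ v e → on? v (M e))
          (λ { v (e , x , u , (nice , ends) , q) → e , (x , v , ends , q) , ends-right ends })
          λ { v v′ e (f , x , u , p@(_ , ends) , _) (f′ , x′ , u′ , p′@(_ , ends′) , _) o o′ →
            inj (edge-unique (ends-right ends) o) (edge-unique (ends-right ends′) o′) p p′ }
          where
          inj : ∀ {e f f′ v v′ x x′ u u′} → f ≡ e → f′ ≡ e → PartnerOf v f x u → PartnerOf v′ f′ x′ u′ → v ≡ v′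
          inj refl refl = partner-unique
        Target : V → Set
        Target z = own j c ≡ just z ⊎ OnPlain z
        target? : ∀ z → Dec (Target z)
        target? z = own≡? z ⊎-dec onPlain? z
        -- Since `v` can be freed, any other neighbour `z` would yield a clash: `z` is itself a
        -- claim if it is uncovered or opposite a nice end, and if `z` is a nice end then `v` is
        -- joined to its uncovered vertex `u′`.
        across-target : ∀ v → Across v → ∃ λ z → Target z × E c v z
        across-target v ((z , e) , k , x , u , (nice@(hit@(_ , u∉ , rep≡ , _) , _) , ends) , ¬q) = z , target , e
          where
          claim-v : Claim j c v u
          claim-v = inner x k nice ends
          z≢x : z ≢ x
          z≢x refl = ¬q (E-sym e)
          v≢x : v ≢ x
          v≢x refl = E-irr (ends-joined M-rainbow ends)
          outside-target : ¬ Covered M z → Target z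
          outside-target z∉ with own≡? z
          ... | yes p = inj₁ p
          ... | no ¬p with stuck c v u z z Rc claim-v (outer refl z∉ ¬p)
                             (λ { refl → ¬q (E-trans (E-sym (proj₂ (rep-just c u rep≡))) (E-sym e) (v≢x ∘ sym)) }) e
          ...   | f , _ , o = contradiction (f , o) z∉
          nice-target : ∀ {f} → On z (M f) → NiceEdge j c f → ⊥
          nice-target {f} oz (x′ , u′ , nice′@(hit′@(_ , u′∉ , rep′≡ , own≢′) , _) , ox′) with on-ends ox′
          ... | y , ends′ with ends-cover ends′ oz
          ...   | inj₁ refl with stuck c v u u′ u′ Rc claim-v (outer refl u′∉ own≢′)
                                   (λ { refl → z≢x (rep-functional hit′ hit) })
                                   (E-trans e (E-sym (proj₂ (rep-just c u′ rep′≡))) (λ { refl → u′∉ (k , ends-right ends) }))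
          ...     | f′ , _ , o = u′∉ (f′ , o)
          nice-target {f} oz (x′ , u′ , nice′@(hit′ , _) , ox′) | y , ends′ | inj₂ refl
            with stuck c v u z u′ Rc claim-v (inner x′ f nice′ ends′) u≢u′ e
            where
            u≢u′ : u ≢ u′
            u≢u′ refl with rep-functional hit hit′
            ... | refl with edge-unique (ends-left ends) (ends-left ends′)
            ...   | refl with ends-same ends ends′
            ...     | refl = E-irr e
          ... | f′ , ov , oz′ with edge-unique ov (ends-right ends) | edge-unique oz′ oz
          ...   | refl | refl with ends-cover ends oz
          ...     | inj₁ z≡x = z≢x z≡x
          ...     | inj₂ refl = E-irr e
          target : Target z
          target with covered? M z
          ... | no z∉ = outside-target z∉
          ... | yes (f , oz) with niceEdge? j c f
          ...   | yes p = ⊥-elim (nice-target oz p)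
          ...   | no ¬p = inj₂ (f , ((λ e≡ → subst (On z) e≡ oz) , ¬p) , oz)
        across-inj : ∀ v v′ z → Across v → Across v′ → E c v z → E c v′ z → v ≡ v′
        across-inj v v′ z (_ , e , x , u , p@(nice , ends) , _) (_ , e′ , x′ , u′ , p′@(nice′ , ends′) , _) q q′ with v ≟ v′
        ... | yes r = r
        ... | no v≢ with u ≟ u′
        ...   | yes refl with rep-functional (proj₁ nice) (proj₁ nice′)
        ...     | refl with edge-unique (ends-left ends) (ends-left ends′)
        ...       | refl = ends-same ends ends′
        across-inj v v′ z (_ , e , x , u , p@(nice , ends) , _) (_ , e′ , x′ , u′ , p′@(nice′ , ends′) , _) q q′
            | no v≢ | no u≢ with stuck c v u v′ u′ Rc (inner x e nice ends) (inner x′ e′ nice′ ends′) u≢ (E-trans q (E-sym q′) v≢)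
        ... | k , o , o′ with edge-unique o (ends-right ends) | edge-unique o′ (ends-right ends′)
        ...   | refl | refl = partner-unique p p′
        across-count : # across? ≤ 1 + (π + π)
        across-count = ≤-trans (#-matching across? target? (E? c) across-target across-inj)
          (≤-trans (#-⊎ target? own≡? onPlain? (λ _ → id)) (+-mono-≤ own-unique (#-endpoints M plain?)))

      private
        m = # (used? M)
        cov = # (hasNeighbour? c)

        cov≤ : cov ≤ # outside? + # inside?
        cov≤ = #-⊎ (hasNeighbour? c) outside? inside? λ v h → case covered? M v of λ
          { (yes p) → inj₂ (h , p) ; (no ¬p) → inj₁ (h , ¬p) }

        inside≤ : # inside? ≤ m + m
        inside≤ = ≤-trans (#-mono inside? (covered? M) (λ v → proj₂)) (covered-count M)

        rough : cov ≤ 4 + β + ν + (m + m)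
        rough = ≤-trans cov≤ (+-mono-≤ outside-count inside≤)

      -- The fine bound is added once and the bound `rough` twice. With these weights `ν` and `π`
      -- both receive the coefficient 4, and their sum is at most `m`; no separate proof that `π` is
      -- small is required.
      coverage-bound : 3 * # (hasNeighbour? c) ≤ 8 * # (used? M) + # (parallel? c) + 3 * # (badHit? j c) + 13
      coverage-bound = begin
        cov + (cov + (cov + 0)) ≤⟨ +-mono-≤ (≤-trans cov≤ (+-mono-≤ outside-count inside-count)) (+-mono-≤ rough (+-monoˡ-≤ 0 rough)) ⟩
        (4 + β + ν + (π + π + (ν + (κ + (1 + (π + π)))))) + (4 + β + ν + (m + m) + (4 + β + ν + (m + m) + 0))
          ≡⟨ arith β ν π κ m ⟩
        4 * (ν + π) + (4 * m + (κ + 3 * β + 13)) ≤⟨ +-monoˡ-≤ _ (*-monoʳ-≤ 4 nice+plain) ⟩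
        4 * m + (4 * m + (κ + 3 * β + 13)) ≡⟨ arith₂ m κ β ⟩
        8 * m + κ + 3 * β + 13 ∎
        where
        open ≤-Reasoning
        arith : ∀ β ν π κ m → (4 + β + ν + (π + π + (ν + (κ + (1 + (π + π)))))) + (4 + β + ν + (m + m) + (4 + β + ν + (m + m) + 0)) ≡ 4 * (ν + π) + (4 * m + (κ + 3 * β + 13))
        arith = solve-∀
        arith₂ : ∀ m κ β → 4 * m + (4 * m + (κ + 3 * β + 13)) ≡ 8 * m + κ + 3 * β + 13
        arith₂ = solve-∀

      nice-bound : # (hasNeighbour? c) ≤ 4 + # (badHit? j c) + # (niceEdge? j c) + (# (used? M) + # (used? M))
      nice-bound = rough

  -- Augmentation as long as at least w colours are missing.

  module Step {N n : ℕ} (G : CliqueColouring N n)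
    (M : Assignment N n) (M-rainbow : IsRainbowMatching G M) (Λ Γ H K L : ℕ)
    (n<ΛH : n < suc H * Λ)
    (Λ-large : K + K * (L * H) < Λ)
    (Γ-large : K + K * (L * H) + K * Λ < Γ)
    (K-large : 3 * L + 5 ≤ K)
    (s w q : ℕ) (s>13 : 13 < s) (w>0 : 0 < w)
    (n<Ls : n < L * suc s)
    (Γ-small : 2 * n * Γ ≤ w * s)
    (w≤missing : w ≤ missing M)
    (coverage : ∀ c → 3 * n ≤ # (CliqueColouring.hasNeighbour? G c) + 2 * s)
    (multiplicity : ∀ x y → # (λ c → CliqueColouring.E? G c x y) ≤ q)
    (q-small : q + 15 * s ≤ n) where
    open CliqueColouring G
    open Counting G M M-rainbow Λ Γ H K L n<ΛH Λ-large Γ-large K-large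

    private
      R? : ∀ j c → Dec (R j c)
      R? j = Stage.R? (stage j)

      ρ : ℕ → ℕ
      ρ j = # (R? j)

      m = # (used? M)

      missing+m : missing M + m ≡ n
      missing+m = #-complement (missing? M)

      m≤n : m ≤ n
      m≤n = #-bound (used? M)

      missing⊆R : ∀ j c → M c ≡ nothing → R j c
      missing⊆R zero    c h = h
      missing⊆R (suc j) c h = inj₁ (missing⊆R j c h)

      w≤ρ : ∀ j → w ≤ ρ j
      w≤ρ j = ≤-trans w≤missing (#-mono (missing? M) (R? j) (missing⊆R j))

      slow-growth : ∀ L → n < L * suc s → ∃ λ j → j < L × ρ (suc j) ≤ ρ j + s
      slow-growth L n< = search L λ h → <⇒≱ n< (≤-trans h (#-bound (R? L)))
        where
        search : ∀ L → ¬ L * suc s ≤ ρ L → ∃ λ j → j < L × ρ (suc j) ≤ ρ j + s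
        search zero    h = contradiction z≤n h
        search (suc L) h with ρ (suc L) ≤? ρ L + s
        ... | yes p = L , ≤-refl , p
        ... | no ¬p with search L (λ g → h (≤-trans (+-monoʳ-≤ (suc s) g)
                           (≤-trans (≤-reflexive (trans (+-comm (suc s) (ρ L)) (+-suc (ρ L) s))) (≰⇒> ¬p))))
        ...   | j , j<L , r = j , m≤n⇒m≤1+n j<L , r

      -- Summed by vertices: only the at most 2n covered vertices are hit. A bad hit is a hit at a
      -- pair that is not heavy, and a vertex that is not light has fewer than Γ colours with such
      -- hits.
      bad-total : ∀ j → sum (λ c → # (badHit? j c)) ≤ 2 * n * Γ
      bad-total j = begin
        sum (λ c → # (badHit? j c))                      ≡⟨ ∑-comm (λ c x → 𝟙 (badHit? j c x)) ⟩
        sum (λ x → # (λ c → badHit? j c x))              ≤⟨ sum-mono column ⟩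
        sum (λ x → 𝟙 (covered? M x) * Γ)                 ≡⟨ sym (*-distribʳ-sum Γ (λ x → 𝟙 (covered? M x))) ⟩
        # (covered? M) * Γ                               ≤⟨ *-monoˡ-≤ Γ (≤-trans (covered-count M) (≤-trans (+-mono-≤ m≤n m≤n) (≤-reflexive (cong (n +_) (sym (+-identityʳ n)))))) ⟩
        2 * n * Γ ∎
        where
        open ≤-Reasoning
        column : ∀ x → # (λ c → badHit? j c x) ≤ 𝟙 (covered? M x) * Γ
        column x with covered? M x
        ... | no x∉ = ≤-reflexive (#-none (λ c → badHit? j c x) λ { c (u , (_ , _ , p , _) , _) → x∉ (proj₁ (rep-just c u p)) })
        ... | yes _ with light? (stage j) x
        ...   | yes l = ≤-trans (≤-reflexive (#-none (λ c → badHit? j c x) λ { c (u , _ , ¬o) → ¬o (inj₂ l) })) z≤n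
        ...   | no ¬l = ≤-trans (#-mono (λ c → badHit? j c x) (λ c → lightHit? (stage j) c x) λ { c (u , h , ¬o) → u , h , ¬o ∘ inj₁ })
                          (≤-trans (<⇒≤ (≰⇒> ¬l)) (≤-reflexive (sym (+-identityʳ Γ))))

      -- Summed by edges of M instead of colours: each edge is parallel to at most `q` colours.
      parallel-total : sum (λ c → # (parallel? c)) ≤ n * q
      parallel-total = begin
        sum (λ c → # (parallel? c))           ≡⟨ ∑-comm (λ c e → 𝟙 (parallel? c e)) ⟩
        sum (λ e → # (λ c → parallel? c e))   ≤⟨ sum-mono column ⟩
        sum (λ (e : C) → q)                   ≡⟨ sum-const n q ⟩
        n * q                                 ∎
        where
        open ≤-Reasoning
        column : ∀ e → # (λ c → parallel? c e) ≤ q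
        column e = by (M e) refl
          where
          joined-by : ∀ {c x y x′ y′} → Ends (just (x , y)) x′ y′ → E c x′ y′ → E c x y
          joined-by (inj₁ refl) p = p
          joined-by (inj₂ refl) p = E-sym p
          by : ∀ o → M e ≡ o → # (λ c → parallel? c e) ≤ q
          by nothing eq = ≤-trans (≤-reflexive (#-none (λ c → parallel? c e) λ { c (x , y , ends , _) →
            subst (On x) eq (ends-left ends) })) z≤n
          by (just (x , y)) eq = ≤-trans (#-mono (λ c → parallel? c e) (λ c → E? c x y) λ { c (x′ , y′ , ends , p) →
            joined-by (subst (λ o → Ends o x′ y′) eq ends) p }) (multiplicity x y)

      module _ (j : ℕ) (stuck : Stuck j) where

        r = ρ j

        -- Here the linear number of missing colours is spent: it makes the loss at most `s` per
        -- colour of `R` on average.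
        bad≤ : sum (λ c → # (badHit? j c)) ≤ r * s
        bad≤ = ≤-trans (bad-total j) (≤-trans Γ-small (*-monoˡ-≤ s (w≤ρ j)))

        over-R : ∀ {f : C → ℕ} a b → (∀ c → R j c → a ≤ b + f c) → r * a ≤ r * b + sum f
        over-R {f} a b h = begin
          r * a                                             ≡⟨ *-distribʳ-sum a (λ c → 𝟙 (R? j c)) ⟩
          sum (λ c → 𝟙 (R? j c) * a)                        ≤⟨ sum-mono term ⟩
          sum (λ c → 𝟙 (R? j c) * b + f c)                  ≡⟨ ∑-distrib-+ (λ c → 𝟙 (R? j c) * b) f ⟩
          sum (λ c → 𝟙 (R? j c) * b) + sum f                ≡⟨ cong (_+ sum f) (sym (*-distribʳ-sum b (λ c → 𝟙 (R? j c)))) ⟩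
          r * b + sum f                                     ∎
          where
          open ≤-Reasoning
          term : ∀ c → 𝟙 (R? j c) * a ≤ 𝟙 (R? j c) * b + f c
          term c with R? j c
          ... | yes Rc = ≤-trans (≤-reflexive (+-identityʳ a)) (≤-trans (h c Rc) (≤-reflexive (cong (_+ f c) (sym (+-identityʳ b)))))
          ... | no  _  = z≤n

        r>0 : 0 < r
        r>0 = ≤-trans w>0 (w≤ρ j)

        -- For each colour of `R`, three times its coverage is at least 9n - 6s but at most 8n + 13
        -- plus parallel and bad terms, so about n must come from these. Summation over `R` replaces
        -- them by their totals.
        parallel-bound : r * n ≤ r * (13 + 9 * s) + n * q
        parallel-bound = +-cancelˡ-≤ (r * (8 * n)) _ _ (begin
          r * (8 * n) + r * n                                     ≡⟨ arith₁ r n ⟩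
          r * (9 * n)                                             ≤⟨ over-R (9 * n) (8 * n + 13 + 6 * s) each ⟩
          r * (8 * n + 13 + 6 * s) + sum (λ c → # (parallel? c) + 3 * # (badHit? j c))
            ≡⟨ cong (r * (8 * n + 13 + 6 * s) +_) (trans (∑-distrib-+ (λ c → # (parallel? c)) (λ c → 3 * # (badHit? j c)))
                 (cong (sum (λ c → # (parallel? c)) +_) (sym (*-distribˡ-sum 3 (λ c → # (badHit? j c)))))) ⟩
          r * (8 * n + 13 + 6 * s) + (sum (λ c → # (parallel? c)) + 3 * sum (λ c → # (badHit? j c)))
            ≤⟨ +-monoʳ-≤ (r * (8 * n + 13 + 6 * s)) (+-mono-≤ parallel-total (*-monoʳ-≤ 3 bad≤)) ⟩
          r * (8 * n + 13 + 6 * s) + (n * q + 3 * (r * s))        ≡⟨ arith₂ r n s q ⟩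
          r * (8 * n) + (r * (13 + 9 * s) + n * q)                ∎)
          where
          open ≤-Reasoning
          arith₁ : ∀ r n → r * (8 * n) + r * n ≡ r * (9 * n)
          arith₁ = solve-∀
          arith₂ : ∀ r n s q → r * (8 * n + 13 + 6 * s) + (n * q + 3 * (r * s)) ≡ r * (8 * n) + (r * (13 + 9 * s) + n * q)
          arith₂ = solve-∀
          arith₃ : ∀ m κ β s → 8 * m + κ + 3 * β + 13 + 3 * (2 * s) ≡ 8 * m + 13 + 6 * s + (κ + 3 * β)
          arith₃ = solve-∀
          each : ∀ c → R j c → 9 * n ≤ 8 * n + 13 + 6 * s + (# (parallel? c) + 3 * # (badHit? j c))
          each c Rc = begin
            9 * n                                             ≡⟨ *-assoc 3 3 n ⟩
            3 * (3 * n)                                       ≤⟨ *-monoʳ-≤ 3 (coverage c) ⟩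
            3 * (# (hasNeighbour? c) + 2 * s)                 ≡⟨ *-distribˡ-+ 3 (# (hasNeighbour? c)) (2 * s) ⟩
            3 * # (hasNeighbour? c) + 3 * (2 * s)             ≤⟨ +-monoˡ-≤ (3 * (2 * s)) (coverage-bound stuck Rc) ⟩
            8 * m + # (parallel? c) + 3 * # (badHit? j c) + 13 + 3 * (2 * s) ≡⟨ arith₃ m (# (parallel? c)) (# (badHit? j c)) s ⟩
            8 * m + 13 + 6 * s + (# (parallel? c) + 3 * # (badHit? j c)) ≤⟨ +-monoˡ-≤ (# (parallel? c) + 3 * # (badHit? j c)) (+-monoˡ-≤ (6 * s) (+-monoˡ-≤ 13 (*-monoʳ-≤ 8 m≤n))) ⟩
            8 * n + 13 + 6 * s + (# (parallel? c) + 3 * # (badHit? j c)) ∎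

        missing+nice : ∀ c → missing M + # (niceEdge? j c) ≤ ρ (suc j)
        missing+nice c = ≤-trans (≤-reflexive (sym (∑-distrib-+ (λ e → 𝟙 (missing? M e)) (λ e → 𝟙 (niceEdge? j c e))))) (sum-mono term)
          where
          in-R : ∀ e → NiceEdge j c e → R (suc j) e
          in-R e (x , u , (_ , inj₁ h , _) , o) = inj₂ (inj₁ (x , u , o , h))
          in-R e (x , u , (_ , inj₂ l , _) , o) = inj₂ (inj₂ (x , o , l))
          term : ∀ e → 𝟙 (missing? M e) + 𝟙 (niceEdge? j c e) ≤ 𝟙 (R? (suc j) e)
          term e with missing? M e | niceEdge? j c e
          ... | yes e∅ | yes (x , _ , _ , o) = ⊥-elim (subst (On x) e∅ o)
          ... | yes e∅ | no _ = ≤-reflexive (sym (𝟙-yes (R? (suc j) e) (missing⊆R (suc j) e e∅)))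
          ... | no  _  | yes p = ≤-reflexive (sym (𝟙-yes (R? (suc j) e) (in-R e p)))
          ... | no  _  | no _ = z≤n

        -- At most 2m vertices of a colour lie on M, so nearly n + 2(n - m) lie outside it and
        -- produce almost as many nice edges. Their colours enter `R` in the next round, where the n
        -- - m missing colours already are.
        growth-bound : n ≤ 4 + ρ (suc j) + 3 * s
        growth-bound = *-cancelˡ-≤ r ⦃ >-nonZero r>0 ⦄ (begin
          r * n                                                     ≤⟨ over-R n (4 + ρ (suc j) + 2 * s) each ⟩
          r * (4 + ρ (suc j) + 2 * s) + sum (λ c → # (badHit? j c)) ≤⟨ +-monoʳ-≤ (r * (4 + ρ (suc j) + 2 * s)) bad≤ ⟩
          r * (4 + ρ (suc j) + 2 * s) + r * s                       ≡⟨ arith r (ρ (suc j)) s ⟩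
          r * (4 + ρ (suc j) + 3 * s)                               ∎)
          where
          open ≤-Reasoning
          arith : ∀ r p s → r * (4 + p + 2 * s) + r * s ≡ r * (4 + p + 3 * s)
          arith = solve-∀
          arith₁ : ∀ a n → a + (2 * n + n) ≡ 3 * n + a
          arith₁ = solve-∀
          arith₂ : ∀ a b β ν s → 4 + β + ν + (b + b) + 2 * s + (a + (a + a)) ≡ 2 * (a + b) + (4 + (a + ν) + 2 * s + β)
          arith₂ = solve-∀
          each : ∀ c → R j c → n ≤ 4 + ρ (suc j) + 2 * s + # (badHit? j c)
          -- Adding three times `missing M` turns the 2m into 2n and leaves one `missing M` to go
          -- with the nice edges.
          each c Rc = +-cancelˡ-≤ (2 * n) _ _ (begin
            2 * n + n                                     ≤⟨ m≤n+m (2 * n + n) (missing M + (missing M + missing M)) ⟩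
            missing M + (missing M + missing M) + (2 * n + n) ≡⟨ arith₁ (missing M + (missing M + missing M)) n ⟩
            3 * n + (missing M + (missing M + missing M)) ≤⟨ +-monoˡ-≤ (missing M + (missing M + missing M)) (coverage c) ⟩
            # (hasNeighbour? c) + 2 * s + (missing M + (missing M + missing M)) ≤⟨ +-monoˡ-≤ (missing M + (missing M + missing M)) (+-monoˡ-≤ (2 * s) (nice-bound stuck Rc)) ⟩
            4 + # (badHit? j c) + # (niceEdge? j c) + (m + m) + 2 * s + (missing M + (missing M + missing M))
              ≡⟨ arith₂ (missing M) m (# (badHit? j c)) (# (niceEdge? j c)) s ⟩
            2 * (missing M + m) + (4 + (missing M + # (niceEdge? j c)) + 2 * s + # (badHit? j c))
              ≤⟨ +-mono-≤ (≤-reflexive (cong (2 *_) missing+m)) (+-monoˡ-≤ (# (badHit? j c)) (+-monoˡ-≤ (2 * s) (+-monoʳ-≤ 4 (missing+nice c)))) ⟩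
            2 * n + (4 + ρ (suc j) + 2 * s + # (badHit? j c)) ∎)

        -- The origin of 15 in `q-small`. Slow growth gives n ≤ r + 5s, and with q ≤ n - 15s this
        -- makes n(r - q) at least 10sn. But `parallel-bound` and 13 < s make it less than 10sr, so
        -- n < r.
        absurd : ρ (suc j) ≤ r + s → ⊥
        absurd slow = <⇒≱ n<r (#-bound (R? j))
          where
          open ≤-Reasoning
          n≤r+5s : n ≤ r + 5 * s
          n≤r+5s = begin
            n                         ≤⟨ growth-bound ⟩
            4 + ρ (suc j) + 3 * s     ≤⟨ +-monoˡ-≤ (3 * s) (+-monoʳ-≤ 4 slow) ⟩
            4 + (r + s) + 3 * s       ≡⟨ arith r s ⟩
            4 + (r + 4 * s)           ≤⟨ +-monoˡ-≤ (r + 4 * s) (≤-trans (m≤m+n 4 9) (<⇒≤ s>13)) ⟩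
            s + (r + 4 * s)           ≡⟨ arith′ r s ⟩
            r + 5 * s                 ∎
            where
            arith : ∀ r s → 4 + (r + s) + 3 * s ≡ 4 + (r + 4 * s)
            arith = solve-∀
            arith′ : ∀ r s → s + (r + 4 * s) ≡ r + 5 * s
            arith′ = solve-∀
          n<r : n < r
          n<r = *-cancelˡ-< (10 * s) n r (+-cancelˡ-< (n * n + 5 * s * n) _ _ (begin-strict
            n * n + 5 * s * n + 10 * s * n              ≤⟨ +-monoˡ-≤ (10 * s * n) (+-monoˡ-≤ (5 * s * n) (*-monoʳ-≤ n n≤r+5s)) ⟩
            n * (r + 5 * s) + 5 * s * n + 10 * s * n    ≡⟨ arith₁ r n s ⟩
            r * n + 20 * (s * n)                        ≤⟨ +-monoˡ-≤ (20 * (s * n)) parallel-bound ⟩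
            r * (13 + 9 * s) + n * q + 20 * (s * n)     ≡⟨ arith₂ r n s q ⟩
            r * (13 + 9 * s) + n * (q + 15 * s) + 5 * s * n <⟨ +-monoˡ-< (5 * s * n) (+-mono-<-≤ (*-monoʳ-< r ⦃ >-nonZero r>0 ⦄ (+-monoˡ-< (9 * s) s>13)) (*-monoʳ-≤ n q-small)) ⟩
            r * (s + 9 * s) + n * n + 5 * s * n         ≡⟨ arith₃ r n s ⟩
            n * n + 5 * s * n + 10 * s * r              ∎))
            where
            arith₁ : ∀ r n s → n * (r + 5 * s) + 5 * s * n + 10 * s * n ≡ r * n + 20 * (s * n)
            arith₁ = solve-∀
            arith₂ : ∀ r n s q → r * (13 + 9 * s) + n * q + 20 * (s * n) ≡ r * (13 + 9 * s) + n * (q + 15 * s) + 5 * s * n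
            arith₂ = solve-∀
            arith₃ : ∀ r n s → r * (s + 9 * s) + n * n + 5 * s * n ≡ n * n + 5 * s * n + 10 * s * r
            arith₃ = solve-∀

      Clash : ℕ → Set
      Clash j = ∃ λ c → ∃ λ y → ∃ λ u → ∃ λ y′ → ∃ λ u′ →
        R j c × Claim j c y u × Claim j c y′ u′ × u ≢ u′ × E c y y′ × ¬ SameEdge y y′

      clash? : ∀ j → Dec (Clash j)
      clash? j = any? λ c → any? λ y → any? λ u → any? λ y′ → any? λ u′ →
        R? j c ×-dec (claim? j c y u ×-dec (claim? j c y′ u′ ×-dec (¬? (u ≟ u′) ×-dec (E? c y y′ ×-dec ¬? (sameEdge? y y′)))))

    augmented : Augmented {G = G} M
    augmented with slow-growth L n<Ls
    ... | j , j<L , slow with clash? j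
    ...   | yes (c , y , u , y′ , u′ , r , cl , cl′ , u≢ , e , ¬same) = augment-claims (<⇒≤ j<L) r cl cl′ u≢ ¬same e
    ...   | no ¬clash = ⊥-elim (absurd j stuck slow)
      where
      stuck : Stuck j
      stuck c y u y′ u′ r cl cl′ u≢ e = decidable-stable (sameEdge? y y′) λ ¬same →
        ¬clash (c , y , u , y′ , u′ , r , cl , cl′ , u≢ , e , ¬same)

  -- A random vertex set, by exponential moments.

  flatten : {A : Set} → List (A × A) → List A
  flatten []             = []
  flatten ((a , b) ∷ es) = a ∷ b ∷ flatten es

  #ˡ : {A : Set} {Q : A → Set} → (∀ x → Dec (Q x)) → List A → ℕ
  #ˡ Q? []       = 0
  #ˡ Q? (x ∷ xs) = 𝟙 (Q? x) + #ˡ Q? xs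

  module Sampling (p : ℕ) where

    P : ℕ
    P = suc p

    -- χ selects the vertices v with lookup χ v ≡ zero, a fraction 1 / P of all on average.
    Choice : ℕ → Set
    Choice N = Vec (Fin P) N

    ∑ : ∀ {N} → (Choice N → ℕ) → ℕ
    ∑ {zero}  F = F []
    ∑ {suc N} F = sum (λ a → ∑ (λ χ → F (a ∷ χ)))

    ∑-mono : ∀ {N} {F F′ : Choice N → ℕ} → (∀ χ → F χ ≤ F′ χ) → ∑ F ≤ ∑ F′
    ∑-mono {zero}  h = h []
    ∑-mono {suc N} h = sum-mono (λ a → ∑-mono (λ χ → h (a ∷ χ)))

    ∑-cong : ∀ {N} {F F′ : Choice N → ℕ} → (∀ χ → F χ ≡ F′ χ) → ∑ F ≡ ∑ F′
    ∑-cong h = ≤-antisym (∑-mono (≤-reflexive ∘ h)) (∑-mono (≤-reflexive ∘ sym ∘ h))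

    ∑-*ʳ : ∀ {N} (F : Choice N → ℕ) c → ∑ F * c ≡ ∑ (λ χ → F χ * c)
    ∑-*ʳ {zero}  F c = refl
    ∑-*ʳ {suc N} F c = trans (*-distribʳ-sum c (λ a → ∑ (λ χ → F (a ∷ χ)))) (sum-cong-≗ (λ a → ∑-*ʳ (λ χ → F (a ∷ χ)) c))

    ∑-const : ∀ N c → ∑ {N} (λ _ → c) ≡ P ^ N * c
    ∑-const zero    c = sym (*-identityˡ c)
    ∑-const (suc N) c = trans (sum-cong-≗ (λ (_ : Fin P) → ∑-const N c))
      (trans (sum-const P (P ^ N * c)) (sym (*-assoc P (P ^ N) c)))

    ∑-sum : ∀ {N k} (F : Fin k → Choice N → ℕ) → ∑ (λ χ → sum (λ c → F c χ)) ≡ sum (λ c → ∑ (F c))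
    ∑-sum {zero}  F = refl
    ∑-sum {suc N} F = trans (sum-cong-≗ (λ a → ∑-sum (λ c χ → F c (a ∷ χ)))) (∑-comm (λ a c → ∑ (λ χ → F c (a ∷ χ))))

    ∑-zero : ∀ {N} (F : Choice N → ℕ) → ∑ F < P ^ N → ∃ λ χ → F χ ≡ 0
    ∑-zero {zero}  F lt = [] , n<1⇒n≡0 lt
    ∑-zero {suc N} F lt with any? (λ a → ∑ (λ χ → F (a ∷ χ)) <? P ^ N)
    ... | yes (a , lt′) = let χ , e = ∑-zero (λ χ → F (a ∷ χ)) lt′ in a ∷ χ , e
    ... | no ¬lt = contradiction lt (≤⇒≯ (≤-trans (≤-reflexive (sym (sum-const P (P ^ N)))) (sum-mono (λ a → ≮⇒≥ (λ lt′ → ¬lt (a , lt′))))))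

    -- Overwriting the coordinate `v` in all choices yields every choice P times. This integrates
    -- out one vertex at a time.
    resample : ∀ {N} (F : Choice N → ℕ) v → ∑ F * P ≡ ∑ (λ χ → sum (λ a → F (χ [ v ]≔ a)))
    resample {suc N} F zero = begin
      sum (λ a → ∑ (λ χ → F (a ∷ χ))) * P                ≡⟨ *-comm (sum (λ a → ∑ (λ χ → F (a ∷ χ)))) P ⟩
      P * sum (λ a → ∑ (λ χ → F (a ∷ χ)))                ≡⟨ sym (sum-const P (sum (λ a → ∑ (λ χ → F (a ∷ χ))))) ⟩
      sum (λ (b : Fin P) → sum (λ a → ∑ (λ χ → F (a ∷ χ)))) ≡⟨ sum-cong-≗ (λ (b : Fin P) → sym (∑-sum (λ a χ → F (a ∷ χ)))) ⟩
      sum (λ (b : Fin P) → ∑ (λ χ → sum (λ a → F (a ∷ χ)))) ∎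
      where open ≡-Reasoning
    resample {suc N} F (suc v) = trans (*-distribʳ-sum P (λ a → ∑ (λ χ → F (a ∷ χ))))
      (sum-cong-≗ (λ a → resample (λ χ → F (a ∷ χ)) v))

    InSample : ∀ {N} → Choice N → Fin N → Set
    InSample χ v = lookup χ v ≡ zero

    inSample? : ∀ {N} (χ : Choice N) v → Dec (InSample χ v)
    inSample? χ v = lookup χ v ≟ zero

    -- The coordinates are independent: a vertex of `T` contributes a mean factor of (2 + p) / P =
    -- (P + 1) / P, any other vertex a factor 1. This moment controls the upper tail.
    moment : ∀ {N} {T : Fin N → Set} (T? : ∀ v → Dec (T v)) →
      ∑ (λ χ → 2 ^ # (λ v → T? v ×-dec inSample? χ v)) * P ^ # T? ≡ suc P ^ # T? * P ^ N
    moment {zero}  T? = refl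
    moment {suc N} T? = begin
      sum (λ a → ∑ (λ χ → 2 ^ (𝟙 (T? zero ×-dec (a ≟ zero)) + tail χ))) * P ^ (𝟙 (T? zero) + # (T? ∘ suc))
        ≡⟨ cong (_* P ^ (𝟙 (T? zero) + # (T? ∘ suc))) (sum-cong-≗ factor) ⟩
      sum (λ a → f a * rest) * P ^ (𝟙 (T? zero) + # (T? ∘ suc))
        ≡⟨ cong₂ _*_ (sym (*-distribʳ-sum rest f)) (^-distribˡ-+-* P (𝟙 (T? zero)) _) ⟩
      sum f * rest * (P ^ 𝟙 (T? zero) * P ^ # (T? ∘ suc))
        ≡⟨ [m*n]*[o*p]≡[m*o]*[n*p] (sum f) rest (P ^ 𝟙 (T? zero)) (P ^ # (T? ∘ suc)) ⟩
      sum f * P ^ 𝟙 (T? zero) * (rest * P ^ # (T? ∘ suc))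
        ≡⟨ cong₂ _*_ (head-sum (T? zero)) (moment (T? ∘ suc)) ⟩
      suc P ^ 𝟙 (T? zero) * P * (suc P ^ # (T? ∘ suc) * P ^ N)
        ≡⟨ [m*n]*[o*p]≡[m*o]*[n*p] (suc P ^ 𝟙 (T? zero)) P _ _ ⟩
      suc P ^ 𝟙 (T? zero) * suc P ^ # (T? ∘ suc) * (P * P ^ N)
        ≡⟨ cong (_* (P * P ^ N)) (sym (^-distribˡ-+-* (suc P) (𝟙 (T? zero)) _)) ⟩
      suc P ^ (𝟙 (T? zero) + # (T? ∘ suc)) * (P * P ^ N) ∎
      where
      open ≡-Reasoning
      tail : Choice N → ℕ
      tail χ = # (λ v → T? (suc v) ×-dec inSample? χ v)
      rest : ℕ
      rest = ∑ (λ χ → 2 ^ tail χ)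
      f : Fin P → ℕ
      f a = 2 ^ 𝟙 (T? zero ×-dec (a ≟ zero))
      factor : ∀ a → ∑ (λ χ → 2 ^ (𝟙 (T? zero ×-dec (a ≟ zero)) + tail χ)) ≡ f a * rest
      factor a = trans (∑-cong (λ χ → trans (^-distribˡ-+-* 2 (𝟙 (T? zero ×-dec (a ≟ zero))) (tail χ)) (*-comm (f a) _)))
        (trans (sym (∑-*ʳ (λ χ → 2 ^ tail χ) (f a))) (*-comm rest (f a)))
      head-sum : {A : Set} (d : Dec A) → sum (λ a → 2 ^ 𝟙 (d ×-dec (a ≟ zero))) * P ^ 𝟙 d ≡ suc P ^ 𝟙 d * P
      head-sum (yes _) = cong₂ _*_ (trans (cong (2 +_) (trans (sum-const p 1) (*-identityʳ p))) (sym (*-identityʳ (suc P)))) (*-identityʳ P)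
      head-sum (no  _) = trans (cong (_* 1) (trans (sum-const P 1) (*-identityʳ P))) (*-comm P 1)

    Within : ∀ {N} → Choice N → Fin N × Fin N → Set
    Within χ (a , b) = InSample χ a × InSample χ b

    within? : ∀ {N} (χ : Choice N) e → Dec (Within χ e)
    within? χ (a , b) = inSample? χ a ×-dec inSample? χ b

    #within : ∀ {N} → List (Fin N × Fin N) → Choice N → ℕ
    #within es χ = #ˡ (within? χ) es

    -- For the lower tail one wants 2 to the power minus the number of edges inside the sample; a
    -- factor 2 for each edge keeps it a natural number.
    weight : Fin P → Fin P → ℕ
    weight zero    zero    = 1
    weight zero    (suc _) = 2
    weight (suc _) _       = 2

    cost : ∀ {N} → List (Fin N × Fin N) → Choice N → ℕ
    cost []             χ = 1
    cost ((a , b) ∷ es) χ = weight (lookup χ a) (lookup χ b) * cost es χ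

    cost-within : ∀ {N} (es : List (Fin N × Fin N)) χ → cost es χ * 2 ^ #within es χ ≡ 2 ^ length es
    cost-within []             χ = refl
    cost-within ((a , b) ∷ es) χ = begin
      weight (lookup χ a) (lookup χ b) * cost es χ * 2 ^ (𝟙 (within? χ (a , b)) + #within es χ)
        ≡⟨ cong (weight (lookup χ a) (lookup χ b) * cost es χ *_) (^-distribˡ-+-* 2 (𝟙 (within? χ (a , b))) _) ⟩
      weight (lookup χ a) (lookup χ b) * cost es χ * (2 ^ 𝟙 (within? χ (a , b)) * 2 ^ #within es χ)
        ≡⟨ [m*n]*[o*p]≡[m*o]*[n*p] (weight (lookup χ a) (lookup χ b)) (cost es χ) _ _ ⟩
      weight (lookup χ a) (lookup χ b) * 2 ^ 𝟙 (within? χ (a , b)) * (cost es χ * 2 ^ #within es χ)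
        ≡⟨ cong₂ _*_ (two (lookup χ a) (lookup χ b)) (cost-within es χ) ⟩
      2 * 2 ^ length es ∎
      where
      open ≡-Reasoning
      two : ∀ i j → weight i j * 2 ^ 𝟙 ((i ≟ zero) ×-dec (j ≟ zero)) ≡ 2
      two zero    zero    = refl
      two zero    (suc _) = refl
      two (suc _) _       = refl

    cost-update : ∀ {N} (es : List (Fin N × Fin N)) χ {v a} → All (v ≢_) (flatten es) → cost es (χ [ v ]≔ a) ≡ cost es χ
    cost-update []             χ _ = refl
    cost-update ((a , b) ∷ es) χ (v≢a ∷ v≢b ∷ v∉) =
      cong₂ _*_ (cong₂ weight (lookup∘updateAt′ _ _ (v≢a ∘ sym) χ) (lookup∘updateAt′ _ _ (v≢b ∘ sym) χ)) (cost-update es χ v∉)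

    W : ℕ
    W = sum (λ i → sum (λ j → weight i j))

    W-value : suc W ≡ 2 * (P * P)
    W-value = trans (cong (λ k → suc (suc (sum {p} (λ _ → 2)) + k)) (trans (sum-const p (sum {P} (λ _ → 2))) (cong (p *_) (sum-const P 2))))
      (trans (cong (λ k → suc (suc k + p * (P * 2))) (sum-const p 2)) (arith p))
      where
      arith : ∀ p → suc (suc (p * 2) + p * (suc p * 2)) ≡ 2 * (suc p * suc p)
      arith = solve-∀

    -- By disjointness, resampling `a` and `b` leaves the cost of the other edges unchanged, so each
    -- edge contributes an independent factor with mean W / P².
    cost-moment : ∀ {N} (es : List (Fin N × Fin N)) → Unique (flatten es) →
      ∑ (cost es) * (P * P) ^ length es ≡ W ^ length es * P ^ N
    cost-moment {N} [] _ = trans (*-identityʳ _) (trans (∑-const N 1) (*-comm (P ^ N) 1))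
    cost-moment {N} ((a , b) ∷ es) ((a≢b ∷ a∉) ∷ b∉ ∷ uniq) = begin
      ∑ H * (P * P * (P * P) ^ length es)
        ≡⟨ trans (sym (*-assoc (∑ H) (P * P) _)) (cong (_* (P * P) ^ length es) (sym (*-assoc (∑ H) P P))) ⟩
      ∑ H * P * P * (P * P) ^ length es
        ≡⟨ cong (λ x → x * P * (P * P) ^ length es) (resample H a) ⟩
      ∑ (λ χ → sum (λ i → H (χ [ a ]≔ i))) * P * (P * P) ^ length es
        ≡⟨ cong (_* (P * P) ^ length es) (resample (λ χ → sum (λ i → H (χ [ a ]≔ i))) b) ⟩
      ∑ (λ χ → sum (λ j → sum (λ i → H (χ [ b ]≔ j [ a ]≔ i)))) * (P * P) ^ length es
        ≡⟨ cong (_* (P * P) ^ length es) (trans (∑-cong collect) (sym (∑-*ʳ (cost es) W))) ⟩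
      ∑ (cost es) * W * (P * P) ^ length es
        ≡⟨ trans (cong (_* (P * P) ^ length es) (*-comm (∑ (cost es)) W)) (*-assoc W (∑ (cost es)) _) ⟩
      W * (∑ (cost es) * (P * P) ^ length es)
        ≡⟨ cong (W *_) (cost-moment es uniq) ⟩
      W * (W ^ length es * P ^ N)
        ≡⟨ sym (*-assoc W (W ^ length es) (P ^ N)) ⟩
      W * W ^ length es * P ^ N ∎
      where
      open ≡-Reasoning
      H : Choice N → ℕ
      H = cost ((a , b) ∷ es)
      split : ∀ χ i j → H (χ [ b ]≔ j [ a ]≔ i) ≡ weight i j * cost es χ
      split χ i j = cong₂ _*_
        (cong₂ weight (lookup∘updateAt a (χ [ b ]≔ j))
          (trans (lookup∘updateAt′ b a (a≢b ∘ sym) (χ [ b ]≔ j)) (lookup∘updateAt b χ)))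
        (trans (cost-update es (χ [ b ]≔ j) a∉) (cost-update es χ b∉))
      collect : ∀ χ → sum (λ j → sum (λ i → H (χ [ b ]≔ j [ a ]≔ i))) ≡ cost es χ * W
      collect χ = begin
        sum (λ j → sum (λ i → H (χ [ b ]≔ j [ a ]≔ i)))     ≡⟨ ∑-comm (λ j i → H (χ [ b ]≔ j [ a ]≔ i)) ⟩
        sum (λ i → sum (λ j → H (χ [ b ]≔ j [ a ]≔ i)))     ≡⟨ sum-cong-≗ (λ i → trans (sum-cong-≗ (λ j → split χ i j)) (sym (*-distribʳ-sum (cost es χ) (weight i)))) ⟩
        sum (λ i → sum (weight i) * cost es χ)             ≡⟨ sym (*-distribʳ-sum (cost es χ) (λ i → sum (weight i))) ⟩
        W * cost es χ                                      ≡⟨ *-comm W _ ⟩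
        cost es χ * W ∎

    -- The mean of F is y / x, cleared of denominators.
    markov : ∀ {N} {Bad : Choice N → Set} (bad? : ∀ χ → Dec (Bad χ)) (F : Choice N → ℕ) (t x y k : ℕ) →
      (∀ χ → Bad χ → t ≤ F χ) → ∑ F * x ≡ y * P ^ N → k * y < t * x → k * ∑ (λ χ → 𝟙 (bad? χ)) < P ^ N
    markov {N} bad? F t x y k big mom small = *-cancelʳ-< (t * x) _ _ (begin-strict
      k * B * (t * x)        ≡⟨ arith k B t x ⟩
      k * (B * t * x)        ≡⟨ cong (λ z → k * (z * x)) (∑-*ʳ (λ χ → 𝟙 (bad? χ)) t) ⟩
      k * (∑ (λ χ → 𝟙 (bad? χ) * t) * x) ≤⟨ *-monoʳ-≤ k (*-monoˡ-≤ x (∑-mono term)) ⟩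
      k * (∑ F * x)          ≡⟨ cong (k *_) mom ⟩
      k * (y * P ^ N)        ≡⟨ sym (*-assoc k y (P ^ N)) ⟩
      k * y * P ^ N          <⟨ *-monoˡ-< (P ^ N) ⦃ m^n≢0 P N ⦄ small ⟩
      t * x * P ^ N          ≡⟨ *-comm (t * x) (P ^ N) ⟩
      P ^ N * (t * x)        ∎)
      where
      open ≤-Reasoning
      B = ∑ (λ χ → 𝟙 (bad? χ))
      arith : ∀ k b t x → k * b * (t * x) ≡ k * (b * t * x)
      arith = solve-∀
      term : ∀ χ → 𝟙 (bad? χ) * t ≤ F χ
      term χ with bad? χ
      ... | yes h = ≤-trans (≤-reflexive (+-identityʳ t)) (big χ h)
      ... | no  _ = z≤n

    module _ {N n : ℕ} (n>0 : 0 < n) {T : Fin n → Fin N → Set} (T? : ∀ c v → Dec (T c v)) (es : Fin n → List (Fin N × Fin N))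
      (a k : ℕ) (uniq : ∀ c → Unique (flatten (es c))) (k≤ : ∀ c → k ≤ length (es c))
      (tail₁ : ∀ c → 2 * n * suc P ^ # (T? c) < 2 ^ (# (T? c) / suc a) * P ^ # (T? c))
      (tail₂ : ∀ c → 2 * n * W ^ length (es c) < 2 ^ (length (es c) ∸ k) * (P * P) ^ length (es c)) where

      private
        Bad₁ Bad₂ : Fin n → Choice N → Set
        Bad₁ c χ = # (T? c) < suc a * # (λ v → T? c v ×-dec inSample? χ v)
        Bad₂ c χ = #within (es c) χ < k
        bad₁? : ∀ c χ → Dec (Bad₁ c χ)
        bad₁? c χ = _ <? _
        bad₂? : ∀ c χ → Dec (Bad₂ c χ)
        bad₂? c χ = _ <? _
        few₁ : ∀ c → 2 * n * ∑ (λ χ → 𝟙 (bad₁? c χ)) < P ^ N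
        few₁ c = markov (bad₁? c) _ (2 ^ (# (T? c) / suc a)) _ _ (2 * n) big (moment (T? c)) (tail₁ c)
          where
          big : ∀ χ → Bad₁ c χ → 2 ^ (# (T? c) / suc a) ≤ 2 ^ # (λ v → T? c v ×-dec inSample? χ v)
          big χ lt = ^-monoʳ-≤ 2 {# (T? c) / suc a} {x} (<⇒≤ (*-cancelˡ-< (suc a) (# (T? c) / suc a) x
            (≤-<-trans (≤-trans (≤-reflexive (*-comm (suc a) (# (T? c) / suc a))) (m/n*n≤m (# (T? c)) (suc a))) lt)))
            where x = # (λ v → T? c v ×-dec inSample? χ v)
        few₂ : ∀ c → 2 * n * ∑ (λ χ → 𝟙 (bad₂? c χ)) < P ^ N
        few₂ c = markov (bad₂? c) (cost (es c)) (2 ^ (length (es c) ∸ k)) _ _ (2 * n) big (cost-moment (es c) (uniq c)) (tail₂ c)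
          where
          open ≤-Reasoning
          big : ∀ χ → Bad₂ c χ → 2 ^ (length (es c) ∸ k) ≤ cost (es c) χ
          big χ lt = *-cancelʳ-≤ _ _ (2 ^ k) ⦃ m^n≢0 2 k ⦄ (begin
            2 ^ (length (es c) ∸ k) * 2 ^ k      ≡⟨ sym (^-distribˡ-+-* 2 (length (es c) ∸ k) k) ⟩
            2 ^ (length (es c) ∸ k + k)          ≡⟨ cong (2 ^_) (m∸n+n≡m (k≤ c)) ⟩
            2 ^ length (es c)                    ≡⟨ sym (cost-within (es c) χ) ⟩
            cost (es c) χ * 2 ^ #within (es c) χ ≤⟨ *-monoʳ-≤ (cost (es c) χ) (^-monoʳ-≤ 2 (<⇒≤ lt)) ⟩
            cost (es c) χ * 2 ^ k                ∎)
        F : Choice N → ℕ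
        F χ = sum (λ c → 𝟙 (bad₁? c χ) + 𝟙 (bad₂? c χ))
        total : ∑ F < P ^ N
        total = *-cancelˡ-< (2 * n) (∑ F) (P ^ N) (begin-strict
          2 * n * ∑ F ≡⟨ cong (2 * n *_) (trans (∑-sum (λ c χ → 𝟙 (bad₁? c χ) + 𝟙 (bad₂? c χ))) (sum-cong-≗ split)) ⟩
          2 * n * sum (λ c → b₁ c + b₂ c) ≡⟨ *-distribˡ-sum (2 * n) (λ c → b₁ c + b₂ c) ⟩
          sum (λ c → 2 * n * (b₁ c + b₂ c)) <⟨ sum-mono-< n>0 (λ c → ≤-<-trans (≤-reflexive (*-distribˡ-+ (2 * n) (b₁ c) (b₂ c))) (+-mono-< (few₁ c) (few₂ c))) ⟩
          sum (λ (c : Fin n) → P ^ N + P ^ N) ≡⟨ sum-const n (P ^ N + P ^ N) ⟩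
          n * (P ^ N + P ^ N) ≡⟨ arith n (P ^ N) ⟩
          2 * n * P ^ N ∎)
          where
          open ≤-Reasoning
          b₁ b₂ : Fin n → ℕ
          b₁ c = ∑ (λ χ → 𝟙 (bad₁? c χ))
          b₂ c = ∑ (λ χ → 𝟙 (bad₂? c χ))
          arith : ∀ n t → n * (t + t) ≡ 2 * n * t
          arith = solve-∀
          split : ∀ c → ∑ (λ χ → 𝟙 (bad₁? c χ) + 𝟙 (bad₂? c χ)) ≡ b₁ c + b₂ c
          split c = trans (∑-cong (λ χ → cong (𝟙 (bad₁? c χ) +_) (sym (+-identityʳ _))))
            -- Additivity of `∑` is obtained from `∑-sum` by writing the two summands as a sum over
            -- `Fin 2`.
            (trans (∑-sum {k = 2} (λ { zero χ → 𝟙 (bad₁? c χ) ; (suc _) χ → 𝟙 (bad₂? c χ) })) (cong (b₁ c +_) (+-identityʳ _)))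

      -- A union bound over 2n events, two for each colour, each of probability below 1 / (2n).
      good-sample : ∃ λ χ → ∀ c →
        suc a * # (λ v → T? c v ×-dec inSample? χ v) ≤ # (T? c) × k ≤ #within (es c) χ
      good-sample with ∑-zero F total
      ... | χ , e = χ , λ c → ≮⇒≥ (λ b → absurd c (m≤m+n _ _) (𝟙-yes (bad₁? c χ) b)) , ≮⇒≥ (λ b → absurd c (m≤n+m _ (𝟙 (bad₁? c χ))) (𝟙-yes (bad₂? c χ) b))
        where
        absurd : ∀ c {x} → x ≤ 𝟙 (bad₁? c χ) + 𝟙 (bad₂? c χ) → x ≡ 1 → ⊥
        absurd c x≤ refl = <⇒≱ (≤-trans x≤ (term≤sum (λ c → 𝟙 (bad₁? c χ) + 𝟙 (bad₂? c χ)) c)) (≤-reflexive e)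

  -- Disjoint edges of one colour, deletion of vertices, greedy completion.

  length-flatten : {A : Set} (es : List (A × A)) → length (flatten es) ≡ 2 * length es
  length-flatten []       = refl
  length-flatten (_ ∷ es) = trans (cong (2 +_) (length-flatten es)) (sym (*-suc 2 (length es)))

  #ˡ-unique : ∀ {k} {Q : Fin k → Set} (Q? : ∀ v → Dec (Q v)) {xs} → Unique xs → #ˡ Q? xs ≤ # Q?
  #ˡ-unique {k} {Q} Q? {xs} uniq = ≤-trans (go uniq) (#-mono (λ v → (v ∈? xs) ×-dec Q? v) Q? (λ _ → proj₂))
    where
    open ≤-Reasoning
    go : ∀ {xs} → Unique xs → #ˡ Q? xs ≤ # (λ v → (v ∈? xs) ×-dec Q? v)
    go [] = z≤n
    go {x ∷ xs} (x∉ ∷ uniq) = begin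
      𝟙 (Q? x) + #ˡ Q? xs
        ≤⟨ +-mono-≤ (head (Q? x)) (go uniq) ⟩
      # (λ v → (v ≟ x) ×-dec Q? v) + # (λ v → (v ∈? xs) ×-dec Q? v)
        ≡⟨ sym (∑-distrib-+ (λ v → 𝟙 ((v ≟ x) ×-dec Q? v)) (λ v → 𝟙 ((v ∈? xs) ×-dec Q? v))) ⟩
      sum (λ v → 𝟙 ((v ≟ x) ×-dec Q? v) + 𝟙 ((v ∈? xs) ×-dec Q? v))
        ≤⟨ sum-mono (λ v → both (v ≟ x) (v ∈? xs) (Q? v) (v ∈? (x ∷ xs)) (λ { refl m → All.lookup x∉ m refl }) here there) ⟩
      # (λ v → (v ∈? (x ∷ xs)) ×-dec Q? v) ∎
      where
      head : (d : Dec (Q x)) → 𝟙 d ≤ # (λ v → (v ≟ x) ×-dec Q? v)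
      head (yes q) = #-≥1 (λ v → (v ≟ x) ×-dec Q? v) x (refl , q)
      head (no  _) = z≤n
      both : {A B C D : Set} (a : Dec A) (b : Dec B) (c : Dec C) (d : Dec D) → (A → B → ⊥) → (A → D) → (B → D) →
        𝟙 (a ×-dec c) + 𝟙 (b ×-dec c) ≤ 𝟙 (d ×-dec c)
      both (yes a) (yes b) c       d ex f g = ⊥-elim (ex a b)
      both (yes a) (no ¬b) (yes c) d ex f g = ≤-reflexive (sym (𝟙-yes (d ×-dec yes c) (f a , c)))
      both (yes a) (no ¬b) (no ¬c) d ex f g = z≤n
      both (no ¬a) b       c       d ex f g = 𝟙-mono (b ×-dec c) (d ×-dec c) (λ { (b , c) → g b , c })

  module _ {N n : ℕ} (G : CliqueColouring N n) where
    open CliqueColouring G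

    -- If a list of disjoint edges cannot be extended, every vertex of the colour outside it has all
    -- its neighbours on it, and two outside vertices with a common neighbour would be joined
    -- themselves. So at most as many vertices lie outside as on the list, that is, at most 4 per
    -- edge in all.
    disjoint-edges : ∀ c k → 4 * k ≤ # (hasNeighbour? c) →
      ∃ λ es → length es ≡ k × Unique (flatten es) × All (λ e → E c (proj₁ e) (proj₂ e)) es
    disjoint-edges c zero    _ = [] , refl , [] , []
    disjoint-edges c (suc k) le with disjoint-edges c k (≤-trans (*-monoʳ-≤ 4 (n≤1+n k)) le)
    ... | es , refl , uniq , joined
      with any? (λ a → any? λ b → ¬? (a ∈? flatten es) ×-dec (¬? (b ∈? flatten es) ×-dec E? c a b))
    ...   | yes (a , b , a∉ , b∉ , e) = (a , b) ∷ es , refl ,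
            ((λ { refl → E-irr e }) ∷ ¬Any⇒All¬ (flatten es) a∉) ∷ ¬Any⇒All¬ (flatten es) b∉ ∷ uniq , e ∷ joined
    ...   | no maximal = contradiction le (<⇒≱ (begin-strict
            # (hasNeighbour? c)                                 ≤⟨ #-⊎ (hasNeighbour? c) (λ v → v ∈? flatten es) rest? split ⟩
            # (λ v → v ∈? flatten es) + # rest?                 ≤⟨ +-monoʳ-≤ _ (#-matching rest? (λ v → v ∈? flatten es) (E? c) partner inj) ⟩
            # (λ v → v ∈? flatten es) + # (λ v → v ∈? flatten es) ≤⟨ +-mono-≤ (#-∈ (flatten es)) (#-∈ (flatten es)) ⟩
            length (flatten es) + length (flatten es)           ≡⟨ cong₂ _+_ (length-flatten es) (length-flatten es) ⟩
            2 * length es + 2 * length es                       ≡⟨ sym (*-distribʳ-+ (length es) 2 2) ⟩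
            4 * length es                                       <⟨ *-monoʳ-< 4 (n<1+n (length es)) ⟩
            4 * suc (length es)                                 ∎))
      where
      open ≤-Reasoning
      rest? : ∀ v → Dec (HasNeighbour c v × v ∉ flatten es)
      rest? v = hasNeighbour? c v ×-dec ¬? (v ∈? flatten es)
      split : ∀ v → HasNeighbour c v → v ∈ flatten es ⊎ (HasNeighbour c v × v ∉ flatten es)
      split v h with v ∈? flatten es
      ... | yes p = inj₁ p
      ... | no ¬p = inj₂ (h , ¬p)
      partner : ∀ v → HasNeighbour c v × v ∉ flatten es → ∃ λ w → w ∈ flatten es × E c v w
      partner v ((w , e) , v∉) with w ∈? flatten es
      ... | yes p = w , p , e
      ... | no ¬p = contradiction (v , w , v∉ , ¬p , e) maximal
      inj : ∀ v v′ w → HasNeighbour c v × v ∉ flatten es → HasNeighbour c v′ × v′ ∉ flatten es → E c v w → E c v′ w → v ≡ v′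
      inj v v′ w (_ , v∉) (_ , v′∉) e e′ with v ≟ v′
      ... | yes r = r
      ... | no v≢ = contradiction (v , v′ , v∉ , v′∉ , E-trans e (E-sym e′) v≢) maximal

    module _ {S : Fin N → Set} (S? : ∀ v → Dec (S v)) where

      avoiding : CliqueColouring N n
      avoiding = record
        { E       = λ c u v → E c u v × ¬ S u × ¬ S v
        ; E?      = λ c u v → E? c u v ×-dec (¬? (S? u) ×-dec ¬? (S? v))
        ; E-sym   = λ { (e , u∉ , v∉) → E-sym e , v∉ , u∉ }
        ; E-irr   = λ { (e , _) → E-irr e }
        ; E-trans = λ { (e , u∉ , v∉) (e′ , _ , w∉) u≢w → E-trans e e′ u≢w , u∉ , w∉ } }

      -- A vertex outside `S` loses its neighbours only if the rest of its clique lies in `S`. It is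
      -- charged to one of these; two such vertices are never in the same clique.
      coverage-avoiding : ∀ c → # (hasNeighbour? c) ≤
        # (CliqueColouring.hasNeighbour? avoiding c) + 2 * # (λ v → hasNeighbour? c v ×-dec S? v)
      coverage-avoiding c = begin
        # (hasNeighbour? c)         ≤⟨ #-⊎ (hasNeighbour? c) kept? lost? split ⟩
        # kept? + # lost?           ≤⟨ +-monoʳ-≤ (# kept?) (#-⊎ lost? taken? alone? (λ v → id)) ⟩
        # kept? + (# taken? + # alone?) ≤⟨ +-monoʳ-≤ (# kept?) (+-monoʳ-≤ (# taken?) (#-matching alone? taken? (E? c) partner inj)) ⟩
        # kept? + (# taken? + # taken?) ≡⟨ cong (λ x → # kept? + (# taken? + x)) (sym (+-identityʳ (# taken?))) ⟩
        # kept? + 2 * # taken?      ∎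
        where
        open ≤-Reasoning
        kept? = CliqueColouring.hasNeighbour? avoiding c
        Taken Alone : Fin N → Set
        Taken v = HasNeighbour c v × S v
        Alone v = HasNeighbour c v × ¬ S v × ¬ CliqueColouring.HasNeighbour avoiding c v
        taken? : ∀ v → Dec (Taken v)
        taken? v = hasNeighbour? c v ×-dec S? v
        alone? : ∀ v → Dec (Alone v)
        alone? v = hasNeighbour? c v ×-dec (¬? (S? v) ×-dec ¬? (kept? v))
        lost? : ∀ v → Dec (Taken v ⊎ Alone v)
        lost? v = taken? v ⊎-dec alone? v
        split : ∀ v → HasNeighbour c v → CliqueColouring.HasNeighbour avoiding c v ⊎ (Taken v ⊎ Alone v)
        split v h with kept? v | S? v
        ... | yes k | _     = inj₁ k
        ... | no _  | yes s = inj₂ (inj₁ (h , s))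
        ... | no ¬k | no ¬s = inj₂ (inj₂ (h , ¬s , ¬k))
        partner : ∀ v → Alone v → ∃ λ w → Taken w × E c v w
        partner v ((w , e) , ¬s , ¬k) with S? w
        ... | yes s = w , ((v , E-sym e) , s) , e
        ... | no ¬s′ = contradiction (w , e , ¬s , ¬s′) ¬k
        inj : ∀ v v′ w → Alone v → Alone v′ → E c v w → E c v′ w → v ≡ v′
        inj v v′ w (_ , ¬s , ¬k) (_ , ¬s′ , _) e e′ with v ≟ v′
        ... | yes r = r
        ... | no v≢ = contradiction (v′ , E-trans e (E-sym e′) v≢ , ¬s , ¬s′) ¬k

      covered-avoiding : ∀ {μ} → IsRainbowMatching avoiding μ → ∀ {v} → Covered μ v → ¬ S v
      covered-avoiding {μ} rm {v} (c , o) with on-ends o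
      ... | w , ends = proj₁ (proj₂ (ends-joined {G = avoiding} rm ends))

      from-avoiding : ∀ {μ} → IsRainbowMatching avoiding μ → IsRainbowMatching G μ
      from-avoiding rm = record { joined = proj₁ ∘ joined ; disjoint = disjoint } where open IsRainbowMatching rm

    empty-isRainbowMatching : IsRainbowMatching G (λ _ → nothing)
    empty-isRainbowMatching = record { joined = λ () ; disjoint = λ () }

    augment-below : ∀ w → 0 < w → (∀ μ → IsRainbowMatching G μ → w ≤ missing μ → Augmented {G = G} μ) →
      ∃ λ μ → IsRainbowMatching G μ × missing μ < w
    augment-below w w>0 step = go _ (λ _ → nothing) empty-isRainbowMatching refl
      where
      go : ∀ f μ → IsRainbowMatching G μ → missing μ ≡ f → ∃ λ μ → IsRainbowMatching G μ × missing μ < w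
      go f μ rm eq with missing μ <? w
      ... | yes lt = μ , rm , lt
      go zero μ rm eq | no ≮w = contradiction (≤-trans w>0 (≤-trans (≮⇒≥ ≮w) (≤-reflexive eq))) λ ()
      go (suc f) μ rm eq | no ≮w with step μ rm (≮⇒≥ ≮w)
      ... | μ′ , rm′ , eq′ = go f μ′ rm′ (ℕ-suc-injective (trans (sym eq′) eq))

    -- Each remaining colour still has an unused edge in the reserved set S.
    complete : ∀ {S : Fin N → Set} (S? : ∀ v → Dec (S v)) b →
      (∀ c → ∃ λ es → Unique (flatten es) × All (λ e → E c (proj₁ e) (proj₂ e)) es ×
        b ≤ #ˡ (λ e → S? (proj₁ e) ×-dec S? (proj₂ e)) es) →
      ∀ f μ → IsRainbowMatching G μ → missing μ ≡ f → # (λ v → S? v ×-dec covered? μ v) + 2 * f ≤ b →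
      ∃ λ μ → IsRainbowMatching G μ × missing μ ≡ 0
    complete S? b reserve zero    μ rm eq le = μ , rm , eq
    complete {S} S? b reserve (suc f) μ rm eq le with any? (missing? μ)
    ... | no full = contradiction (trans (sym (#-none (missing? μ) (λ c e → full (c , e)))) eq) (λ ())
    ... | yes (c , c∅) with reserve c
    ...   | es , uniq , joined , b≤ = insert (find es joined)
      where
      open ≤-Reasoning
      Hit : Fin N → Set
      Hit v = S v × Covered μ v
      hit? : ∀ v → Dec (Hit v)
      hit? v = S? v ×-dec covered? μ v
      Free : Set
      Free = ∃ λ x → ∃ λ y → E c x y × ¬ Covered μ x × ¬ Covered μ y
      in? : ∀ e → Dec (S (proj₁ e) × S (proj₂ e))
      in? e = S? (proj₁ e) ×-dec S? (proj₂ e)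
      -- An edge that cannot be added has a covered end, which is in `S` if the whole edge is. The
      -- edges being disjoint, b of them inside `S` would require b covered vertices of `S`.
      find : ∀ es → All (λ e → E c (proj₁ e) (proj₂ e)) es → Free ⊎ #ˡ in? es ≤ #ˡ hit? (flatten es)
      find [] [] = inj₂ z≤n
      find ((x , y) ∷ es) (e ∷ js) with find es js
      ... | inj₁ r = inj₁ r
      ... | inj₂ le = cases (S? x) (S? y) (covered? μ x) (covered? μ y)
        where
        cases : (sx : Dec (S x)) (sy : Dec (S y)) (cx : Dec (Covered μ x)) (cy : Dec (Covered μ y)) →
          Free ⊎ 𝟙 (sx ×-dec sy) + #ˡ in? es ≤ 𝟙 (sx ×-dec cx) + (𝟙 (sy ×-dec cy) + #ˡ hit? (flatten es))
        cases sx sy (no x∉) (no y∉) = inj₁ (x , y , e , x∉ , y∉)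
        cases sx sy (yes cx) cy = inj₂ (+-mono-≤ (𝟙-mono (sx ×-dec sy) (sx ×-dec yes cx) (λ p → proj₁ p , cx))
          (≤-trans le (m≤n+m _ (𝟙 (sy ×-dec cy)))))
        cases sx sy (no x∉) (yes cy) = inj₂ (≤-trans (+-mono-≤ (𝟙-mono (sx ×-dec sy) (sy ×-dec yes cy) (λ p → proj₂ p , cy)) le)
          (m≤n+m _ (𝟙 (sx ×-dec no x∉))))
      insert : Free ⊎ #ˡ in? es ≤ #ˡ hit? (flatten es) → ∃ λ μ → IsRainbowMatching G μ × missing μ ≡ 0
      insert (inj₂ few) = contradiction le (<⇒≱ (begin-strict
        b                        ≤⟨ b≤ ⟩
        #ˡ in? es                ≤⟨ few ⟩
        #ˡ hit? (flatten es)     ≤⟨ #ˡ-unique hit? uniq ⟩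
        # hit?                   <⟨ m<m+n (# hit?) (s≤s z≤n) ⟩
        # hit? + 2 * suc f       ∎))
      insert (inj₁ (x , y , e , x∉ , y∉)) = complete S? b reserve f μ′ (fill-isRainbowMatching rm e x∉ y∉)
        (ℕ-suc-injective (trans (sym (missing-fill {μ = μ} c∅)) eq))
        (begin
          # (λ v → S? v ×-dec covered? μ′ v) + 2 * f ≤⟨ +-monoˡ-≤ (2 * f) (#-⊎ (λ v → S? v ×-dec covered? μ′ v) hit? new? grow) ⟩
          # hit? + # new? + 2 * f                    ≤⟨ +-monoˡ-≤ (2 * f) (+-monoʳ-≤ (# hit?) (#-∈ (x ∷ y ∷ []))) ⟩
          # hit? + 2 + 2 * f                         ≡⟨ +-assoc (# hit?) 2 (2 * f) ⟩
          # hit? + (2 + 2 * f)                       ≡⟨ cong (# hit? +_) (sym (*-suc 2 f)) ⟩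
          # hit? + 2 * suc f                         ≤⟨ le ⟩
          b                                          ∎)
        where
        μ′ = μ [ c := just (x , y) ]
        new? : ∀ v → Dec (v ∈ x ∷ y ∷ [])
        new? v = v ∈? (x ∷ y ∷ [])
        grow : ∀ v → S v × Covered μ′ v → Hit v ⊎ v ∈ x ∷ y ∷ []
        grow v (s , cov) with covered-fill {μ = μ} {c} cov
        ... | inj₁ p = inj₁ (s , p)
        ... | inj₂ (inj₁ e) = inj₂ (here e)
        ... | inj₂ (inj₂ e) = inj₂ (there (here e))

  -- The coverage and multiplicity bounds are measured in units of s, while w
  -- (the number of colours left to the reserved set), Γ and Λ are successively smaller
  -- multiples of n.
  record Parameters (n s : ℕ) : Set where
    field
      Λ Γ H K L w p b : ℕ
      n<ΛH    : n < suc H * Λ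
      Λ-large : K + K * (L * H) < Λ
      Γ-large : K + K * (L * H) + K * Λ < Γ
      K-large : 3 * L + 5 ≤ K
      s>13    : 13 < s
      s≤n     : s ≤ n
      w>0     : 0 < w
      n<Ls    : n < L * suc s
      Γ-small : 2 * n * Γ ≤ w * s
      b-large : 6 * n ≤ b * s
      w-small : 2 * w ≤ n / 2
      tail₁   : ∀ t → 2 * n ≤ t → 2 * n * suc (suc p) ^ t < 2 ^ (t / suc (suc b)) * suc p ^ t
      tail₂   : 2 * n * Sampling.W p ^ (n / 2) < 2 ^ (n / 2 ∸ 2 * w) * (suc p * suc p) ^ (n / 2)

  -- A full rainbow matching from suitable parameters.

  module _ {N n s q : ℕ} (par : Parameters n s) (G : CliqueColouring N n)
    (coverage : ∀ c → 3 * n ≤ # (CliqueColouring.hasNeighbour? G c) + s)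
    (multiplicity : ∀ x y → # (λ c → CliqueColouring.E? G c x y) ≤ q)
    (q-small : q + 15 * s ≤ n) where
    open CliqueColouring G
    open Parameters par
    open Sampling p

    private
      n>0 : 0 < n
      n>0 = ≤-trans (≤-trans (s≤s z≤n) s>13) s≤n

      2n≤coverage : ∀ c → 2 * n ≤ # (hasNeighbour? c)
      2n≤coverage c = +-cancelʳ-≤ s _ _ (≤-trans (+-monoʳ-≤ (2 * n) s≤n) (≤-trans (≤-reflexive (+-comm (2 * n) n)) (coverage c)))

      abstract
        reserve : ∀ c → ∃ λ es → length es ≡ n / 2 × Unique (flatten es) × All (λ e → E c (proj₁ e) (proj₂ e)) es
        reserve c = disjoint-edges G c (n / 2) (≤-trans (≤-trans (≤-reflexive (arith (n / 2))) (*-monoʳ-≤ 2 (m/n*n≤m n 2))) (2n≤coverage c))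
          where
          arith : ∀ h → 4 * h ≡ 2 * (h * 2)
          arith = solve-∀

      edges : Fin n → List (Fin N × Fin N)
      edges c = proj₁ (reserve c)

      length-edges : ∀ c → length (edges c) ≡ n / 2
      length-edges c = proj₁ (proj₂ (reserve c))

      abstract
        sample : ∃ λ χ → ∀ c →
          suc (suc b) * # (λ v → hasNeighbour? c v ×-dec inSample? χ v) ≤ # (hasNeighbour? c) × 2 * w ≤ #within (edges c) χ
        sample = good-sample n>0 hasNeighbour? edges (suc b) (2 * w) (λ c → proj₁ (proj₂ (proj₂ (reserve c))))
          (λ c → ≤-trans w-small (≤-reflexive (sym (length-edges c))))
          (λ c → tail₁ (# (hasNeighbour? c)) (2n≤coverage c))
          (λ c → subst (λ l → 2 * n * W ^ l < 2 ^ (l ∸ 2 * w) * (P * P) ^ l) (sym (length-edges c)) tail₂)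

      module WithSample (χ : Choice N)
        (small : ∀ c → suc (suc b) * # (λ v → hasNeighbour? c v ×-dec inSample? χ v) ≤ # (hasNeighbour? c))
        (large : ∀ c → 2 * w ≤ #within (edges c) χ) where

        G′ : CliqueColouring N n
        G′ = avoiding G (inSample? χ)

        -- With t the old coverage, `kept` gives t′ ≥ bt / (b + 2). As t ≥ 3n - s, the further loss
        -- is at most 6n / (b + 2), and `b-large` makes that at most a second `s`.
        coverage′ : ∀ c → 3 * n ≤ # (CliqueColouring.hasNeighbour? G′ c) + 2 * s
        coverage′ c = *-cancelˡ-≤ (suc (suc b)) (begin
          (2 + b) * (3 * n)                      ≡⟨ arith₁ b n ⟩
          b * (3 * n) + 6 * n                    ≤⟨ +-mono-≤ (*-monoʳ-≤ b (coverage c)) b-large ⟩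
          b * (t + s) + b * s                    ≡⟨ arith₂ b t s ⟩
          b * t + 2 * (b * s)                    ≤⟨ +-monoˡ-≤ (2 * (b * s)) kept ⟩
          (2 + b) * t′ + 2 * (b * s)             ≤⟨ +-monoʳ-≤ ((2 + b) * t′) (m≤n+m (2 * (b * s)) (4 * s)) ⟩
          (2 + b) * t′ + (4 * s + 2 * (b * s))   ≡⟨ arith₃ b t′ s ⟩
          (2 + b) * (t′ + 2 * s)                 ∎)
          where
          open ≤-Reasoning
          t t′ x : ℕ
          t = # (hasNeighbour? c)
          t′ = # (CliqueColouring.hasNeighbour? G′ c)
          x = # (λ v → hasNeighbour? c v ×-dec inSample? χ v)
          arith₁ : ∀ b n → (2 + b) * (3 * n) ≡ b * (3 * n) + 6 * n
          arith₁ = solve-∀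
          arith₂ : ∀ b t s → b * (t + s) + b * s ≡ b * t + 2 * (b * s)
          arith₂ = solve-∀
          arith₃ : ∀ b t s → (2 + b) * t + (4 * s + 2 * (b * s)) ≡ (2 + b) * (t + 2 * s)
          arith₃ = solve-∀
          arith₄ : ∀ b t → b * t + 2 * t ≡ (2 + b) * t
          arith₄ = solve-∀
          arith₅ : ∀ b t x → (2 + b) * (t + 2 * x) ≡ (2 + b) * t + 2 * ((2 + b) * x)
          arith₅ = solve-∀
          kept : b * t ≤ (2 + b) * t′
          kept = +-cancelʳ-≤ (2 * t) _ _ (begin
            b * t + 2 * t                        ≡⟨ arith₄ b t ⟩
            (2 + b) * t                          ≤⟨ *-monoʳ-≤ (2 + b) (coverage-avoiding G (inSample? χ) c) ⟩
            (2 + b) * (t′ + 2 * x)               ≡⟨ arith₅ b t′ x ⟩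
            (2 + b) * t′ + 2 * ((2 + b) * x)     ≤⟨ +-monoʳ-≤ ((2 + b) * t′) (*-monoʳ-≤ 2 (small c)) ⟩
            (2 + b) * t′ + 2 * t                 ∎)

        step : ∀ μ → IsRainbowMatching G′ μ → w ≤ missing μ → Augmented {G = G′} μ
        step μ rm w≤ = Step.augmented G′ μ rm Λ Γ H K L n<ΛH Λ-large Γ-large K-large s w q s>13 w>0 n<Ls Γ-small w≤
          coverage′ (λ x y → ≤-trans (#-mono (λ c → CliqueColouring.E? G′ c x y) (λ c → E? c x y) (λ c → proj₁)) (multiplicity x y)) q-small

        reserved : ∀ c → ∃ λ es → Unique (flatten es) × All (λ e → E c (proj₁ e) (proj₂ e)) es ×
          2 * w ≤ #ˡ (λ e → inSample? χ (proj₁ e) ×-dec inSample? χ (proj₂ e)) es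
        reserved c = edges c , proj₁ (proj₂ (proj₂ (reserve c))) , proj₂ (proj₂ (proj₂ (reserve c))) , large c

        start : ∀ μ → IsRainbowMatching G′ μ → missing μ < w →
          # (λ v → inSample? χ v ×-dec covered? μ v) + 2 * missing μ ≤ 2 * w
        start μ rm few = +-mono-≤
          (≤-reflexive (#-none (λ v → inSample? χ v ×-dec covered? μ v) λ { v (s , cov) → covered-avoiding G (inSample? χ) rm cov s }))
          (*-monoʳ-≤ 2 (<⇒≤ few))

        finish : ∀ μ → IsRainbowMatching G′ μ → missing μ < w → ∃ λ μ → IsRainbowMatching G μ × missing μ ≡ 0
        finish μ rm few = complete G {InSample χ} (inSample? χ) (2 * w) reserved (missing μ) μ
          (from-avoiding G (inSample? χ) rm) refl (start μ rm few)

        result : ∃ λ μ → IsRainbowMatching G μ × missing μ ≡ 0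
        result = let μ , rm , few = augment-below G′ w w>0 step in finish μ rm few

    full-rainbow-matching : ∃ λ μ → IsRainbowMatching G μ × missing μ ≡ 0
    full-rainbow-matching = WithSample.result (proj₁ sample) (proj₁ ∘ proj₂ sample) (proj₂ ∘ proj₂ sample)

  -- Estimates for powers, and the choice of the constants.

  suc≤2^ : ∀ n → suc n ≤ 2 ^ n
  suc≤2^ zero    = ≤-refl
  suc≤2^ (suc n) = ≤-trans (+-mono-≤ {1} {2 ^ n} (≤-trans (s≤s z≤n) (suc≤2^ n)) (suc≤2^ n))
    (≤-reflexive (cong (2 ^ n +_) (sym (+-identityʳ (2 ^ n)))))

  -- At i = 3D the left side is at most (D + 1)³, hence at most the cube of 2 ^ D; afterwards the
  -- right side doubles at each step and the left side at most doubles.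
  linear≤2^ : ∀ D i → 3 * D ≤ i → D * suc i ≤ 2 ^ i
  linear≤2^ D i le with ≤⇒≤′ le
  ... | ≤′-refl = begin
    D * suc (3 * D)               ≤⟨ m+n≤o⇒m≤o (D * suc (3 * D)) (≤-reflexive (arith D)) ⟩
    suc D * (suc D * suc D)       ≤⟨ *-mono-≤ (suc≤2^ D) (*-mono-≤ (suc≤2^ D) (suc≤2^ D)) ⟩
    2 ^ D * (2 ^ D * 2 ^ D)       ≡⟨ cong (2 ^ D *_) (sym (^-distribˡ-+-* 2 D D)) ⟩
    2 ^ D * 2 ^ (D + D)           ≡⟨ sym (^-distribˡ-+-* 2 D (D + D)) ⟩
    2 ^ (D + (D + D))             ≡⟨ cong (λ x → 2 ^ (D + (D + x))) (sym (+-identityʳ D)) ⟩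
    2 ^ (3 * D)                   ∎
    where
    open ≤-Reasoning
    arith : ∀ D → D * suc (3 * D) + (D * (D * D) + 2 * D + 1) ≡ suc D * (suc D * suc D)
    arith = solve-∀
  linear≤2^ D (suc i) le | ≤′-step le′ = begin
    D * suc (suc i)               ≤⟨ m+n≤o⇒m≤o (D * suc (suc i)) (≤-reflexive (arith D i)) ⟩
    2 * (D * suc i)               ≤⟨ *-monoʳ-≤ 2 (linear≤2^ D i (≤′⇒≤ le′)) ⟩
    2 * 2 ^ i                     ∎
    where
    open ≤-Reasoning
    arith : ∀ D i → D * suc (suc i) + D * i ≡ 2 * (D * suc i)
    arith = solve-∀

  m<suc[m/n]*n : ∀ m n .⦃ _ : NonZero n ⦄ → m < suc (m / n) * n
  m<suc[m/n]*n m n = begin-strict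
    m                     ≡⟨ m≡m%n+[m/n]*n m n ⟩
    m % n + m / n * n     <⟨ +-monoˡ-< (m / n * n) (m%n<n m n) ⟩
    suc (m / n) * n       ∎
    where open ≤-Reasoning

  ≤-quotient : ∀ {m k} n .⦃ _ : NonZero n ⦄ → k * n ≤ m → k ≤ m / n
  ≤-quotient {m} {k} n le = ≤-trans (≤-reflexive (sym (m*n/n≡m k n))) (/-monoˡ-≤ n le)

  4n<2^[n/C] : ∀ C .⦃ _ : NonZero C ⦄ n → 3 * (4 * C) * C ≤ n → 4 * n < 2 ^ (n / C)
  4n<2^[n/C] C n le = begin-strict
    4 * n                       <⟨ *-monoʳ-< 4 (m<suc[m/n]*n n C) ⟩
    4 * (suc (n / C) * C)       ≡⟨ trans (cong (4 *_) (*-comm (suc (n / C)) C)) (sym (*-assoc 4 C (suc (n / C)))) ⟩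
    4 * C * suc (n / C)         ≤⟨ linear≤2^ (4 * C) (n / C) (≤-quotient C le) ⟩
    2 ^ (n / C)                 ∎
    where open ≤-Reasoning

  -- (1 + 1/P)ᵏ ≤ 1 / (1 - k/P), cleared of denominators.
  bernoulli-upper : ∀ k e → suc (k + e) ^ k * e ≤ (k + e) ^ k * (k + e)
  bernoulli-upper zero    e = ≤-refl
  -- The induction moves a unit from `k` to `e`, so that the base P = k + e stays fixed.
  bernoulli-upper (suc k) e = begin
    suc P * suc P ^ k * e               ≡⟨ arith₁ (suc P) (suc P ^ k) e ⟩
    suc P ^ k * (suc P * e)             ≤⟨ *-monoʳ-≤ (suc P ^ k) (m+n≤o⇒m≤o (suc P * e) (≤-reflexive (arith₂ k e))) ⟩
    suc P ^ k * (P * suc e)             ≡⟨ arith₃ (suc P ^ k) P (suc e) ⟩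
    P * (suc P ^ k * suc e)             ≡⟨ cong (λ x → P * (suc x ^ k * suc e)) (sym (+-suc k e)) ⟩
    P * (suc (k + suc e) ^ k * suc e)   ≤⟨ *-monoʳ-≤ P (bernoulli-upper k (suc e)) ⟩
    P * ((k + suc e) ^ k * (k + suc e)) ≡⟨ cong (λ x → P * (x ^ k * x)) (+-suc k e) ⟩
    P * (P ^ k * P)                     ≡⟨ sym (*-assoc P (P ^ k) P) ⟩
    P * P ^ k * P                       ∎
    where
    open ≤-Reasoning
    P = suc k + e
    arith₁ : ∀ p x e → p * x * e ≡ x * (p * e)
    arith₁ = solve-∀
    arith₂ : ∀ k e → suc (suc k + e) * e + suc k ≡ (suc k + e) * suc e
    arith₂ = solve-∀
    arith₃ : ∀ x p e → x * (p * e) ≡ p * (x * e)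
    arith₃ = solve-∀

  power-upper : ∀ k P → 2 * k ≤ P → suc P ^ k ≤ 2 * P ^ k
  power-upper zero    zero    le = s≤s z≤n
  power-upper (suc k) zero    ()
  power-upper k P@(suc _) le = *-cancelʳ-≤ _ _ P (begin
    suc P ^ k * P             ≤⟨ *-monoʳ-≤ (suc P ^ k) P≤2e ⟩
    suc P ^ k * (2 * e)       ≡⟨ arith (suc P ^ k) e ⟩
    2 * (suc P ^ k * e)       ≤⟨ *-monoʳ-≤ 2 (subst (λ x → suc x ^ k * e ≤ x ^ k * x) k+e≡P (bernoulli-upper k e)) ⟩
    2 * (P ^ k * P)           ≡⟨ sym (*-assoc 2 (P ^ k) P) ⟩
    2 * P ^ k * P             ∎)
    where
    open ≤-Reasoning
    e = P ∸ k
    k≤P : k ≤ P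
    k≤P = ≤-trans (m≤m+n k _) le
    k+e≡P : k + e ≡ P
    k+e≡P = m+[n∸m]≡n k≤P
    k≤e : k ≤ e
    k≤e = ≤-trans (≤-reflexive (sym (trans (cong (_∸ k) (cong (k +_) (+-identityʳ k))) (m+n∸m≡n k k)))) (∸-monoˡ-≤ k le)
    P≤2e : P ≤ 2 * e
    P≤2e = ≤-trans (≤-reflexive (sym k+e≡P)) (≤-trans (+-monoˡ-≤ e k≤e) (≤-reflexive (cong (e +_) (sym (+-identityʳ e)))))
    arith : ∀ x e → x * (2 * e) ≡ 2 * (x * e)
    arith = solve-∀

  -- Each of the t / β blocks of length β costs a factor 2; the additional 2 pays for the remainder.
  power-upper-blocks : ∀ β .⦃ _ : NonZero β ⦄ P t → 2 * β ≤ P → suc P ^ t ≤ 2 ^ suc (t / β) * P ^ t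
  power-upper-blocks β P t le = begin
    suc P ^ t                                     ≡⟨ cong (suc P ^_) (m≡m%n+[m/n]*n t β) ⟩
    suc P ^ (ρ + i * β)                           ≡⟨ ^-distribˡ-+-* (suc P) ρ (i * β) ⟩
    suc P ^ ρ * suc P ^ (i * β)                   ≤⟨ *-mono-≤ (power-upper ρ P (≤-trans (*-monoʳ-≤ 2 (<⇒≤ (m%n<n t β))) le)) (blocks i) ⟩
    2 * P ^ ρ * (2 ^ i * P ^ (i * β))             ≡⟨ [m*n]*[o*p]≡[m*o]*[n*p] 2 (P ^ ρ) (2 ^ i) _ ⟩
    2 ^ suc i * (P ^ ρ * P ^ (i * β))             ≡⟨ cong (2 ^ suc i *_) (sym (^-distribˡ-+-* P ρ (i * β))) ⟩
    2 ^ suc i * P ^ (ρ + i * β)                   ≡⟨ cong (λ x → 2 ^ suc i * P ^ x) (sym (m≡m%n+[m/n]*n t β)) ⟩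
    2 ^ suc i * P ^ t                             ∎
    where
    open ≤-Reasoning
    i = t / β
    ρ = t % β
    blocks : ∀ i → suc P ^ (i * β) ≤ 2 ^ i * P ^ (i * β)
    blocks zero    = ≤-refl
    blocks (suc i) = begin
      suc P ^ (β + i * β)                    ≡⟨ ^-distribˡ-+-* (suc P) β (i * β) ⟩
      suc P ^ β * suc P ^ (i * β)            ≤⟨ *-mono-≤ (power-upper β P le) (blocks i) ⟩
      2 * P ^ β * (2 ^ i * P ^ (i * β))      ≡⟨ [m*n]*[o*p]≡[m*o]*[n*p] 2 (P ^ β) (2 ^ i) _ ⟩
      2 ^ suc i * (P ^ β * P ^ (i * β))      ≡⟨ cong (2 ^ suc i *_) (sym (^-distribˡ-+-* P β (i * β))) ⟩
      2 ^ suc i * P ^ (β + i * β)            ∎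

  -- Bernoulli's inequality for 1 + 1/W, multiplied by `W ^ suc m`.
  bernoulli-lower : ∀ W m → W ^ suc m + suc m * W ^ m ≤ suc W ^ suc m
  bernoulli-lower W zero    = ≤-reflexive (arith W)
    where
    arith : ∀ W → W * 1 + 1 ≡ suc W * 1
    arith = solve-∀
  bernoulli-lower W (suc m) = begin
    W * (W * W ^ m) + suc (suc m) * (W * W ^ m)            ≤⟨ m≤m+n _ (suc m * W ^ m) ⟩
    W * (W * W ^ m) + suc (suc m) * (W * W ^ m) + suc m * W ^ m ≡⟨ arith W m (W ^ m) ⟩
    suc W * (W * W ^ m + suc m * W ^ m)                    ≤⟨ *-monoʳ-≤ (suc W) (bernoulli-lower W m) ⟩
    suc W * suc W ^ suc m                                  ∎
    where
    open ≤-Reasoning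
    arith : ∀ W m x → W * (W * x) + suc (suc m) * (W * x) + suc m * x ≡ suc W * (W * x + suc m * x)
    arith = solve-∀

  doubling : ∀ W → 2 * W ^ suc W ≤ suc W ^ suc W
  doubling W = ≤-trans (≤-trans (≤-reflexive (cong (W ^ suc W +_) (+-identityʳ (W * W ^ W)))) (+-monoʳ-≤ (W ^ suc W) (m≤n+m (W * W ^ W) (W ^ W)))) (bernoulli-lower W W)

  -- By `doubling` each block of length W + 1 gains a factor 2; on the remainder, replacing W by W +
  -- 1 loses nothing.
  power-lower-blocks : ∀ W h → 2 ^ (h / suc W) * W ^ h ≤ suc W ^ h
  power-lower-blocks W h = begin
    2 ^ i * W ^ h                          ≡⟨ cong (λ x → 2 ^ i * W ^ x) (m≡m%n+[m/n]*n h (suc W)) ⟩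
    2 ^ i * W ^ (ρ + i * suc W)            ≡⟨ cong (2 ^ i *_) (^-distribˡ-+-* W ρ (i * suc W)) ⟩
    2 ^ i * (W ^ ρ * W ^ (i * suc W))      ≡⟨ arith (2 ^ i) (W ^ ρ) _ ⟩
    W ^ ρ * (2 ^ i * W ^ (i * suc W))      ≤⟨ *-mono-≤ (^-monoˡ-≤ ρ (n≤1+n W)) (blocks i) ⟩
    suc W ^ ρ * suc W ^ (i * suc W)        ≡⟨ sym (^-distribˡ-+-* (suc W) ρ (i * suc W)) ⟩
    suc W ^ (ρ + i * suc W)                ≡⟨ cong (suc W ^_) (sym (m≡m%n+[m/n]*n h (suc W))) ⟩
    suc W ^ h                              ∎
    where
    open ≤-Reasoning
    i = h / suc W
    ρ = h % suc W
    arith : ∀ a b c → a * (b * c) ≡ b * (a * c)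
    arith = solve-∀
    blocks : ∀ i → 2 ^ i * W ^ (i * suc W) ≤ suc W ^ (i * suc W)
    blocks zero    = ≤-refl
    blocks (suc i) = begin
      2 * 2 ^ i * W ^ (suc W + i * suc W)              ≡⟨ cong (2 * 2 ^ i *_) (^-distribˡ-+-* W (suc W) (i * suc W)) ⟩
      2 * 2 ^ i * (W ^ suc W * W ^ (i * suc W))        ≡⟨ [m*n]*[o*p]≡[m*o]*[n*p] 2 (2 ^ i) (W ^ suc W) _ ⟩
      2 * W ^ suc W * (2 ^ i * W ^ (i * suc W))        ≤⟨ *-mono-≤ (doubling W) (blocks i) ⟩
      suc W ^ suc W * suc W ^ (i * suc W)              ≡⟨ sym (^-distribˡ-+-* (suc W) (suc W) (i * suc W)) ⟩
      suc W ^ (suc W + i * suc W)                      ∎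

  ^-distribʳ-* : ∀ h x y → (x * y) ^ h ≡ x ^ h * y ^ h
  ^-distribʳ-* zero    x y = refl
  ^-distribʳ-* (suc h) x y = trans (cong (x * y *_) (^-distribʳ-* h x y)) ([m*n]*[o*p]≡[m*o]*[n*p] x y (x ^ h) (y ^ h))

  -- Everything that grows with n is a fixed multiple of the threshold ℓ = n / C for heavy pairs.
  module Constants (A′ : ℕ) where
    -- From n ≤ (A + 1)s the value of `b` gives 6n ≤ bs, and `L` rounds suffice for the pigeonhole.
    -- `β` is 2B so that half of the exponent t / B pays for the growth of (1 + 1/P) ^ t and half
    -- for the factor 4n; P = 2β is what `power-upper-blocks` asks for. `c` and `C′` are the ratios
    -- of w and s to ℓ, and the factor 8Q ensures 4Qw ≤ n / 2. `H` is 2C because n < (ℓ + 1)C ≤ 2Cℓ.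
    -- `X` collects the demands on ℓ: more than K + KLH for Λ, more than 13 for s, and at least A
    -- for the rounding in n ≤ (A + 1)s. The summands of `threshold` yield X ≤ ℓ, 4n < 2 ^ ℓ and 4n
    -- < 2 ^ (n / β) respectively.
    A b B β p P W Q L K c C′ C H X threshold : ℕ
    A  = suc A′
    b  = 6 * suc A
    B  = suc (suc b)
    β  = 2 * B
    p  = 4 * b + 7
    P  = suc p
    W  = Sampling.W p
    Q  = suc W
    L  = suc A
    K  = 3 * L + 5
    c  = 2 * suc A * (K + 2)
    C′ = 8 * Q * c
    C  = A * C′
    H  = 2 * C
    X  = suc (K + K * (L * H)) + 14 + A
    threshold = X * C + 3 * (4 * C) * C + 3 * (4 * β) * β

    instance
      C≢0 : NonZero C
      C≢0 = m*n≢0 A C′ ⦃ >-nonZero (s≤s z≤n) ⦄ ⦃ m*n≢0 (8 * Q) c ⦄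

    module _ (n : ℕ) (large : threshold ≤ n) where
      ℓ Γ w s h : ℕ
      ℓ = n / C
      Γ = (K + 2) * ℓ
      w = 2 * suc A * Γ
      s = C′ * ℓ
      h = n / 2

      private
        X≤ℓ : X ≤ ℓ
        X≤ℓ = ≤-quotient C (≤-trans (≤-trans (m≤m+n (X * C) _) (m≤m+n _ _)) large)

        4n<2^ℓ : 4 * n < 2 ^ ℓ
        4n<2^ℓ = 4n<2^[n/C] C n (≤-trans (≤-trans (m≤n+m _ (X * C)) (m≤m+n _ _)) large)

        4n<2^[n/β] : 4 * n < 2 ^ (n / β)
        4n<2^[n/β] = 4n<2^[n/C] β n (≤-trans (m≤n+m _ (X * C + 3 * (4 * C) * C)) large)

        ℓ>0 : 0 < ℓ
        ℓ>0 = ≤-trans (s≤s z≤n) X≤ℓ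

        A≤ℓ : A ≤ ℓ
        A≤ℓ = ≤-trans (m≤n+m A (suc (K + K * (L * H)) + 14)) X≤ℓ

        ℓ≤s : ℓ ≤ s
        ℓ≤s = ≤-trans (≤-reflexive (sym (*-identityˡ ℓ))) (*-monoˡ-≤ ℓ {1} {C′} (>-nonZero⁻¹ C′ ⦃ m*n≢0 (8 * Q) c ⦄))

        8Qw≡s : 8 * Q * w ≡ s
        8Qw≡s = arith (8 * Q) (2 * suc A) (K + 2) ℓ
          where
          arith : ∀ q a k l → q * (a * (k * l)) ≡ q * (a * k) * l
          arith = solve-∀

      A*s≤n : A * s ≤ n
      A*s≤n = ≤-trans (≤-reflexive (trans (sym (*-assoc A C′ ℓ)) (*-comm C ℓ))) (m/n*n≤m n C)

      n≤[1+A]*s : n ≤ suc A * s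
      n≤[1+A]*s = begin
        n                     ≤⟨ <⇒≤ (m<suc[m/n]*n n C) ⟩
        suc ℓ * (A * C′)      ≡⟨ arith ℓ A C′ ⟩
        C′ * A + A * (C′ * ℓ) ≤⟨ +-monoˡ-≤ _ (*-monoʳ-≤ C′ A≤ℓ) ⟩
        suc A * s             ∎
        where
        open ≤-Reasoning
        arith : ∀ l a c → suc l * (a * c) ≡ c * a + a * (c * l)
        arith = solve-∀

      s≤n : s ≤ n
      s≤n = ≤-trans (m≤m+n s (A′ * s)) A*s≤n

      parameters : Parameters n s
      parameters = record
        { Λ = ℓ ; Γ = Γ ; H = H ; K = K ; L = L ; w = w ; p = p ; b = b
        ; n<ΛH = n<ΛH
        ; Λ-large = Λ-large
        ; Γ-large = ≤-trans (+-monoˡ-< (K * ℓ) Λ-large) (≤-trans (m≤n+m _ ℓ) (≤-reflexive (arith₀ K ℓ)))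
        ; K-large = ≤-refl
        ; s>13 = ≤-trans (≤-trans (m≤n+m 14 (suc (K + K * (L * H)))) (≤-trans (m≤m+n _ A) X≤ℓ)) ℓ≤s
        ; s≤n = s≤n
        ; w>0 = w>0
        ; n<Ls = ≤-<-trans n≤[1+A]*s (*-monoʳ-< (suc A) (n<1+n s))
        ; Γ-small = ≤-trans (≤-reflexive (*-assoc 2 n Γ)) (≤-trans (*-monoʳ-≤ 2 (*-monoˡ-≤ Γ n≤[1+A]*s)) (≤-reflexive (arith₁ (suc A) s Γ)))
        ; b-large = ≤-trans (*-monoʳ-≤ 6 n≤[1+A]*s) (≤-reflexive (sym (*-assoc 6 (suc A) s)))
        ; w-small = ≤-trans (*-monoˡ-≤ w (≤-trans (s≤s (s≤s z≤n)) (m≤m*n 4 Q))) 4Qw≤h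
        ; tail₁ = tail₁
        ; tail₂ = tail₂ }
        where
        open ≤-Reasoning
        arith₀ : ∀ K l → l + (l + K * l) ≡ (K + 2) * l
        arith₀ = solve-∀
        arith₁ : ∀ a s g → 2 * (a * s * g) ≡ 2 * a * g * s
        arith₁ = solve-∀
        n<ΛH : n < suc H * ℓ
        n<ΛH = begin-strict
          n                 <⟨ m<suc[m/n]*n n C ⟩
          C + ℓ * C         ≤⟨ +-monoˡ-≤ (ℓ * C) (≤-trans (≤-reflexive (sym (*-identityˡ C))) (*-monoˡ-≤ C ℓ>0)) ⟩
          ℓ * C + ℓ * C     ≤⟨ m≤n+m _ ℓ ⟩
          ℓ + (ℓ * C + ℓ * C) ≡⟨ arith ℓ C ⟩
          suc H * ℓ         ∎
          where
          arith : ∀ l c → l + (l * c + l * c) ≡ suc (2 * c) * l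
          arith = solve-∀
        Λ-large : K + K * (L * H) < ℓ
        Λ-large = ≤-trans (≤-trans (m≤m+n _ 14) (m≤m+n _ A)) X≤ℓ
        ℓ≤w : ℓ ≤ w
        ℓ≤w = ≤-trans (≤-trans (≤-reflexive (sym (*-identityˡ ℓ))) (*-monoˡ-≤ ℓ (≤-trans (s≤s z≤n) (m≤n+m 2 K))))
          (≤-trans (≤-reflexive (sym (*-identityˡ Γ))) (*-monoˡ-≤ Γ {1} {2 * suc A} (s≤s z≤n)))
        w>0 : 0 < w
        w>0 = ≤-trans ℓ>0 ℓ≤w
        4Qw≤h : 4 * Q * w ≤ h
        4Qw≤h = ≤-quotient 2 (≤-trans (≤-reflexive (trans (arith Q w) 8Qw≡s)) s≤n)
          where
          arith : ∀ Q w → 4 * Q * w * 2 ≡ 8 * Q * w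
          arith = solve-∀
        tail₁ : ∀ t → 2 * n ≤ t → 2 * n * suc P ^ t < 2 ^ (t / B) * P ^ t
        tail₁ t 2n≤t = begin-strict
          2 * n * suc P ^ t               ≤⟨ *-monoʳ-≤ (2 * n) (power-upper-blocks β P t (≤-trans (m≤m+n _ 0) (≤-reflexive (arith b)))) ⟩
          2 * n * (2 * 2 ^ i * P ^ t)     ≡⟨ arith′ n (2 ^ i) (P ^ t) ⟩
          4 * n * 2 ^ i * P ^ t           <⟨ *-monoˡ-< (P ^ t) ⦃ m^n≢0 P t ⦄ (*-monoˡ-< (2 ^ i) ⦃ m^n≢0 2 i ⦄ 4n<2^i) ⟩
          2 ^ i * 2 ^ i * P ^ t           ≡⟨ cong (_* P ^ t) (sym (^-distribˡ-+-* 2 i i)) ⟩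
          2 ^ (i + i) * P ^ t             ≤⟨ *-monoˡ-≤ (P ^ t) (^-monoʳ-≤ 2 2i≤) ⟩
          2 ^ (t / B) * P ^ t             ∎
          where
          i = t / β
          arith : ∀ b → 2 * (2 * suc (suc b)) + 0 ≡ suc (4 * b + 7)
          arith = solve-∀
          arith′ : ∀ n x y → 2 * n * (2 * x * y) ≡ 4 * n * x * y
          arith′ = solve-∀
          arith″ : ∀ i B → (i + i) * B ≡ i * (2 * B)
          arith″ = solve-∀
          4n<2^i : 4 * n < 2 ^ i
          4n<2^i = <-≤-trans 4n<2^[n/β] (^-monoʳ-≤ 2 (/-monoˡ-≤ β (≤-trans (m≤m+n n _) 2n≤t)))
          2i≤ : i + i ≤ t / B
          2i≤ = ≤-quotient B (≤-trans (≤-reflexive (arith″ i B)) (m/n*n≤m t β))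
        -- Since W is Q - 1 with Q = 2P², the quotient of 2 ^ h * (P * P) ^ h by W ^ h is at least 2
        -- ^ (h / Q), and h / Q ≥ 4w. One factor 2 ^ (2w) exceeds 2n, the other makes up for the
        -- reduced exponent h ∸ 2w.
        tail₂ : 2 * n * W ^ h < 2 ^ (h ∸ 2 * w) * (P * P) ^ h
        tail₂ = *-cancelʳ-< (2 ^ (2 * w)) _ _ (begin-strict
          2 * n * W ^ h * 2 ^ (2 * w)               ≡⟨ arith (2 * n) (W ^ h) (2 ^ (2 * w)) ⟩
          2 * n * 2 ^ (2 * w) * W ^ h               <⟨ *-monoˡ-< (W ^ h) ⦃ m^n≢0 W h ⦄ (*-monoˡ-< (2 ^ (2 * w)) ⦃ m^n≢0 2 (2 * w) ⦄ 2n<) ⟩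
          2 ^ (2 * w) * 2 ^ (2 * w) * W ^ h         ≡⟨ cong (_* W ^ h) (sym (^-distribˡ-+-* 2 (2 * w) (2 * w))) ⟩
          2 ^ (2 * w + 2 * w) * W ^ h               ≤⟨ *-monoˡ-≤ (W ^ h) {2 ^ (2 * w + 2 * w)} {2 ^ (h / Q)} (^-monoʳ-≤ 2 {2 * w + 2 * w} {h / Q} (≤-quotient Q (≤-trans (≤-reflexive (arith₂ Q w)) 4Qw≤h))) ⟩
          2 ^ (h / Q) * W ^ h                       ≤⟨ power-lower-blocks W h ⟩
          Q ^ h                                     ≡⟨ cong (_^ h) (Sampling.W-value p) ⟩
          (2 * (P * P)) ^ h                         ≡⟨ ^-distribʳ-* h 2 (P * P) ⟩
          2 ^ h * (P * P) ^ h                       ≡⟨ cong (λ x → 2 ^ x * (P * P) ^ h) (sym (m∸n+n≡m 2w≤h)) ⟩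
          2 ^ (h ∸ 2 * w + 2 * w) * (P * P) ^ h     ≡⟨ cong (_* (P * P) ^ h) (^-distribˡ-+-* 2 (h ∸ 2 * w) (2 * w)) ⟩
          2 ^ (h ∸ 2 * w) * 2 ^ (2 * w) * (P * P) ^ h ≡⟨ arith (2 ^ (h ∸ 2 * w)) (2 ^ (2 * w)) _ ⟩
          2 ^ (h ∸ 2 * w) * (P * P) ^ h * 2 ^ (2 * w) ∎)
          where
          arith : ∀ a b c → a * b * c ≡ a * c * b
          arith = solve-∀
          arith₂ : ∀ Q w → (2 * w + 2 * w) * Q ≡ 4 * Q * w
          arith₂ = solve-∀
          2w≤h : 2 * w ≤ h
          2w≤h = ≤-trans (*-monoˡ-≤ w (≤-trans (s≤s (s≤s z≤n)) (m≤m*n 4 Q))) 4Qw≤h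
          2n< : 2 * n < 2 ^ (2 * w)
          2n< = ≤-<-trans (*-monoˡ-≤ n {2} {4} (s≤s (s≤s z≤n))) (<-≤-trans 4n<2^ℓ (^-monoʳ-≤ 2 (≤-trans ℓ≤w (m≤m+n w _))))

  abstract
    eventually-parameters : ∀ A′ → ∃ λ N → ∀ n → N ≤ n →
      ∃ λ s → Parameters n s × suc A′ * s ≤ n × n ≤ suc (suc A′) * s
    eventually-parameters A′ = threshold , λ n large → s n large , parameters n large , A*s≤n n large , n≤[1+A]*s n large
      where open Constants A′

-- Multigraphs as clique colourings, and assignments as lists of edges.

module Multigraphs where
  open RainbowMatchings using
    ( #; #-pick; #-unique; #-mono; #-≥1; sum-mono; 𝟙-mono
    ; CliqueColouring; IsRainbowMatching; missing; missing?; On )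
  open import Data.Nat hiding (_≟_)
  open import Data.Nat.Properties hiding (_≟_; suc-injective; 0≢1+n)
  open import Data.Fin using (Fin; zero; suc)
  open import Data.Fin.Properties using (_≟_)
  open import Data.Fin.Subset using (Subset; inside; outside; ⋃; ∣_∣; _∩_; Empty) renaming (_∈_ to _∈ˢ_)
  open import Data.Fin.Subset.Properties using (∉⊥; x∈p∪q⁻; x∈p∩q⁺) renaming (_∈?_ to _∈ˢ?_)
  open import Data.Vec using (_∷_; []; here; there)
  open import Data.List using ([]; _∷_; length; filter; tabulate)
  open import Data.List.Extrema.Nat using (xs≤max)
  open import Data.List.Membership.Propositional using (_∈_)
  open import Data.List.Membership.Propositional.Properties using (∈-cartesianProductWith⁺; ∈-allFin)
  open import Data.List.Properties using (length-tabulate; map-tabulate)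
  open import Data.List.Relation.Unary.All as All using (All; []; _∷_)
  open import Data.List.Relation.Unary.Any as Any using (Any; here; there)
  open import Data.List.Relation.Unary.AllPairs using (AllPairs; []; _∷_)
  open import Data.Rational using (ℚ)
  import Data.List.Relation.Unary.AllPairs.Properties as AllPairs
  import Data.List.Relation.Unary.Unique.Propositional.Properties as Unique
  open import Data.List.Relation.Unary.Unique.Propositional using (Unique)
  open import Data.Maybe using (just; nothing)
  open import Data.Product using (_×_; _,_; proj₂; ∃)
  open import Data.Sum using (inj₁; inj₂)
  open import Function using (_∘_; id)
  open import Function.Bundles using (Equivalence)
  open import Relation.Nullary using (Dec; yes; no; contradiction)
  open import Relation.Binary.PropositionalEquality

  ∣_∣≤# : ∀ {k} (p : Subset k) → ∣ p ∣ ≤ # (λ v → v ∈ˢ? p)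
  ∣ []          ∣≤# = z≤n
  ∣ inside  ∷ p ∣≤# = s≤s (≤-trans ∣ p ∣≤# (sum-mono λ v → 𝟙-mono (v ∈ˢ? p) (suc v ∈ˢ? (inside ∷ p)) there))
  ∣ outside ∷ p ∣≤# = ≤-trans ∣ p ∣≤# (sum-mono λ v → 𝟙-mono (v ∈ˢ? p) (suc v ∈ˢ? (outside ∷ p)) there)

  ∈⋃⁻ : ∀ {k} {v : Fin k} Ks → v ∈ˢ ⋃ Ks → Any (v ∈ˢ_) Ks
  ∈⋃⁻ []       v∈ = contradiction v∈ ∉⊥
  ∈⋃⁻ (K ∷ Ks) v∈ with x∈p∪q⁻ K (⋃ Ks) v∈
  ... | inj₁ p = here p
  ... | inj₂ q = there (∈⋃⁻ Ks q)

  other-member : ∀ {k} {v : Fin k} {K} → 2 ≤ ∣ K ∣ → ∃ λ w → w ∈ˢ K × w ≢ v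
  other-member {v = v} {K} le = #-pick (λ w → w ∈ˢ? K) (λ w → w ≟ v)
    (≤-trans (s≤s (#-unique (λ w → w ≟ v) λ _ _ p q → trans p (sym q))) (≤-trans le ∣ K ∣≤#))

  -- The cliques are disjoint and both witnesses contain `v`, so they sit at the same position of
  -- the list.
  common-clique : ∀ {k} {u v w : Fin k} {Ks} → AllPairs (λ K L → Empty (K ∩ L)) Ks →
    Any (λ K → u ∈ˢ K × v ∈ˢ K) Ks → Any (λ K → v ∈ˢ K × w ∈ˢ K) Ks → Any (λ K → u ∈ˢ K × w ∈ˢ K) Ks
  common-clique (ds ∷ dss) (here (u∈ , _)) (here (_ , w∈)) = here (u∈ , w∈)
  common-clique (ds ∷ dss) (there p)       (there q)       = there (common-clique dss p q)
  common-clique (ds ∷ dss) (here (_ , v∈)) (there q) with All.lookupAny ds q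
  ... | empty , v∈′ , _ = contradiction (_ , x∈p∩q⁺ (v∈ , v∈′)) empty
  common-clique (ds ∷ dss) (there p) (here (v∈ , _)) with All.lookupAny ds p
  ... | empty , _ , v∈′ = contradiction (_ , x∈p∩q⁺ (v∈ , v∈′)) empty

  #≤length-filter : ∀ {k} {A : Set} {Q : A → Set} (Q? : ∀ x → Dec (Q x)) (f : Fin k → A) →
    # (λ i → Q? (f i)) ≤ length (filter Q? (tabulate f))
  #≤length-filter {zero}  Q? f = z≤n
  #≤length-filter {suc k} Q? f with Q? (f zero)
  ... | yes _ = s≤s (#≤length-filter Q? (f ∘ suc))
  ... | no  _ = #≤length-filter Q? (f ∘ suc)

  module _ {n : ℕ} {v : ℚ} (G : ColouredMultigraph n) (G-cliques : Is⟨ n , v ⟩-multigraph G) where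
    open ColouredMultigraph G renaming (sym to joined-sym)
    open module Cliques c = IsDisjointUnionOfCliques (G-cliques c)

    colouring : CliqueColouring order n
    colouring = record
      { E       = Joined
      ; E?      = joined?
      ; E-sym   = λ {c} → joined-sym c
      ; E-irr   = λ {c} {u} → irrefl c u
      ; E-trans = λ {c} {u} {_} {w} e e′ u≢w → Equivalence.from (edges c u w)
          (u≢w , common-clique (disjoint c) (proj₂ (Equivalence.to (edges c u _) e)) (proj₂ (Equivalence.to (edges c _ w) e′))) }

    ∣⋃cliques∣≤coverage : ∀ c → ∣ ⋃ (cliques c) ∣ ≤ # (CliqueColouring.hasNeighbour? colouring c)
    ∣⋃cliques∣≤coverage c = ≤-trans ∣ ⋃ (cliques c) ∣≤#
      (#-mono (λ v → v ∈ˢ? ⋃ (cliques c)) (CliqueColouring.hasNeighbour? colouring c) neighbour)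
      where
      neighbour : ∀ v → v ∈ˢ ⋃ (cliques c) → ∃ λ w → Joined c v w
      neighbour v v∈ = 
        let K-any            = ∈⋃⁻ (cliques c) v∈
            size , v∈K       = All.lookupAny (size≥2 c) K-any
            w , w∈K , w≢v    = other-member size
        in w , Equivalence.from (edges c v w) (w≢v ∘ sym , Any.map (λ { refl → v∈K , w∈K }) (any-≡ K-any))
        where
        -- Pins the witness to the particular clique in which the second vertex `w` was found, so
        -- that both vertices are placed in the same clique.
        any-≡ : ∀ {Ks} (p : Any (v ∈ˢ_) Ks) → Any (Any.lookup p ≡_) Ks
        any-≡ (here _)  = here refl
        any-≡ (there p) = there (any-≡ p)

    colours≤multiplicity : ∀ x y → # (λ c → joined? c x y) ≤ multiplicity G
    colours≤multiplicity x y = ≤-trans (#≤length-filter (λ c → joined? c x y) id)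
      (All.lookup (xs≤max 0 _) (∈-cartesianProductWith⁺ (edgesBetween G) (∈-allFin x) (∈-allFin y)))

    has-rainbow-matching : (∃ λ μ → IsRainbowMatching colouring μ × missing μ ≡ 0) → HasRainbowMatchingOfSize G n
    has-rainbow-matching (μ , rainbow , full) =
        tabulate edge
      , AllPairs.tabulate⁺ (λ i≢j (z∈ , z∈′) → i≢j (IsRainbowMatching.disjoint rainbow (on z∈) (on z∈′)))
      , subst Unique (sym (map-tabulate edge Edge.colour)) (Unique.tabulate⁺ id)
      , length-tabulate edge
      where
      used : ∀ c → ∃ λ x → ∃ λ y → μ c ≡ just (x , y)
      used c = by (μ c) refl
        where
        by : ∀ o → μ c ≡ o → ∃ λ x → ∃ λ y → μ c ≡ just (x , y)
        by (just (x , y)) e = x , y , e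
        by nothing        e = contradiction (≤-trans (#-≥1 (missing? μ) c e) (≤-reflexive full)) λ ()
      edge : Fin n → Edge G
      edge c = let x , y , e = used c in
        record { colour = c ; end₁ = x ; end₂ = y ; joined = IsRainbowMatching.joined rainbow e }
      on : ∀ {c z} → z ∈ Edge.ends (edge c) → On z (μ c)
      on {c} {z} z∈ = subst (On z) (sym (proj₂ (proj₂ (used c)))) (ends z∈)
        where
        ends : z ∈ Edge.ends (edge c) → On z (just (Edge.end₁ (edge c) , Edge.end₂ (edge c)))
        ends (here e)         = inj₁ e
        ends (there (here e)) = inj₂ e

-- Clearing denominators.

module Rationals where
  open import Data.Nat as ℕ using (ℕ; suc)
  import Data.Nat.Properties as ℕ
  open import Data.Integer as ℤ using (ℤ; +_)
  import Data.Integer.Properties as ℤ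
  open import Data.Integer.Tactic.RingSolver using (solve-∀)
  open import Data.Rational as ℚ using (ℚ; mkℚ)
  import Data.Rational.Properties as ℚ
  open import Data.Rational.Unnormalised as ℚᵘ using (mkℚᵘ)
  import Data.Rational.Unnormalised.Properties as ℚᵘ
  open import Relation.Binary.PropositionalEquality
  open import Data.Nat.Coprimality using (Coprime)
  import Data.Nat.Tactic.RingSolver as ℕRing

  toℚᵘ-fromℕ : ∀ k → ℚ.toℚᵘ (fromℕ k) ℚᵘ.≃ mkℚᵘ (+ k) 0
  toℚᵘ-fromℕ k = ℚ.toℚᵘ-fromℚᵘ (mkℚᵘ (+ k) 0)

  module _ (j n : ℕ) (δ : ℚ) where
    toℚᵘ-[j-δ]*n : ℚ.toℚᵘ ((fromℕ j ℚ.- δ) ℚ.* fromℕ n) ℚᵘ.≃ (mkℚᵘ (+ j) 0 ℚᵘ.- ℚ.toℚᵘ δ) ℚᵘ.* mkℚᵘ (+ n) 0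
    toℚᵘ-[j-δ]*n = ℚᵘ.≃-trans (ℚ.toℚᵘ-homo-* (fromℕ j ℚ.- δ) (fromℕ n))
      (ℚᵘ.*-cong (ℚᵘ.≃-trans (ℚ.toℚᵘ-homo-+ (fromℕ j) (ℚ.- δ)) (ℚᵘ.+-cong (toℚᵘ-fromℕ j) (ℚ.toℚᵘ-homo‿- δ))) (toℚᵘ-fromℕ n))

  module _ (j n m a d : ℕ) .(c : Coprime a (suc d)) where
    private
      δ = mkℚ (+ a) d c
      arith₁ : ∀ m d a n → (+ m ℤ.* + d) ℤ.+ (+ a ℤ.* + n) ≡ + (m ℕ.* d ℕ.+ a ℕ.* n)
      arith₁ m d a n = trans (cong₂ ℤ._+_ (sym (ℤ.pos-* m d)) (sym (ℤ.pos-* a n))) (sym (ℤ.pos-+ (m ℕ.* d) (a ℕ.* n)))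
      arith₂ : ∀ j d a n → (j ℤ.* d ℤ.+ (ℤ.- a) ℤ.* + 1) ℤ.* n ℤ.* + 1 ℤ.+ a ℤ.* n ≡ j ℤ.* d ℤ.* n
      arith₂ = solve-∀
      arith₃ : ∀ j d n → + j ℤ.* + d ℤ.* + n ≡ + (j ℕ.* d ℕ.* n)
      arith₃ j d n = trans (cong (ℤ._* + n) (sym (ℤ.pos-* j d))) (sym (ℤ.pos-* (j ℕ.* d) n))
      den : ℚᵘ.↧ ((mkℚᵘ (+ j) 0 ℚᵘ.- ℚ.toℚᵘ δ) ℚᵘ.* mkℚᵘ (+ n) 0) ≡ + suc d
      den = cong +_ (trans (ℕ.*-identityʳ (suc (d ℕ.+ 0))) (cong suc (ℕ.+-identityʳ d)))
      num : ℚᵘ.↥ ((mkℚᵘ (+ j) 0 ℚᵘ.- ℚ.toℚᵘ δ) ℚᵘ.* mkℚᵘ (+ n) 0) ℤ.* + 1 ℤ.+ + a ℤ.* + n ≡ + (j ℕ.* suc d ℕ.* n)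
      num = trans (arith₂ (+ j) (+ suc d) (+ a) (+ n)) (arith₃ j (suc d) n)
      left : + m ℤ.* ℚᵘ.↧ ((mkℚᵘ (+ j) 0 ℚᵘ.- ℚ.toℚᵘ δ) ℚᵘ.* mkℚᵘ (+ n) 0) ℤ.+ + a ℤ.* + n ≡ + (m ℕ.* suc d ℕ.+ a ℕ.* n)
      left = trans (cong (λ x → + m ℤ.* x ℤ.+ + a ℤ.* + n) den) (arith₁ m (suc d) a n)

    -- With δ = a / (d + 1), both sides are multiplied by d + 1 and `a * n` is moved to the other
    -- side, so that an inequality without subtraction remains in ℕ.
    clear-upper : fromℕ m ℚ.≤ (fromℕ j ℚ.- δ) ℚ.* fromℕ n → m ℕ.* suc d ℕ.+ a ℕ.* n ℕ.≤ j ℕ.* suc d ℕ.* n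
    clear-upper le = ℤ.drop‿+≤+ (subst₂ ℤ._≤_ left num (ℤ.+-monoˡ-≤ (+ a ℤ.* + n) (ℚᵘ.drop-*≤*
      (ℚᵘ.≤-respˡ-≃ (toℚᵘ-fromℕ m) (ℚᵘ.≤-respʳ-≃ (toℚᵘ-[j-δ]*n j n δ) (ℚ.toℚᵘ-mono-≤ le))))))

    clear-lower : (fromℕ j ℚ.- δ) ℚ.* fromℕ n ℚ.≤ fromℕ m → j ℕ.* suc d ℕ.* n ℕ.≤ m ℕ.* suc d ℕ.+ a ℕ.* n
    clear-lower le = ℤ.drop‿+≤+ (subst₂ ℤ._≤_ num left (ℤ.+-monoˡ-≤ (+ a ℤ.* + n) (ℚᵘ.drop-*≤*
      (ℚᵘ.≤-respˡ-≃ (toℚᵘ-[j-δ]*n j n δ) (ℚᵘ.≤-respʳ-≃ (toℚᵘ-fromℕ m) (ℚ.toℚᵘ-mono-≤ le))))))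

  -- For δ′ = 1 / (A + 1) the deficit δ′n is at most `s`.
  coverage-arithmetic : ∀ {n s t} A → n ℕ.≤ suc A ℕ.* s → 3 ℕ.* suc A ℕ.* n ℕ.≤ t ℕ.* suc A ℕ.+ 1 ℕ.* n → 3 ℕ.* n ℕ.≤ t ℕ.+ s
  coverage-arithmetic {n} {s} {t} A n≤ le = ℕ.*-cancelˡ-≤ (suc A) (begin
    suc A ℕ.* (3 ℕ.* n)              ≡⟨ arith₁ (suc A) n ⟩
    3 ℕ.* suc A ℕ.* n                ≤⟨ le ⟩
    t ℕ.* suc A ℕ.+ 1 ℕ.* n          ≡⟨ cong (t ℕ.* suc A ℕ.+_) (ℕ.*-identityˡ n) ⟩
    t ℕ.* suc A ℕ.+ n                ≤⟨ ℕ.+-monoʳ-≤ (t ℕ.* suc A) n≤ ⟩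
    t ℕ.* suc A ℕ.+ suc A ℕ.* s      ≡⟨ arith₂ t (suc A) s ⟩
    suc A ℕ.* (t ℕ.+ s)              ∎)
    where
    open ℕ.≤-Reasoning
    arith₁ : ∀ a n → a ℕ.* (3 ℕ.* n) ≡ 3 ℕ.* a ℕ.* n
    arith₁ = ℕRing.solve-∀
    arith₂ : ∀ t a s → t ℕ.* a ℕ.+ a ℕ.* s ≡ a ℕ.* (t ℕ.+ s)
    arith₂ = ℕRing.solve-∀

  -- The numerator of δ being positive, δn is at least n / (d + 1), hence at least 15s.
  multiplicity-arithmetic : ∀ {n s m} a d → 15 ℕ.* suc d ℕ.* s ℕ.≤ n →
    m ℕ.* suc d ℕ.+ suc a ℕ.* n ℕ.≤ 1 ℕ.* suc d ℕ.* n → m ℕ.+ 15 ℕ.* s ℕ.≤ n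
  multiplicity-arithmetic {n} {s} {m} a d ≤n le = ℕ.*-cancelˡ-≤ (suc d) (begin
    suc d ℕ.* (m ℕ.+ 15 ℕ.* s)              ≡⟨ arith (suc d) m s ⟩
    m ℕ.* suc d ℕ.+ 15 ℕ.* suc d ℕ.* s      ≤⟨ ℕ.+-monoʳ-≤ (m ℕ.* suc d) ≤n ⟩
    m ℕ.* suc d ℕ.+ n                       ≤⟨ ℕ.+-monoʳ-≤ (m ℕ.* suc d) (ℕ.m≤m+n n (a ℕ.* n)) ⟩
    m ℕ.* suc d ℕ.+ suc a ℕ.* n             ≤⟨ le ⟩
    1 ℕ.* suc d ℕ.* n                       ≡⟨ cong (ℕ._* n) (ℕ.*-identityˡ (suc d)) ⟩
    suc d ℕ.* n                             ∎)
    where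
    open ℕ.≤-Reasoning
    arith : ∀ d m s → d ℕ.* (m ℕ.+ 15 ℕ.* s) ≡ m ℕ.* d ℕ.+ 15 ℕ.* d ℕ.* s
    arith = ℕRing.solve-∀

-- The choice of δ′ from δ.

open import Data.Nat as ℕ using (ℕ)
open import Data.Product using (_×_; ∃-syntax)
open import Data.Rational using (ℚ; 0ℚ; 1ℚ; _<_; _≤_; _-_; _*_)
open import Data.Integer using (+_; -[1+_])
open import Data.Nat using (zero; suc)
open import Data.Nat.Coprimality using (1-coprimeTo)
import Data.Nat.Properties as ℕ
open import Data.Rational.Properties using (positive⁻¹)
open import Data.Product using (_,_; proj₁; proj₂)
open import Data.Fin.Subset using (⋃; ∣_∣)
open import Data.Rational using (mkℚ; positive)

theorem3p2 : ∀ (δ : ℚ) → 0ℚ < δ →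
    ∃[ δ′ ] (0ℚ < δ′ × ∃[ N ] (∀ (n : ℕ) → N ℕ.≤ n →
    ∀ (G : ColouredMultigraph n) →
    Is⟨ n , (fromℕ 3 - δ′) * fromℕ n ⟩-multigraph G →
    fromℕ (multiplicity G) ≤ (1ℚ - δ) * fromℕ n →
    HasRainbowMatchingOfSize G n))
theorem3p2 (mkℚ (+ suc a) d c) _ =
  δ′ , positive⁻¹ δ′ , proj₁ (eventually-parameters A′) , λ n large G cliques few →
    let s , parameters , A*s≤n , n≤[1+A]*s = proj₂ (eventually-parameters A′) n large in
    has-rainbow-matching G cliques (full-rainbow-matching parameters (colouring G cliques)
      (λ k → enough n s G cliques n≤[1+A]*s k)
      (colours≤multiplicity G cliques)
      (multiplicity-arithmetic {n} {s} {multiplicity G} a d A*s≤n (clear-upper 1 n (multiplicity G) (suc a) d c few)))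
  where
  open RainbowMatchings using (full-rainbow-matching; eventually-parameters; #; CliqueColouring)
  open Multigraphs
  open Rationals
  -- Chosen so that `suc A′` is 15 * suc d; then `A*s≤n` is literally the bound on 15s that
  -- `multiplicity-arithmetic` takes.
  A′ = d ℕ.+ 14 ℕ.* suc d
  A  = suc A′
  δ′ : ℚ
  δ′ = mkℚ (+ 1) A (1-coprimeTo (suc A))
  enough : ∀ n s (G : ColouredMultigraph n) (cliques : Is⟨ n , (fromℕ 3 - δ′) * fromℕ n ⟩-multigraph G) →
    n ℕ.≤ suc A ℕ.* s → ∀ k → 3 ℕ.* n ℕ.≤ # (CliqueColouring.hasNeighbour? (colouring G cliques) k) ℕ.+ s
  enough n s G cliques n≤ k = ℕ.≤-trans
    (coverage-arithmetic {n} {s} {covered} A n≤ (clear-lower 3 n covered 1 A (1-coprimeTo (suc A)) total≥v))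
    (ℕ.+-monoˡ-≤ s (∣⋃cliques∣≤coverage G cliques k))
    where
    open IsDisjointUnionOfCliques (cliques k) using (total≥v)
    covered = ∣ ⋃ (IsDisjointUnionOfCliques.cliques (cliques k)) ∣
theorem3p2 (mkℚ (+ zero) d c) δ>0 with () ← positive δ>0
theorem3p2 (mkℚ -[1+ a ] d c) δ>0 with () ← positive δ>0
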